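{- Let $G$ be a finite group. Then there is an integer $M_G$ such that for every integer $u \geq M_G$ with $u \equiv 1$ or $3 \pmod 6$ there is a Steiner triple system $U$ on $u$ points whose full automorphism group $\mathrm{Aut}\,U$ is isomorphic to $G$.
   Context: A Steiner triple system (STS) is a finite set of points together with a collection of 3-element subsets (triples) such that every pair of distinct points lies in exactly one triple. $\mathrm{Aut}\,U$ denotes the group of permutations of the points of $U$ mapping triples to triples. -}

module Defs where

open import Level using (Level; _⊔_) renaming (suc to lsuc)
open import Data.Nat using (ℕ)
open import Data.Bool using (Bool)
open import Data.Fin using (Fin)
open import Data.Fin.Subset using (Subset; _∈_; ∣_∣)
open import Data.Fin.Permutation using (Permutation′; _⟨$⟩ʳ_; _⟨$⟩ˡ_; inverseˡ; inverseʳ; id; flip; _∘ₚ_)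
open import Data.Vec using (Vec; tabulate; lookup)
open import Data.Vec.Properties using (lookup∘tabulate; tabulate∘lookup; tabulate-cong)
open import Data.Product using (Σ; ∃; ∃!; _×_; _,_; proj₁; proj₂)
open import Function.Bundles using (_⇔_; mk⇔; Equivalence; Inverse)
open import Algebra.Bundles using (Group)
open import Algebra.Bundles.Raw using (RawGroup)
open import Relation.Binary.PropositionalEquality
  using (_≡_; _≢_; refl; sym; trans; cong; subst; setoid)

record STS (u : ℕ) : Set₁ where
  field
    Block        : Subset u → Set
    block-size   : ∀ b → Block b → ∣ b ∣ ≡ 3
    unique-block : ∀ (x y : Fin u) → x ≢ y →
                   ∃! _≡_ (λ b → Block b × x ∈ b × y ∈ b)

image : ∀ {u} → Permutation′ u → Subset u → Subset u
image π b = tabulate (λ i → lookup b (π ⟨$⟩ˡ i))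

IsAut : ∀ {u} → STS u → Permutation′ u → Set
IsAut U π = ∀ b → Block b ⇔ Block (image π b)
  where open STS U

Aut : ∀ {u} → STS u → Set
Aut {u} U = Σ (Permutation′ u) (IsAut U)

_≈ᴬ_ : ∀ {u} {U : STS u} → Aut U → Aut U → Set
(π , _) ≈ᴬ (ρ , _) = ∀ i → π ⟨$⟩ʳ i ≡ ρ ⟨$⟩ʳ i

private
  image-∘ : ∀ {u} (π ρ : Permutation′ u) b →
            image π (image ρ b) ≡ image (ρ ∘ₚ π) b
  image-∘ π ρ b = tabulate-cong (λ i → lookup∘tabulate _ (π ⟨$⟩ˡ i))

  image-id : ∀ {u} b → image (id {u}) b ≡ b
  image-id b = tabulate∘lookup b

  image-inv : ∀ {u} (π : Permutation′ u) b → image π (image (flip π) b) ≡ b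
  image-inv π b = trans (tabulate-cong (λ i →
      trans (lookup∘tabulate _ (π ⟨$⟩ˡ i)) (cong (lookup b) (inverseʳ π))))
    (tabulate∘lookup b)

module _ {u} (U : STS u) where
  open STS U

  private
    tr : ∀ {b c} → b ≡ c → Block b ⇔ Block c
    tr refl = mk⇔ (λ x → x) (λ x → x)

    _∘⇔_ : ∀ {A B C : Set} → B ⇔ C → A ⇔ B → A ⇔ C
    g ∘⇔ f = mk⇔ (λ a → Equivalence.to g (Equivalence.to f a))
                 (λ c → Equivalence.from f (Equivalence.from g c))

    sym⇔ : ∀ {A B : Set} → A ⇔ B → B ⇔ A
    sym⇔ f = mk⇔ (Equivalence.from f) (Equivalence.to f)

  -- group operation: (π ∙ ρ) x = π (ρ x)
  _∙ᴬ_ : Aut U → Aut U → Aut U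
  (π , p) ∙ᴬ (ρ , r) = ρ ∘ₚ π , λ b → tr (image-∘ π ρ b) ∘⇔ (p (image ρ b) ∘⇔ r b)

  εᴬ : Aut U
  εᴬ = id , λ b → tr (sym (image-id b))

  _⁻¹ᴬ : Aut U → Aut U
  (π , p) ⁻¹ᴬ = flip π , λ b →
    sym⇔ (tr (image-inv π b) ∘⇔ p (image (flip π) b))

  -- Aut U, the full automorphism group of U (as a raw group; the
  -- statement only needs its operations to speak of an isomorphism).
  AutGroup : RawGroup Level.zero Level.zero
  AutGroup = record
    { Carrier = Aut U
    ; _≈_     = _≈ᴬ_ {U = U}
    ; _∙_     = _∙ᴬ_
    ; ε       = εᴬ
    ; _⁻¹     = _⁻¹ᴬ
    }

IsFinite : ∀ {c ℓ} → Group c ℓ → Set (c ⊔ ℓ)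
IsFinite G = ∃ λ n → Inverse (Group.setoid G) (setoid (Fin n))

{-# OPTIONS --safe #-}

-- A triple system is treated as a Steiner quasigroup. Let V be the projective space of
-- three copies of the regular representation of G over the field of two elements, its
-- points coloured by the G-orbits, and let T = Z₂ × Z₃ × Z_b with b prime to 6. The
-- points of U are Y ∪ (V × T): the triples meeting three places of V are given by
-- i + j + k = 0 over the lines of V, and each place carries a copy of one system on
-- Y ∪ T, in which the colour of the place is written. The order |Y| + 6 b |V| takes all
-- large admissible values with |Y| bounded and b growing.
--
-- The point ∞ of Y that acts on T as translation by (1, 0, 0) satisfies
-- ∞ (p q) = (∞ p) q for all p and q over different places, and no other point does so
-- nearly as often. Hence automorphisms fix ∞, then Y, and then permute the fibres over
-- V. The triples across fibres make them affine on T, the fibre admits no affine map but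
-- the identity, and what remains is a collineation of V that preserves every G-orbit;
-- such a collineation lies in G.
module Submission where

open import Defs
open import Level using (Level)
open import Data.Nat using (ℕ; zero; suc; _≤_; _<_; s≤s; z≤n; _∸_; _^_; _%_; _/_; NonZero; >-nonZero; >-nonZero⁻¹)
  renaming (_+_ to _+ℕ_; _*_ to _*ℕ_)
import Data.Nat.Properties as ℕₚ
import Data.Nat.DivMod as DivMod
open import Data.Nat.DivMod using (_mod_; %-distribˡ-+; m<n⇒m%n≡m; m%n<n; m*n%n≡0; n%n≡0)
open import Data.Nat.Solver using (module +-*-Solver)
open import Data.Fin using (Fin; zero; suc; toℕ)
import Data.Fin as Fin
import Data.Fin.Properties as Finₚ
open import Data.Fin.Patterns using (0F; 1F; 2F; 3F; 4F)
open import Data.Fin.Permutation using (Permutation′; permutation; _⟨$⟩ʳ_; _⟨$⟩ˡ_; flip)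
  renaming (inverseˡ to perm-inverseˡ; inverseʳ to perm-inverseʳ)
open import Data.Fin.Subset using (Subset; _∈_; _∉_; _⊆_; ∣_∣; ⁅_⁆; _∪_)
open import Data.Fin.Subset.Properties
  using (x∈⁅x⁆; x∈⁅y⁆⇒x≡y; x∈p∪q⁻; x∈p∪q⁺; ∣⁅x⁆∣≡1; ∪-identityˡ; ⊆-antisym; p⊂q⇒∣p∣<∣q∣; _∈?_)
open import Data.Bool using (Bool; true; false; not; _xor_; _∧_; _∨_; if_then_else_)
  renaming (T to IsTrue)
import Data.Bool.Properties as Boolₚ
open import Data.Unit using (⊤; tt)
open import Data.Empty using (⊥; ⊥-elim)
open import Data.Sum using (_⊎_; inj₁; inj₂)
import Data.Sum.Properties as Sumₚ
open import Data.Sum.Properties using (inj₁-injective)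
open import Data.Sum.Function.Propositional using (_⊎-↔_)
open import Data.Product using (_×_; _,_; proj₁; proj₂; ∃; ∃₂; Σ)
import Data.Product.Properties as Productₚ
open import Data.Product.Function.NonDependent.Propositional using (_×-↔_)
open import Data.Vec using (Vec; []; _∷_; here; there; lookup; zipWith; replicate; tabulate)
import Data.Vec.Properties as Vecₚ
open import Data.Vec.Properties using (lookup∘tabulate; tabulate∘lookup; tabulate-cong; lookup⇒[]=; []=⇒lookup)
open import Function.Bundles using (_↔_; mk↔ₛ′; mk⇔; Equivalence; Inverse)
open import Function.Properties.Inverse using (↔-refl; ↔-sym; ↔-trans)
open import Algebra.Bundles using (Group)
import Algebra.Properties.Group as GroupProperties
open import Algebra.Morphism.Structures using (module GroupMorphisms)
open import Relation.Nullary using (¬_; Dec; yes; no; does; isNo)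
open import Relation.Nullary.Decidable
  using (False; fromWitnessFalse; toWitnessFalse; toWitness; does-⇔; dec-true; map′; _×-dec_)
open import Relation.Binary using (DecidableEquality)
open import Relation.Binary.PropositionalEquality

-- Without the points of `K × Fin 3` the order would be e + 6 b |V|, which misses most admissible
-- values. With |K| = 2 r they add 6 r, at the price of perfect matchings of `T` that Bose's triples
-- must leave free; the difference set says where. As r stays bounded, b outgrows |Y|, and `Y` is
-- detected by counting: some coordinate in `B` avoids any |Y| exceptions, and `B` does not embed in
-- `Y`. Since b is prime to 6, an additive bijection of `T` respects its three factors, and each is
-- pinned separately: Z₂ by ∞, Z₃ by the upward direction of Bose's triples, Z_b by a switch. Over a
-- pair outside the difference set the four triples form a Pasch configuration, which can be
-- exchanged for the opposite one without affecting any triple that meets `Y`. One switch, at {0, 1}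
-- and common to all places, fixes the multiplier on Z_b; another, at {0, c}, writes the colour c.
-- Hence 1 and all colours are kept out of the difference set, while 2 belongs to it, so that the
-- involutions of `Y` connect `T`.

-- Abelian groups and a solver for their identities

record AbGroup (A : Set) : Set where
  infixl 6 _+_
  infix 8 -_
  field
    _+_ : A → A → A
    0#  : A
    -_  : A → A
    +-assoc     : ∀ x y z → (x + y) + z ≡ x + (y + z)
    +-comm      : ∀ x y → x + y ≡ y + x
    +-identityˡ : ∀ x → 0# + x ≡ x
    +-inverseˡ  : ∀ x → - x + x ≡ 0#

  open ≡-Reasoning

  +-identityʳ : ∀ x → x + 0# ≡ x
  +-identityʳ x = trans (+-comm x 0#) (+-identityˡ x)

  +-inverseʳ : ∀ x → x + - x ≡ 0#
  +-inverseʳ x = trans (+-comm x (- x)) (+-inverseˡ x)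

  +-cancelʳ : ∀ {x y} z → x + z ≡ y + z → x ≡ y
  +-cancelʳ {x} {y} z eq = begin
    x              ≡⟨ sym (+-identityʳ x) ⟩
    x + 0#         ≡⟨ cong (x +_) (sym (+-inverseʳ z)) ⟩
    x + (z + - z)  ≡⟨ sym (+-assoc x z (- z)) ⟩
    x + z + - z    ≡⟨ cong (_+ - z) eq ⟩
    y + z + - z    ≡⟨ +-assoc y z (- z) ⟩
    y + (z + - z)  ≡⟨ cong (y +_) (+-inverseʳ z) ⟩
    y + 0#         ≡⟨ +-identityʳ y ⟩
    y ∎

  +-interchange : ∀ a b c d → (a + b) + (c + d) ≡ (a + c) + (b + d)
  +-interchange a b c d = begin
    (a + b) + (c + d)  ≡⟨ +-assoc a b (c + d) ⟩
    a + (b + (c + d))  ≡⟨ cong (a +_) (sym (+-assoc b c d)) ⟩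
    a + ((b + c) + d)  ≡⟨ cong (λ w → a + (w + d)) (+-comm b c) ⟩
    a + ((c + b) + d)  ≡⟨ cong (a +_) (+-assoc c b d) ⟩
    a + (c + (b + d))  ≡⟨ sym (+-assoc a c (b + d)) ⟩
    (a + c) + (b + d) ∎

  infixr 7 _×ₙ_
  _×ₙ_ : ℕ → A → A
  zero  ×ₙ x = 0#
  suc k ×ₙ x = x + k ×ₙ x

  ×ₙ-homo-+ : ∀ k l x → (k +ℕ l) ×ₙ x ≡ k ×ₙ x + l ×ₙ x
  ×ₙ-homo-+ zero    l x = sym (+-identityˡ _)
  ×ₙ-homo-+ (suc k) l x = trans (cong (x +_) (×ₙ-homo-+ k l x)) (sym (+-assoc x _ _))

data Expr (n : ℕ) : Set where
  var : Fin n → Expr n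
  𝟘   : Expr n
  _⊕_ : Expr n → Expr n → Expr n
  ⊖_  : Expr n → Expr n
infixl 6 _⊕_
infix 8 ⊖_

v₀ : ∀ {n} → Expr (suc n)
v₀ = var zero
v₁ : ∀ {n} → Expr (suc (suc n))
v₁ = var (suc zero)
v₂ : ∀ {n} → Expr (suc (suc (suc n)))
v₂ = var (suc (suc zero))
v₃ : ∀ {n} → Expr (suc (suc (suc (suc n))))
v₃ = var (suc (suc (suc zero)))
zeros : ∀ {n} → Vec ℕ n
zeros = replicate _ 0

unit : ∀ {n} → Fin n → Vec ℕ n
unit zero    = 1 ∷ zeros
unit (suc i) = 0 ∷ unit i

_⊞_ : ∀ {n} → Vec ℕ n → Vec ℕ n → Vec ℕ n
_⊞_ = zipWith _+ℕ_

-- An expression is brought to the form P − N; two expressions agree in every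
-- abelian group as soon as P₁ + N₂ and P₂ + N₁ are the same vector over ℕ.
posPart negPart : ∀ {n} → Expr n → Vec ℕ n
posPart (var i) = unit i
posPart 𝟘       = zeros
posPart (d ⊕ e) = posPart d ⊞ posPart e
posPart (⊖ e)   = negPart e
negPart (var i) = zeros
negPart 𝟘       = zeros
negPart (d ⊕ e) = negPart d ⊞ negPart e
negPart (⊖ e)   = posPart e

module Solver {A : Set} (G : AbGroup A) where
  open AbGroup G
  open ≡-Reasoning

  ⟦_⟧ : ∀ {n} → Expr n → Vec A n → A
  ⟦ var i ⟧ ρ = lookup ρ i
  ⟦ 𝟘 ⟧ ρ     = 0#
  ⟦ d ⊕ e ⟧ ρ = ⟦ d ⟧ ρ + ⟦ e ⟧ ρ
  ⟦ ⊖ e ⟧ ρ   = - ⟦ e ⟧ ρ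

  comb : ∀ {n} → Vec ℕ n → Vec A n → A
  comb []       []      = 0#
  comb (k ∷ ks) (x ∷ ρ) = k ×ₙ x + comb ks ρ

  comb-zeros : ∀ {n} (ρ : Vec A n) → comb zeros ρ ≡ 0#
  comb-zeros []      = refl
  comb-zeros (x ∷ ρ) = trans (+-identityˡ _) (comb-zeros ρ)

  comb-unit : ∀ {n} (i : Fin n) ρ → comb (unit i) ρ ≡ lookup ρ i
  comb-unit zero    (x ∷ ρ) =
    trans (cong₂ _+_ (+-identityʳ x) (comb-zeros ρ)) (+-identityʳ x)
  comb-unit (suc i) (x ∷ ρ) = trans (+-identityˡ _) (comb-unit i ρ)

  comb-⊞ : ∀ {n} ks ls (ρ : Vec A n) → comb (ks ⊞ ls) ρ ≡ comb ks ρ + comb ls ρ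
  comb-⊞ []       []       []      = sym (+-identityˡ 0#)
  comb-⊞ (k ∷ ks) (l ∷ ls) (x ∷ ρ) =
    trans (cong₂ _+_ (×ₙ-homo-+ k l x) (comb-⊞ ks ls ρ))
          (+-interchange (k ×ₙ x) (l ×ₙ x) (comb ks ρ) (comb ls ρ))

  -- The form value + N = P avoids subtraction, so that the coefficients in `comb` can be natural
  -- numbers; the case `⊖` merely exchanges the two parts.
  sound : ∀ {n} (e : Expr n) ρ → ⟦ e ⟧ ρ + comb (negPart e) ρ ≡ comb (posPart e) ρ
  sound (var i) ρ = trans (cong (lookup ρ i +_) (comb-zeros ρ))
                          (trans (+-identityʳ _) (sym (comb-unit i ρ)))
  sound 𝟘       ρ = +-identityˡ _
  sound (d ⊕ e) ρ = begin
    (⟦ d ⟧ ρ + ⟦ e ⟧ ρ) + comb (negPart d ⊞ negPart e) ρ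
      ≡⟨ cong (⟦ d ⊕ e ⟧ ρ +_) (comb-⊞ (negPart d) (negPart e) ρ) ⟩
    (⟦ d ⟧ ρ + ⟦ e ⟧ ρ) + (comb (negPart d) ρ + comb (negPart e) ρ)
      ≡⟨ +-interchange _ _ _ _ ⟩
    (⟦ d ⟧ ρ + comb (negPart d) ρ) + (⟦ e ⟧ ρ + comb (negPart e) ρ)
      ≡⟨ cong₂ _+_ (sound d ρ) (sound e ρ) ⟩
    comb (posPart d) ρ + comb (posPart e) ρ
      ≡⟨ sym (comb-⊞ (posPart d) (posPart e) ρ) ⟩
    comb (posPart d ⊞ posPart e) ρ ∎
  sound (⊖ e) ρ = begin
    - x + comb (posPart e) ρ        ≡⟨ cong (- x +_) (sym (sound e ρ)) ⟩
    - x + (x + comb (negPart e) ρ)  ≡⟨ sym (+-assoc (- x) x _) ⟩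
    (- x + x) + comb (negPart e) ρ  ≡⟨ cong (_+ comb (negPart e) ρ) (+-inverseˡ x) ⟩
    0# + comb (negPart e) ρ         ≡⟨ +-identityˡ _ ⟩
    comb (negPart e) ρ ∎
    where x = ⟦ e ⟧ ρ

  -- The premise compares closed vectors of numbers, so `refl` settles it at every use.
  prove : ∀ {n} (ρ : Vec A n) (d e : Expr n) →
          posPart d ⊞ negPart e ≡ posPart e ⊞ negPart d → ⟦ d ⟧ ρ ≡ ⟦ e ⟧ ρ
  prove ρ d e eq = +-cancelʳ (comb (negPart d) ρ + comb (negPart e) ρ) (begin
    ⟦ d ⟧ ρ + (comb (negPart d) ρ + comb (negPart e) ρ)
      ≡⟨ sym (+-assoc _ _ _) ⟩
    ⟦ d ⟧ ρ + comb (negPart d) ρ + comb (negPart e) ρ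
      ≡⟨ cong (_+ comb (negPart e) ρ) (sound d ρ) ⟩
    comb (posPart d) ρ + comb (negPart e) ρ
      ≡⟨ sym (comb-⊞ (posPart d) (negPart e) ρ) ⟩
    comb (posPart d ⊞ negPart e) ρ
      ≡⟨ cong (λ ks → comb ks ρ) eq ⟩
    comb (posPart e ⊞ negPart d) ρ
      ≡⟨ comb-⊞ (posPart e) (negPart d) ρ ⟩
    comb (posPart e) ρ + comb (negPart d) ρ
      ≡⟨ cong (_+ comb (negPart d) ρ) (sym (sound e ρ)) ⟩
    ⟦ e ⟧ ρ + comb (negPart e) ρ + comb (negPart d) ρ
      ≡⟨ +-assoc _ _ _ ⟩
    ⟦ e ⟧ ρ + (comb (negPart e) ρ + comb (negPart d) ρ)
      ≡⟨ cong (⟦ e ⟧ ρ +_) (+-comm _ _) ⟩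
    ⟦ e ⟧ ρ + (comb (negPart d) ρ + comb (negPart e) ρ) ∎)

xorGroup : AbGroup Bool
xorGroup = record
  { _+_ = _xor_ ; 0# = false ; -_ = λ b → b
  ; +-assoc = Boolₚ.xor-assoc ; +-comm = Boolₚ.xor-comm
  ; +-identityˡ = Boolₚ.xor-identityˡ ; +-inverseˡ = Boolₚ.xor-same }

infixr 5 _×ᴳ_
_×ᴳ_ : ∀ {A B} → AbGroup A → AbGroup B → AbGroup (A × B)
G ×ᴳ H = record
  { _+_ = λ p q → proj₁ p G.+ proj₁ q , proj₂ p H.+ proj₂ q
  ; 0#  = G.0# , H.0#
  ; -_  = λ p → G.- proj₁ p , H.- proj₂ p
  ; +-assoc     = λ p q r → cong₂ _,_ (G.+-assoc _ _ _) (H.+-assoc _ _ _)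
  ; +-comm      = λ p q → cong₂ _,_ (G.+-comm _ _) (H.+-comm _ _)
  ; +-identityˡ = λ p → cong₂ _,_ (G.+-identityˡ _) (H.+-identityˡ _)
  ; +-inverseˡ  = λ p → cong₂ _,_ (G.+-inverseˡ _) (H.+-inverseˡ _) }
  where module G = AbGroup G
        module H = AbGroup H

-- Cyclic groups

module Cyclic (n : ℕ) where
  open ≡-Reasoning

  b : ℕ
  b = suc n

  ι : ℕ → Fin b
  ι k = k mod b

  toℕ-ι : ∀ k → toℕ (ι k) ≡ k % b
  toℕ-ι k = Finₚ.toℕ-fromℕ< (m%n<n k b)

  ι-toℕ : ∀ x → ι (toℕ x) ≡ x
  ι-toℕ x = Finₚ.toℕ-injective (trans (toℕ-ι (toℕ x)) (m<n⇒m%n≡m (Finₚ.toℕ<n x)))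

  ι-cong-% : ∀ {k l} → k % b ≡ l % b → ι k ≡ ι l
  ι-cong-% {k} {l} eq = Finₚ.toℕ-injective (trans (toℕ-ι k) (trans eq (sym (toℕ-ι l))))

  _+ᶻ_ : Fin b → Fin b → Fin b
  x +ᶻ y = ι (toℕ x +ℕ toℕ y)

  ι-+ : ∀ k l → ι (k +ℕ l) ≡ ι k +ᶻ ι l
  ι-+ k l = ι-cong-% {k +ℕ l} {toℕ (ι k) +ℕ toℕ (ι l)} (begin
    (k +ℕ l) % b                       ≡⟨ %-distribˡ-+ k l b ⟩
    (k % b +ℕ l % b) % b             ≡⟨ cong₂ (λ x y → (x +ℕ y) % b) (sym (toℕ-ι k)) (sym (toℕ-ι l)) ⟩
    (toℕ (ι k) +ℕ toℕ (ι l)) % b ∎)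

  -ᶻ_ : Fin b → Fin b
  -ᶻ x = ι (b ∸ toℕ x)

  group : AbGroup (Fin b)
  group = record
    { _+_ = _+ᶻ_ ; 0# = ι 0 ; -_ = -ᶻ_
    ; +-assoc = λ x y z → begin
        (x +ᶻ y) +ᶻ z                        ≡⟨ cong ((x +ᶻ y) +ᶻ_) (sym (ι-toℕ z)) ⟩
        ι (toℕ x +ℕ toℕ y) +ᶻ ι (toℕ z)      ≡⟨ sym (ι-+ (toℕ x +ℕ toℕ y) (toℕ z)) ⟩
        ι (toℕ x +ℕ toℕ y +ℕ toℕ z)          ≡⟨ cong ι (ℕₚ.+-assoc (toℕ x) (toℕ y) (toℕ z)) ⟩
        ι (toℕ x +ℕ (toℕ y +ℕ toℕ z))        ≡⟨ ι-+ (toℕ x) (toℕ y +ℕ toℕ z) ⟩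
        ι (toℕ x) +ᶻ (y +ᶻ z)                ≡⟨ cong (_+ᶻ (y +ᶻ z)) (ι-toℕ x) ⟩
        x +ᶻ (y +ᶻ z) ∎
    ; +-comm = λ x y → cong ι (ℕₚ.+-comm (toℕ x) (toℕ y))
    ; +-identityˡ = λ x → ι-toℕ x
    ; +-inverseˡ = λ x → begin
        ι (b ∸ toℕ x) +ᶻ x              ≡⟨ cong (ι (b ∸ toℕ x) +ᶻ_) (sym (ι-toℕ x)) ⟩
        ι (b ∸ toℕ x) +ᶻ ι (toℕ x)      ≡⟨ sym (ι-+ (b ∸ toℕ x) (toℕ x)) ⟩
        ι (b ∸ toℕ x +ℕ toℕ x)          ≡⟨ cong ι (ℕₚ.m∸n+n≡m (ℕₚ.<⇒≤ (Finₚ.toℕ<n x))) ⟩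
        ι b                             ≡⟨ ι-cong-% {b} {0} (n%n≡0 b) ⟩
        ι 0 ∎ }

  open AbGroup group using (_×ₙ_)

  ×ₙ-ι : ∀ k l → k ×ₙ ι l ≡ ι (k *ℕ l)
  ×ₙ-ι zero    l = refl
  ×ₙ-ι (suc k) l = trans (cong (ι l +ᶻ_) (×ₙ-ι k l)) (sym (ι-+ l (k *ℕ l)))

  torsion : ∀ x → b ×ₙ x ≡ ι 0
  torsion x = begin
    b ×ₙ x             ≡⟨ cong (b ×ₙ_) (sym (ι-toℕ x)) ⟩
    b ×ₙ ι (toℕ x)     ≡⟨ ×ₙ-ι b (toℕ x) ⟩
    ι (b *ℕ toℕ x)     ≡⟨ cong ι (ℕₚ.*-comm b (toℕ x)) ⟩
    ι (toℕ x *ℕ b)     ≡⟨ ι-cong-% {toℕ x *ℕ b} {0} (m*n%n≡0 (toℕ x) b) ⟩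
    ι 0 ∎

  generates : (P : Fin b → Set) → P (ι 0) → (∀ x → P x → P (x +ᶻ ι 1)) → ∀ x → P x
  generates P P0 P+ x = subst P (ι-toℕ x) (go (toℕ x))
    where
    go : ∀ k → P (ι k)
    go zero    = P0
    go (suc k) = subst P (trans (sym (ι-+ k 1)) (cong ι (ℕₚ.+-comm k 1))) (P+ (ι k) (go k))

-- Steiner quasigroups and Moore's product

record Steiner (P : Set) : Set where
  infixl 7 _·_
  field
    _·_   : P → P → P
    idem  : ∀ x → x · x ≡ x
    comm  : ∀ x y → x · y ≡ y · x
    invol : ∀ x y → x · (x · y) ≡ y

  cancelˡ : ∀ x {y z} → x · y ≡ x · z → y ≡ z
  cancelˡ x {y} {z} eq = trans (sym (invol x y)) (trans (cong (x ·_) eq) (invol x z))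

  fixed : ∀ {x y} → x · y ≡ y → x ≡ y
  fixed {x} {y} eq = cancelˡ y (trans (comm y x) (trans eq (sym (idem y))))

  absorb : ∀ {x y} → x · y ≡ x → x ≡ y
  absorb {x} {y} eq = cancelˡ x (trans (idem x) (sym eq))

  swap : ∀ {x y z} → x · y ≡ z → x · z ≡ y
  swap {x} {y} eq = trans (cong (x ·_) (sym eq)) (invol x y)

-- The structure of a triple system on Y ∪ T with its subsystem Y left out.
record Fibre {Y T : Set} (σ : Y → T → T) : Set where
  field
    τ      : T → T → Y ⊎ T
    τ-idem : ∀ i → τ i i ≡ inj₂ i
    τ-comm : ∀ i j → τ i j ≡ τ j i
    τ-σ    : ∀ y i → τ i (σ y i) ≡ inj₁ y
    σ-τ    : ∀ {i j y} → τ i j ≡ inj₁ y → σ y i ≡ j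
    τ-τ    : ∀ {i j k} → τ i j ≡ inj₂ k → τ i k ≡ inj₂ j

-- Moore's product: Y ∪ (V × T), with a copy of the fibre over each point of V
-- and the Latin square i + j + k = 0 over each triple of V.
module Product {Y V T : Set} (G : AbGroup T) (SY : Steiner Y) (SV : Steiner V)
               (_≟_ : DecidableEquality V) (σ : Y → T → T)
               (σ-σ : ∀ y i → σ y (σ y i) ≡ i) (fibre : V → Fibre σ) where
  open AbGroup G
  open Solver G
  open import Data.Vec using ([]; _∷_)
  private
    module SY = Steiner SY
    module SV = Steiner SV
    module F (a : V) = Fibre (fibre a)

  infixr 6 _⋆_
  infixl 7 _∙_
  _⋆_ : V → V → V
  _⋆_ = SV._·_

  U : Set
  U = Y ⊎ (V × T)

  over : V → Y ⊎ T → U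
  over a (inj₁ y) = inj₁ y
  over a (inj₂ i) = inj₂ (a , i)

  third : T → T → T
  third i j = - (i + j)

  _∙_ : U → U → U
  inj₁ y       ∙ inj₁ z       = inj₁ (y SY.· z)
  inj₁ y       ∙ inj₂ (a , i) = inj₂ (a , σ y i)
  inj₂ (a , i) ∙ inj₁ y       = inj₂ (a , σ y i)
  inj₂ (a , i) ∙ inj₂ (b , j) with a ≟ b
  ... | yes _ = over a (F.τ a i j)
  ... | no  _ = inj₂ (a ⋆ b , third i j)

  inside : ∀ a i j → inj₂ (a , i) ∙ inj₂ (a , j) ≡ over a (F.τ a i j)
  inside a i j with a ≟ a
  ... | yes _   = refl
  ... | no  a≢a = ⊥-elim (a≢a refl)

  across : ∀ {a b} i j → a ≢ b → inj₂ (a , i) ∙ inj₂ (b , j) ≡ inj₂ (a ⋆ b , third i j)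
  across {a} {b} i j a≢b with a ≟ b
  ... | yes a≡b = ⊥-elim (a≢b a≡b)
  ... | no  _   = refl

  third-invol : ∀ i j → third i (third i j) ≡ j
  third-invol i j = prove (i ∷ j ∷ []) (⊖ (v₀ ⊕ ⊖ (v₀ ⊕ v₁))) v₁ refl

  steiner : Steiner U
  steiner = record { _·_ = _∙_ ; idem = idem ; comm = comm ; invol = invol }
    where
    idem : ∀ x → x ∙ x ≡ x
    idem (inj₁ y)       = cong inj₁ (SY.idem y)
    idem (inj₂ (a , i)) = trans (inside a i i) (cong (over a) (F.τ-idem a i))

    comm : ∀ x y → x ∙ y ≡ y ∙ x
    comm (inj₁ y)       (inj₁ z)       = cong inj₁ (SY.comm y z)
    comm (inj₁ y)       (inj₂ (a , i)) = refl
    comm (inj₂ (a , i)) (inj₁ y)       = refl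
    comm (inj₂ (a , i)) (inj₂ (b , j)) with a ≟ b
    ... | yes refl = trans (cong (over a) (F.τ-comm a i j)) (sym (inside a j i))
    ... | no  a≢b  = trans (cong₂ (λ c k → inj₂ (c , - k)) (SV.comm a b) (+-comm i j))
                           (sym (across j i (λ eq → a≢b (sym eq))))

    inner : ∀ a i j {w} → F.τ a i j ≡ w → inj₂ (a , i) ∙ over a w ≡ inj₂ (a , j)
    inner a i j {inj₁ y} eq = cong (λ k → inj₂ (a , k)) (F.σ-τ a eq)
    inner a i j {inj₂ k} eq = trans (inside a i k) (cong (over a) (F.τ-τ a eq))

    invol : ∀ x y → x ∙ (x ∙ y) ≡ y
    invol (inj₁ y)       (inj₁ z)       = cong inj₁ (SY.invol y z)
    invol (inj₁ y)       (inj₂ (a , i)) = cong (λ k → inj₂ (a , k)) (σ-σ y i)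
    invol (inj₂ (a , i)) (inj₁ y)       = trans (inside a i (σ y i)) (cong (over a) (F.τ-σ a y i))
    invol (inj₂ (a , i)) (inj₂ (b , j)) with a ≟ b
    ... | yes refl = inner a i j refl
    ... | no  a≢b  = trans (across i (third i j) (λ eq → a≢b (SV.absorb (sym eq))))
                           (cong₂ (λ c k → inj₂ (c , k)) (SV.invol a b) (third-invol i j))

-- The fibre: Bose's construction with a matched part

Level₃ : AbGroup (Fin 3)
Level₃ = Cyclic.group 2

up : Fin 3 → Fin 3
up 0F = 1F
up 1F = 2F
up 2F = 0F

-- Two of three cyclically ordered levels are equal or adjacent. The view records the direction,
-- because Bose's triples lead from a pair on ℓ to a point on `up ℓ`.
data Levels : Fin 3 → Fin 3 → Set where
  same    : ∀ ℓ → Levels ℓ ℓ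
  rising  : ∀ ℓ → Levels ℓ (up ℓ)
  falling : ∀ ℓ → Levels (up ℓ) ℓ

levels : ∀ ℓ m → Levels ℓ m
levels 0F 0F = same 0F
levels 0F 1F = rising 0F
levels 0F 2F = falling 2F
levels 1F 0F = falling 0F
levels 1F 1F = same 1F
levels 1F 2F = rising 1F
levels 2F 0F = rising 2F
levels 2F 1F = falling 1F
levels 2F 2F = same 2F

levels-same : ∀ ℓ → levels ℓ ℓ ≡ same ℓ
levels-same 0F = refl
levels-same 1F = refl
levels-same 2F = refl

levels-rising : ∀ ℓ → levels ℓ (up ℓ) ≡ rising ℓ
levels-rising 0F = refl
levels-rising 1F = refl
levels-rising 2F = refl

levels-falling : ∀ ℓ → levels (up ℓ) ℓ ≡ falling ℓ
levels-falling 0F = refl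
levels-falling 1F = refl
levels-falling 2F = refl

module Signed {A : Set} (G : AbGroup A) where
  open AbGroup G
  open Solver G

  signed : Bool → A → A
  signed false x = x
  signed true  x = - x

  signed-cancel : ∀ ε x y → x + signed ε y + signed (not ε) y ≡ x
  signed-cancel false x y = prove (x ∷ y ∷ []) (v₀ ⊕ v₁ ⊕ ⊖ v₁) v₀ refl
  signed-cancel true  x y = prove (x ∷ y ∷ []) (v₀ ⊕ ⊖ v₁ ⊕ v₁) v₀ refl

-- A triple system on E ∪ (Bool × Fin 3) without the lines inside E; the point
-- e of E joins (false, ℓ) to (true, ℓ + shift e).
record Hole (E : Set) : Set where
  open AbGroup Level₃
  open Signed Level₃
  field
    ∞       : E
    shift   : E → Fin 3
    shift-∞ : shift ∞ ≡ 0F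
    shift-0 : ∀ {e} → shift e ≡ 0F → e ≡ ∞
    line    : Bool × Fin 3 → Bool × Fin 3 → E ⊎ (Bool × Fin 3)

  act : E → Bool × Fin 3 → Bool × Fin 3
  act e (ε , ℓ) = not ε , ℓ + signed ε (shift e)

  field
    line-idem : ∀ s → line s s ≡ inj₂ s
    line-comm : ∀ s t → line s t ≡ line t s
    line-act  : ∀ e s → line s (act e s) ≡ inj₁ e
    act-line  : ∀ {s t e} → line s t ≡ inj₁ e → act e s ≡ t
    line-line : ∀ {s t u} → line s t ≡ inj₂ u → line s u ≡ inj₂ t

  act-act : ∀ e s → act e (act e s) ≡ s
  act-act e (ε , ℓ) = cong₂ _,_ (Boolₚ.not-involutive ε) (signed-cancel ε ℓ (shift e))

record OddGroup (B : Set) : Set where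
  field
    group       : AbGroup B
    _≟_         : DecidableEquality B
    half        : B → B
  open AbGroup group public
  field
    half-double : ∀ x → half x + half x ≡ x
    double-half : ∀ x → half (x + x) ≡ x

  2-cancel : ∀ {x y} → x + x ≡ y + y → x ≡ y
  2-cancel {x} {y} eq = trans (sym (double-half x)) (trans (cong half eq) (double-half y))

-- A symmetric set without 0. It is indexed by a type because each of its elements also contributes
-- three points `(k , α)` to `Y`.
record DifferenceSet {B : Set} (G : OddGroup B) (K : Set) : Set where
  open OddGroup G using (0#; -_)
  field
    D     : K → B
    neg   : K → K
    D-inj : ∀ {k l} → D k ≡ D l → k ≡ l
    D-neg : ∀ k → D (neg k) ≡ - D k
    D≢0   : ∀ k → D k ≢ 0#
    D?    : ∀ x → Dec (∃ λ k → D k ≡ x)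

-- Bose's construction on three levels with two points (ε, ℓ, x) at each place.
-- Of the four triples over a pair x ≠ y only two are kept when y − x lies in D;
-- the pairs this sets free form matchings, which are joined to the points (k, α).
module Bose {B K E : Set} (G : OddGroup B) (𝔻 : DifferenceSet G K) (H : Hole E) where
  open OddGroup G
  open DifferenceSet 𝔻
  open Hole H
  open Solver group
  open Signed group

  T Y : Set
  T = Bool × Fin 3 × B
  Y = E ⊎ (K × Fin 3)

  -- The freed pairs have opposite bits and lie either both on ℓ, at difference `D k`, or on ℓ and
  -- `up ℓ`, at half of it. The point `(k , α)` takes those of the first kind on the level before α
  -- and those of the second kind between α and `up α`: together a perfect matching of `T`.
  σ : Y → T → T
  σ (inj₁ e) (ε , ℓ , x) = proj₁ (act e (ε , ℓ)) , proj₂ (act e (ε , ℓ)) , x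
  σ (inj₂ (k , α)) (ε , ℓ , x) with levels ℓ α
  ... | same _    = not ε , up ℓ , x + half (D k)
  ... | rising _  = not ε , ℓ , x + signed ε (D k)
  ... | falling _ = not ε , α , x + - half (D k)

  σ-same : ∀ k ε ℓ x → σ (inj₂ (k , ℓ)) (ε , ℓ , x) ≡ (not ε , up ℓ , x + half (D k))
  σ-same k ε ℓ x rewrite levels-same ℓ = refl

  σ-rising : ∀ k ε ℓ x → σ (inj₂ (k , up ℓ)) (ε , ℓ , x) ≡ (not ε , ℓ , x + signed ε (D k))
  σ-rising k ε ℓ x rewrite levels-rising ℓ = refl

  σ-falling : ∀ k ε ℓ x → σ (inj₂ (k , ℓ)) (ε , up ℓ , x) ≡ (not ε , ℓ , x + - half (D k))
  σ-falling k ε ℓ x rewrite levels-falling ℓ = refl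

  σ-flips : ∀ y i → proj₁ (σ y i) ≡ not (proj₁ i)
  σ-flips (inj₁ e) (ε , ℓ , x) = refl
  σ-flips (inj₂ (k , α)) (ε , ℓ , x) with levels ℓ α
  ... | same _    = refl
  ... | rising _  = refl
  ... | falling _ = refl

  triple≡ : ∀ {ε δ : Bool} {ℓ : Fin 3} {x y : B} → ε ≡ δ → x ≡ y → (ε , ℓ , x) ≡ (δ , ℓ , y)
  triple≡ refl refl = refl

  σ-σ : ∀ y i → σ y (σ y i) ≡ i
  σ-σ (inj₁ e) (ε , ℓ , x) = cong (λ s → proj₁ s , proj₂ s , x) (act-act e (ε , ℓ))
  σ-σ (inj₂ (k , α)) (ε , ℓ , x) with levels ℓ α
  ... | same _ = trans (σ-falling k (not ε) ℓ _)
    (triple≡ (Boolₚ.not-involutive ε) (prove (x ∷ half (D k) ∷ []) (v₀ ⊕ v₁ ⊕ ⊖ v₁) v₀ refl))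
  ... | rising _ = trans (σ-rising k (not ε) ℓ _)
    (triple≡ (Boolₚ.not-involutive ε) (signed-cancel ε x (D k)))
  ... | falling _ = trans (σ-same k (not ε) α _)
    (triple≡ (Boolₚ.not-involutive ε) (prove (x ∷ half (D k) ∷ []) (v₀ ⊕ ⊖ v₁ ⊕ v₁) v₀ refl))

  mirror : B → B → B
  mirror x z = z + z + - x

  mirror-half : ∀ x y → mirror x (half (x + y)) ≡ y
  mirror-half x y = trans (cong (_+ - x) (half-double (x + y)))
                          (prove (x ∷ y ∷ []) (v₀ ⊕ v₁ ⊕ ⊖ v₀) v₁ refl)

  half-mirror : ∀ x z → half (x + mirror x z) ≡ z
  half-mirror x z =
    trans (cong half (prove (x ∷ z ∷ []) (v₀ ⊕ (v₁ ⊕ v₁ ⊕ ⊖ v₀)) (v₁ ⊕ v₁) refl)) (double-half z)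

  mirror-mirror : ∀ x z → mirror (mirror x z) z ≡ x
  mirror-mirror x z = prove (x ∷ z ∷ []) (v₁ ⊕ v₁ ⊕ ⊖ (v₁ ⊕ v₁ ⊕ ⊖ v₀)) v₀ refl

  mirror≢ : ∀ {x z} → x ≢ z → x ≢ mirror x z
  mirror≢ {x} {z} x≢z eq =
    x≢z (trans (sym (double-half x)) (trans (cong (λ w → half (x + w)) eq) (half-mirror x z)))

  half≢ : ∀ {x y} → x ≢ y → x ≢ half (x + y)
  half≢ {x} {y} x≢y eq = x≢y (trans (prove (x ∷ []) v₀ (v₀ ⊕ v₀ ⊕ ⊖ v₀) refl)
                                    (trans (cong (mirror x) eq) (mirror-half x y)))

  InD : B → Set
  InD e = ∃ λ k → D k ≡ e

  -- Over (ε, x) and (δ, y) at one level: the point of the pair at the midpoint of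
  -- x and y, or the point of K that the two are matched by.
  glue : ∀ {e} → Dec (InD e) → Bool → Bool → Bool → Bool ⊎ K
  glue (no _)        t ε     δ     = inj₁ ((ε xor δ) xor t)
  glue (yes (k , _)) t false false = inj₁ false
  glue (yes (k , _)) t false true  = inj₂ k
  glue (yes (k , _)) t true  false = inj₂ k
  glue (yes (k , _)) t true  true  = inj₁ true

  -- The three bits of a triple satisfy a symmetric condition: their sum is `t` outside `D`, and
  -- they are all equal inside `D`.
  glue-swap : ∀ {e ε δ ε′} (d : Dec (InD e)) t → glue d t ε δ ≡ inj₁ ε′ → glue d t ε ε′ ≡ inj₁ δ
  glue-swap {ε = ε} {δ} (no _) t refl = cong inj₁ (xor-lemma ε δ t)
    where
    xor-lemma : ∀ ε δ t → (ε xor ((ε xor δ) xor t)) xor t ≡ δ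
    xor-lemma false false false = refl
    xor-lemma false false true  = refl
    xor-lemma false true  false = refl
    xor-lemma false true  true  = refl
    xor-lemma true  false false = refl
    xor-lemma true  false true  = refl
    xor-lemma true  true  false = refl
    xor-lemma true  true  true  = refl
  glue-swap {ε = false} {false} (yes _) t refl = refl
  glue-swap {ε = true}  {true}  (yes _) t refl = refl

  glue-K : ∀ {e ε δ k} (d : Dec (InD e)) t → glue d t ε δ ≡ inj₂ k → D k ≡ e × δ ≡ not ε
  glue-K {ε = false} {true}  (yes (k , eq)) t refl = eq , refl
  glue-K {ε = true}  {false} (yes (k , eq)) t refl = eq , refl

  glue-≢ : ∀ {e k} (d : Dec (InD e)) t ε → D k ≡ e → glue d t ε (not ε) ≡ inj₂ k
  glue-≢ (no ¬d)        t ε     eq = ⊥-elim (¬d (_ , eq))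
  glue-≢ (yes (l , eq)) t false eq′ = cong inj₂ (D-inj (trans eq (sym eq′)))
  glue-≢ (yes (l , eq)) t true  eq′ = cong inj₂ (D-inj (trans eq (sym eq′)))

  glue-≢′ : ∀ {e k} (d : Dec (InD e)) t ε → D k ≡ e → glue d t (not ε) ε ≡ inj₂ k
  glue-≢′ d t false = glue-≢ d t true
  glue-≢′ d t true  = glue-≢ d t false

  InD-neg : ∀ {x y} → InD (y + - x) → InD (x + - y)
  InD-neg {x} {y} (k , eq) = neg k , trans (D-neg k)
    (trans (cong -_ eq) (prove (x ∷ y ∷ []) (⊖ (v₁ ⊕ ⊖ v₀)) (v₀ ⊕ ⊖ v₁) refl))

  -- The same symmetry, but with the pair read from its other end. Membership is then decided for
  -- the opposite difference, and `InD-neg` excludes that the two decisions disagree.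
  glue-rotate : ∀ {x y ε δ ε′} (d : Dec (InD (y + - x))) (d′ : Dec (InD (x + - y))) t →
                glue d t ε δ ≡ inj₁ ε′ → glue d′ t ε′ δ ≡ inj₁ ε
  glue-rotate (no ¬d) (yes d) t eq = ⊥-elim (¬d (InD-neg d))
  glue-rotate (yes d) (no ¬d) t eq = ⊥-elim (¬d (InD-neg d))
  glue-rotate {ε = ε} {δ} (no _) (no _) t refl = cong inj₁ (xor-lemma ε δ t)
    where
    xor-lemma : ∀ ε δ t → ((((ε xor δ) xor t) xor δ) xor t) ≡ ε
    xor-lemma false false false = refl
    xor-lemma false false true  = refl
    xor-lemma false true  false = refl
    xor-lemma false true  true  = refl
    xor-lemma true  false false = refl
    xor-lemma true  false true  = refl
    xor-lemma true  true  false = refl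
    xor-lemma true  true  true  = refl
  glue-rotate {ε = false} {false} (yes _) (yes _) t refl = refl
  glue-rotate {ε = true}  {true}  (yes _) (yes _) t refl = refl

  -- `glued` takes the difference from the first point of the pair, whereas the matching of
  -- `(k , up ℓ)` adds `D k` at the point with bit `false`. Starting from the bit `true`, the sign
  -- changes.
  orient : Bool → K → K
  orient false k = k
  orient true  k = neg k

  -- Over a pair outside `D` the four triples form a Pasch configuration, and `twist` exchanges it
  -- for the other one on the same six points. As `σ` does not depend on `twist`, differently
  -- twisted fibres can share `Y`.
  module Twisted (twist : Fin 3 → B → B → Bool) (twist-comm : ∀ ℓ x y → twist ℓ x y ≡ twist ℓ y x) where

    glued : Fin 3 → B → B → Bool → Bool → Bool ⊎ K
    glued ℓ x y ε δ = glue (D? (y + - x)) (twist ℓ x y) ε δ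

    inHole : B → E ⊎ (Bool × Fin 3) → Y ⊎ T
    inHole x (inj₁ e)       = inj₁ (inj₁ e)
    inHole x (inj₂ (ε , ℓ)) = inj₂ (ε , ℓ , x)

    above : Bool → Fin 3 → B → B → Bool ⊎ K → Y ⊎ T
    above ε ℓ x y (inj₁ δ) = inj₂ (δ , up ℓ , half (x + y))
    above ε ℓ x y (inj₂ k) = inj₁ (inj₂ (orient ε k , up ℓ))

    beside : Fin 3 → B → Bool ⊎ K → Y ⊎ T
    beside ℓ y (inj₁ δ) = inj₂ (δ , ℓ , y)
    beside ℓ y (inj₂ k) = inj₁ (inj₂ (k , ℓ))

    rise : Bool → Fin 3 → B → Bool → B → Y ⊎ T
    rise ε ℓ x δ z = beside ℓ (mirror x z) (glued ℓ x (mirror x z) ε δ)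

    offHole : ∀ {ℓ m} → Levels ℓ m → Bool → B → Bool → B → Y ⊎ T
    offHole (same ℓ)    ε x δ y = above ε ℓ x y (glued ℓ x y ε δ)
    offHole (rising ℓ)  ε x δ y = rise ε ℓ x δ y
    offHole (falling ℓ) ε x δ y = rise δ ℓ y ε x

    τ : T → T → Y ⊎ T
    τ (ε , ℓ , x) (δ , m , y) with x ≟ y
    ... | yes _ = inHole x (line (ε , ℓ) (δ , m))
    ... | no  _ = offHole (levels ℓ m) ε x δ y

    τ-hole : ∀ ε ℓ δ m x → τ (ε , ℓ , x) (δ , m , x) ≡ inHole x (line (ε , ℓ) (δ , m))
    τ-hole ε ℓ δ m x with x ≟ x
    ... | yes _   = refl
    ... | no  x≢x = ⊥-elim (x≢x refl)

    τ-off : ∀ ε ℓ δ m {x y} → x ≢ y → τ (ε , ℓ , x) (δ , m , y) ≡ offHole (levels ℓ m) ε x δ y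
    τ-off ε ℓ δ m {x} {y} x≢y with x ≟ y
    ... | yes x≡y = ⊥-elim (x≢y x≡y)
    ... | no  _   = refl

    τ-same : ∀ ε ℓ δ {x y} → x ≢ y →
             τ (ε , ℓ , x) (δ , ℓ , y) ≡ above ε ℓ x y (glued ℓ x y ε δ)
    τ-same ε ℓ δ {x} {y} x≢y = trans (τ-off ε ℓ δ ℓ x≢y)
      (cong (λ v → offHole v ε x δ y) (levels-same ℓ))

    rise-≡ : ∀ ε ℓ x δ z {y} → mirror x z ≡ y → rise ε ℓ x δ z ≡ beside ℓ y (glued ℓ x y ε δ)
    rise-≡ ε ℓ x δ z refl = refl

    τ-rising : ∀ ε ℓ δ {x z y} → x ≢ z → mirror x z ≡ y →
               τ (ε , ℓ , x) (δ , up ℓ , z) ≡ beside ℓ y (glued ℓ x y ε δ)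
    τ-rising ε ℓ δ {x} {z} x≢z eq = trans (τ-off ε ℓ δ (up ℓ) x≢z)
      (trans (cong (λ v → offHole v ε x δ z) (levels-rising ℓ)) (rise-≡ ε ℓ x δ z eq))

    τ-falling : ∀ ε ℓ δ {x z y} → x ≢ z → mirror z x ≡ y →
                τ (ε , up ℓ , x) (δ , ℓ , z) ≡ beside ℓ y (glued ℓ z y δ ε)
    τ-falling ε ℓ δ {x} {z} x≢z eq = trans (τ-off ε (up ℓ) δ ℓ x≢z)
      (trans (cong (λ v → offHole v ε x δ z) (levels-falling ℓ)) (rise-≡ δ ℓ z ε x eq))

    τ-idem : ∀ i → τ i i ≡ inj₂ i
    τ-idem (ε , ℓ , x) = trans (τ-hole ε ℓ ε ℓ x) (cong (inHole x) (line-idem (ε , ℓ)))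

    above-comm : ∀ ε δ ℓ x y (d : Dec (InD (y + - x))) (d′ : Dec (InD (x + - y))) t →
                 above ε ℓ x y (glue d t ε δ) ≡ above δ ℓ y x (glue d′ t δ ε)
    above-comm ε δ ℓ x y (no ¬d) (yes d) t = ⊥-elim (¬d (InD-neg d))
    above-comm ε δ ℓ x y (yes d) (no ¬d) t = ⊥-elim (¬d (InD-neg d))
    above-comm ε δ ℓ x y (no _)  (no _)  t =
      cong₂ (λ α w → inj₂ (α xor t , up ℓ , half w)) (Boolₚ.xor-comm ε δ) (+-comm x y)
    above-comm false false ℓ x y (yes _) (yes _) t =
      cong (λ w → inj₂ (false , up ℓ , half w)) (+-comm x y)
    above-comm true  true  ℓ x y (yes _) (yes _) t =
      cong (λ w → inj₂ (true , up ℓ , half w)) (+-comm x y)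
    above-comm false true  ℓ x y (yes (k , p)) (yes (l , q)) t =
      cong (λ k → inj₁ (inj₂ (k , up ℓ)))
           (D-inj (trans p (sym (proj₂ (InD-neg (l , q))))))
    above-comm true  false ℓ x y (yes (k , p)) (yes (l , q)) t =
      cong (λ k → inj₁ (inj₂ (k , up ℓ)))
           (D-inj (trans (proj₂ (InD-neg (k , p))) (sym q)))

    τ-comm : ∀ i j → τ i j ≡ τ j i
    τ-comm (ε , ℓ , x) (δ , m , y) with x ≟ y
    ... | yes refl = trans (cong (inHole x) (line-comm (ε , ℓ) (δ , m))) (sym (τ-hole δ m ε ℓ x))
    ... | no  x≢y  = trans (off-comm (levels ℓ m)) (sym (τ-off δ m ε ℓ (λ eq → x≢y (sym eq))))
      where
      off-comm : ∀ {ℓ m} (v : Levels ℓ m) → offHole v ε x δ y ≡ offHole (levels m ℓ) δ y ε x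
      off-comm (same ℓ) rewrite levels-same ℓ | twist-comm ℓ y x =
        above-comm ε δ ℓ x y (D? (y + - x)) (D? (x + - y)) (twist ℓ x y)
      off-comm (rising ℓ)  rewrite levels-falling ℓ = refl
      off-comm (falling ℓ) rewrite levels-rising ℓ = refl

    shifted≢ : ∀ {x d} → d ≢ 0# → x ≢ x + d
    shifted≢ {x} {d} d≢0 eq = d≢0 (+-cancelʳ x (trans (+-comm d x) (trans (sym eq) (sym (+-identityˡ x)))))

    half-D≢0 : ∀ k → half (D k) ≢ 0#
    half-D≢0 k eq = D≢0 k (trans (sym (half-double (D k)))
                                 (trans (cong₂ _+_ eq eq) (+-identityˡ 0#)))

    -≢0 : ∀ {d} → d ≢ 0# → - d ≢ 0#
    -≢0 {d} d≢0 eq = d≢0 (trans (prove (d ∷ []) v₀ (⊖ (⊖ v₀)) refl) (trans (cong -_ eq)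
                                  (prove [] (⊖ 𝟘) 𝟘 refl)))

    τ-σ : ∀ y i → τ i (σ y i) ≡ inj₁ y
    τ-σ (inj₁ e) (ε , ℓ , x) = trans (τ-hole ε ℓ _ _ x) (cong (inHole x) (line-act e (ε , ℓ)))
    τ-σ (inj₂ (k , α)) (ε , ℓ , x) with levels ℓ α
    ... | same _ = trans (τ-rising ε ℓ (not ε) (shifted≢ (half-D≢0 k)) refl)
        (cong (beside ℓ _) (glue-≢ (D? _) _ ε (trans (sym (half-double (D k)))
          (prove (x ∷ half (D k) ∷ []) (v₁ ⊕ v₁)
            ((v₀ ⊕ v₁) ⊕ (v₀ ⊕ v₁) ⊕ ⊖ v₀ ⊕ ⊖ v₀) refl))))
    ... | falling _ = trans (τ-falling ε α (not ε) (shifted≢ (-≢0 (half-D≢0 k))) refl)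
        (cong (beside α _) (glue-≢′ (D? _) _ ε (trans (sym (half-double (D k)))
          (prove (x ∷ half (D k) ∷ []) (v₁ ⊕ v₁)
            (v₀ ⊕ v₀ ⊕ ⊖ (v₀ ⊕ ⊖ v₁) ⊕ ⊖ (v₀ ⊕ ⊖ v₁)) refl))))
    τ-σ (inj₂ (k , .(up ℓ))) (false , ℓ , x) | rising .ℓ =
        trans (τ-same false ℓ true (shifted≢ (D≢0 k)))
          (cong (above false ℓ _ _) (glue-≢ (D? _) _ false
            (prove (x ∷ D k ∷ []) v₁ (v₀ ⊕ v₁ ⊕ ⊖ v₀) refl)))
    -- From the bit `true` the difference is `- D k`, so `glue` finds `neg k`, and `orient` negates
    -- it back.
    τ-σ (inj₂ (k , .(up ℓ))) (true , ℓ , x) | rising .ℓ =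
        trans (τ-same true ℓ false (shifted≢ (-≢0 (D≢0 k))))
          (trans (cong (above true ℓ _ _) (glue-≢ {k = neg k} (D? _) _ true
            (trans (D-neg k) (prove (x ∷ D k ∷ []) (⊖ v₁) (v₀ ⊕ ⊖ v₁ ⊕ ⊖ v₀) refl))))
          (cong (λ l → inj₁ (inj₂ (l , up ℓ))) (D-inj (trans (D-neg (neg k))
            (trans (cong -_ (D-neg k)) (prove (D k ∷ []) (⊖ (⊖ v₀)) v₀ refl))))))

    σ-τ : ∀ {i j y} → τ i j ≡ inj₁ y → σ y i ≡ j
    σ-τ {ε , ℓ , x} {δ , m , y} eq with x ≟ y
    σ-τ {ε , ℓ , x} {δ , m , y} eq | yes refl with line (ε , ℓ) (δ , m) in l-eq
    σ-τ {ε , ℓ , x} {δ , m , y} refl | yes refl | inj₁ e =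
      cong (λ s → proj₁ s , proj₂ s , x) (act-line l-eq)
    σ-τ {ε , ℓ , x} {δ , m , y} eq | no x≢y with levels ℓ m
    σ-τ {ε , ℓ , x} {δ , m , y} eq | no x≢y | same _
      with glued ℓ x y ε δ in g-eq
    σ-τ {ε , ℓ , x} {δ , m , y} refl | no x≢y | same _ | inj₂ k
      with refl ← proj₂ (glue-K (D? (y + - x)) (twist ℓ x y) g-eq) =
      trans (σ-rising (orient ε k) ε ℓ x) (triple≡ refl
        (trans (cong (x +_) (oriented ε)) (trans (cong (x +_) (proj₁ (glue-K (D? _) (twist ℓ x y) g-eq)))
          (prove (x ∷ y ∷ []) (v₀ ⊕ (v₁ ⊕ ⊖ v₀)) v₁ refl))))
      where
      oriented : ∀ ε → signed ε (D (orient ε k)) ≡ D k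
      oriented false = refl
      oriented true  = trans (cong -_ (D-neg k)) (prove (D k ∷ []) (⊖ (⊖ v₀)) v₀ refl)
    σ-τ {ε , ℓ , x} {δ , m , z} eq | no x≢z | rising _
      with glued ℓ x (mirror x z) ε δ in g-eq
    σ-τ {ε , ℓ , x} {δ , m , z} refl | no x≢z | rising _ | inj₂ k
      with refl ← proj₂ (glue-K (D? (mirror x z + - x)) (twist ℓ x (mirror x z)) g-eq) =
      trans (σ-same k ε ℓ x) (triple≡ refl (begin
        x + half (D k)
          ≡⟨ cong (λ d → x + half d) (proj₁ (glue-K (D? _) (twist ℓ x (mirror x z)) g-eq)) ⟩
        x + half (mirror x z + - x)
          ≡⟨ cong (λ d → x + half d) (prove (x ∷ z ∷ []) (v₁ ⊕ v₁ ⊕ ⊖ v₀ ⊕ ⊖ v₀)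
               ((v₁ ⊕ ⊖ v₀) ⊕ (v₁ ⊕ ⊖ v₀)) refl) ⟩
        x + half ((z + - x) + (z + - x))
          ≡⟨ cong (x +_) (double-half (z + - x)) ⟩
        x + (z + - x)
          ≡⟨ prove (x ∷ z ∷ []) (v₀ ⊕ (v₁ ⊕ ⊖ v₀)) v₁ refl ⟩
        z ∎))
      where open ≡-Reasoning
    σ-τ {ε , ℓ , x} {δ , m , z} eq | no x≢z | falling _
      with glued m z (mirror z x) δ ε in g-eq
    σ-τ {ε , ℓ , x} {δ , m , z} refl | no x≢z | falling _ | inj₂ k
      with refl ← proj₂ (glue-K (D? (mirror z x + - z)) (twist m z (mirror z x)) g-eq) =
      trans (σ-falling k (not δ) m x) (triple≡ (Boolₚ.not-involutive δ) (begin
        x + - half (D k)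
          ≡⟨ cong (λ d → x + - half d) (proj₁ (glue-K (D? _) (twist m z (mirror z x)) g-eq)) ⟩
        x + - half (mirror z x + - z)
          ≡⟨ cong (λ d → x + - half d) (prove (x ∷ z ∷ []) (v₀ ⊕ v₀ ⊕ ⊖ v₁ ⊕ ⊖ v₁)
               ((v₀ ⊕ ⊖ v₁) ⊕ (v₀ ⊕ ⊖ v₁)) refl) ⟩
        x + - half ((x + - z) + (x + - z))
          ≡⟨ cong (λ d → x + - d) (double-half (x + - z)) ⟩
        x + - (x + - z)
          ≡⟨ prove (x ∷ z ∷ []) (v₀ ⊕ ⊖ (v₀ ⊕ ⊖ v₁)) v₁ refl ⟩
        z ∎))
      where open ≡-Reasoning

    τ-τ : ∀ {i j k} → τ i j ≡ inj₂ k → τ i k ≡ inj₂ j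
    τ-τ {ε , ℓ , x} {δ , m , y} eq with x ≟ y
    τ-τ {ε , ℓ , x} {δ , m , y} eq | yes refl with line (ε , ℓ) (δ , m) in l-eq
    τ-τ {ε , ℓ , x} {δ , m , y} refl | yes refl | inj₂ (ε′ , ℓ′) =
      trans (τ-hole ε ℓ ε′ ℓ′ x) (cong (inHole x) (line-line l-eq))
    τ-τ {ε , ℓ , x} {δ , m , y} eq | no x≢y with levels ℓ m
    τ-τ {ε , ℓ , x} {δ , m , y} eq | no x≢y | same _
      with glued ℓ x y ε δ in g-eq
    τ-τ {ε , ℓ , x} {δ , m , y} refl | no x≢y | same _ | inj₁ ε′ =
      trans (τ-rising ε ℓ ε′ (half≢ x≢y) (mirror-half x y))
            (cong (beside ℓ y) (glue-swap (D? (y + - x)) (twist ℓ x y) g-eq))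
    τ-τ {ε , ℓ , x} {δ , m , z} eq | no x≢z | rising _
      with glued ℓ x (mirror x z) ε δ in g-eq
    τ-τ {ε , ℓ , x} {δ , m , z} refl | no x≢z | rising _ | inj₁ ε′ =
      trans (τ-same ε ℓ ε′ (mirror≢ x≢z))
        (trans (cong (above ε ℓ x _) (glue-swap (D? (mirror x z + - x)) (twist ℓ x (mirror x z)) g-eq))
               (cong (λ w → inj₂ (δ , up ℓ , w)) (half-mirror x z)))
    τ-τ {ε , ℓ , x} {δ , m , z} eq | no x≢z | falling _
      with glued m z (mirror z x) δ ε in g-eq
    τ-τ {ε , ℓ , x} {δ , m , z} refl | no x≢z | falling _ | inj₁ ε′ =
      trans (τ-falling ε m ε′ x≢z′ (mirror-mirror z x))
        (cong (beside m z)
          (trans (cong (λ t → glue (D? (z + - mirror z x)) t ε′ ε) (twist-comm m (mirror z x) z))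
            (glue-rotate (D? (mirror z x + - z)) (D? (z + - mirror z x)) (twist m z (mirror z x)) g-eq)))
      where
      x≢z′ : x ≢ mirror z x
      x≢z′ eq = x≢z (trans (sym (prove (x ∷ []) (v₀ ⊕ v₀ ⊕ ⊖ v₀) v₀ refl))
                           (trans (cong (λ w → x + x + - w) eq) (mirror-mirror z x)))

    fibre : Fibre σ
    fibre = record
      { τ = τ ; τ-idem = τ-idem ; τ-comm = τ-comm ; τ-σ = τ-σ ; σ-τ = λ {i} {j} {y} → σ-τ {i} {j} {y}
      ; τ-τ = λ {i} {j} {k} → τ-τ {i} {j} {k} }

-- Triple systems and Steiner quasigroups

∣⁅x⁆∪p∣ : ∀ {n} {x : Fin n} {p : Subset n} → x ∉ p → ∣ ⁅ x ⁆ ∪ p ∣ ≡ suc ∣ p ∣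
∣⁅x⁆∪p∣ {x = zero}  {false ∷ p} x∉p = cong (λ q → suc ∣ q ∣) (∪-identityˡ p)
∣⁅x⁆∪p∣ {x = zero}  {true ∷ p}  x∉p = ⊥-elim (x∉p here)
∣⁅x⁆∪p∣ {x = suc x} {false ∷ p} x∉p = ∣⁅x⁆∪p∣ (λ x∈p → x∉p (there x∈p))
∣⁅x⁆∪p∣ {x = suc x} {true ∷ p}  x∉p = cong suc (∣⁅x⁆∪p∣ (λ x∈p → x∉p (there x∈p)))

⊆-card⇒≡ : ∀ {n} {p q : Subset n} → p ⊆ q → ∣ p ∣ ≡ ∣ q ∣ → p ≡ q
⊆-card⇒≡ {p = p} {q} p⊆q eq = ⊆-antisym p⊆q q⊆p
  where
  q⊆p : q ⊆ p
  q⊆p {x} x∈q with x ∈? p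
  ... | yes x∈p = x∈p
  ... | no  x∉p = ⊥-elim (ℕₚ.<-irrefl eq (p⊂q⇒∣p∣<∣q∣ (p⊆q , x , x∈q , x∉p)))

∈-image⁺ : ∀ {u} (π : Permutation′ u) b {i} → (π ⟨$⟩ˡ i) ∈ b → i ∈ image π b
∈-image⁺ π b {i} p = lookup⇒[]= i (image π b) (trans (lookup∘tabulate _ i) ([]=⇒lookup p))

∈-image⁻ : ∀ {u} (π : Permutation′ u) b {i} → i ∈ image π b → (π ⟨$⟩ˡ i) ∈ b
∈-image⁻ π b {i} p = lookup⇒[]= _ b (trans (sym (lookup∘tabulate _ i)) ([]=⇒lookup p))

image-flip : ∀ {u} (π : Permutation′ u) b → image (flip π) (image π b) ≡ b
image-flip π b = trans (tabulate-cong (λ i →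
    trans (lookup∘tabulate _ (π ⟨$⟩ʳ i)) (cong (lookup b) (perm-inverseˡ π)))) (tabulate∘lookup b)

module Triples {u : ℕ} (S : Steiner (Fin u)) where
  open Steiner S

  triple : Fin u → Fin u → Subset u
  triple x y = ⁅ x ⁆ ∪ (⁅ y ⁆ ∪ ⁅ x · y ⁆)

  data Member (x y : Fin u) : Fin u → Set where
    first  : Member x y x
    second : Member x y y
    third  : Member x y (x · y)

  ∈⇒Member : ∀ {x y z} → z ∈ triple x y → Member x y z
  ∈⇒Member {x} {y} {z} p with x∈p∪q⁻ ⁅ x ⁆ _ p
  ... | inj₁ q with refl ← x∈⁅y⁆⇒x≡y x q = first
  ... | inj₂ q with x∈p∪q⁻ ⁅ y ⁆ _ q
  ...   | inj₁ r with refl ← x∈⁅y⁆⇒x≡y y r = second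
  ...   | inj₂ r with refl ← x∈⁅y⁆⇒x≡y (x · y) r = third

  Member⇒∈ : ∀ {x y z} → Member x y z → z ∈ triple x y
  Member⇒∈ first  = x∈p∪q⁺ (inj₁ (x∈⁅x⁆ _))
  Member⇒∈ second = x∈p∪q⁺ {p = ⁅ _ ⁆} (inj₂ (x∈p∪q⁺ (inj₁ (x∈⁅x⁆ _))))
  Member⇒∈ third  = x∈p∪q⁺ {p = ⁅ _ ⁆} (inj₂ (x∈p∪q⁺ {p = ⁅ _ ⁆} (inj₂ (x∈⁅x⁆ _))))

  -- A triple is a subquasigroup; this is why any two of its points determine it in `triple-unique`.
  Member-closed : ∀ {p q x y} → Member p q x → Member p q y → Member p q (x · y)
  Member-closed first  first  = subst (Member _ _) (sym (idem _)) first
  Member-closed first  second = third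
  Member-closed first  third  = subst (Member _ _) (sym (invol _ _)) second
  Member-closed second first  = subst (Member _ _) (comm _ _) third
  Member-closed second second = subst (Member _ _) (sym (idem _)) second
  Member-closed {p} {q} second third  =
    subst (Member _ _) (sym (trans (cong (q ·_) (comm p q)) (invol q p))) first
  Member-closed third  first  = subst (Member _ _) (sym (trans (comm _ _) (invol _ _))) second
  Member-closed {p} {q} third  second =
    subst (Member _ _) (sym (trans (comm _ _) (trans (cong (q ·_) (comm p q)) (invol q p)))) first
  Member-closed third  third  = subst (Member _ _) (sym (idem _)) third

  triple-size : ∀ {x y} → x ≢ y → ∣ triple x y ∣ ≡ 3
  triple-size {x} {y} x≢y = trans (∣⁅x⁆∪p∣ x∉)
    (cong suc (trans (∣⁅x⁆∪p∣ y∉) (cong suc (∣⁅x⁆∣≡1 (x · y)))))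
    where
    y∉ : y ∉ ⁅ x · y ⁆
    y∉ p = x≢y (fixed (sym (x∈⁅y⁆⇒x≡y _ p)))
    x∉ : x ∉ ⁅ y ⁆ ∪ ⁅ x · y ⁆
    x∉ p with x∈p∪q⁻ ⁅ y ⁆ _ p
    ... | inj₁ q = x≢y (x∈⁅y⁆⇒x≡y _ q)
    ... | inj₂ q = x≢y (absorb (sym (x∈⁅y⁆⇒x≡y _ q)))

  triple-unique : ∀ {p q x y} → p ≢ q → x ≢ y → Member p q x → Member p q y → triple x y ≡ triple p q
  triple-unique {p} {q} {x} {y} p≢q x≢y mx my =
    ⊆-card⇒≡ (λ z∈ → Member⇒∈ (sub (∈⇒Member z∈)))
              (trans (triple-size x≢y) (sym (triple-size p≢q)))
    where
    sub : ∀ {z} → Member x y z → Member p q z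
    sub first  = mx
    sub second = my
    sub third  = Member-closed mx my

  Block : Subset u → Set
  Block b = ∃₂ λ x y → x ≢ y × triple x y ≡ b

  sts : STS u
  sts = record
    { Block        = Block
    ; block-size   = λ { _ (x , y , x≢y , refl) → triple-size x≢y }
    ; unique-block = λ x y x≢y → triple x y
        , ((x , y , x≢y , refl) , Member⇒∈ first , Member⇒∈ second)
        , λ { ((p , q , p≢q , refl) , x∈ , y∈) → triple-unique p≢q x≢y (∈⇒Member x∈) (∈⇒Member y∈) } }

  IsHom : (Fin u → Fin u) → Set
  IsHom f = ∀ x y → f (x · y) ≡ f x · f y

  -- The image of a triple is a block through the images of two of its points, hence the triple on
  -- these two, and injectivity leaves only their product for the image of the third.
  aut⇒hom : ∀ π → IsAut sts π → IsHom (π ⟨$⟩ʳ_)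
  aut⇒hom π aut x y with x Fin.≟ y
  ... | yes refl = trans (cong (π ⟨$⟩ʳ_) (idem x)) (sym (idem _))
  ... | no  x≢y with p , q , p≢q , eq ← Equivalence.to (aut (triple x y)) (x , y , x≢y , refl) =
    result (∈⇒Member (subst (π ⟨$⟩ʳ (x · y) ∈_) (sym image≡) (subst (_ ∈_) (sym eq) (move third)))) refl
    where
    π-inj : ∀ {s t} → π ⟨$⟩ʳ s ≡ π ⟨$⟩ʳ t → s ≡ t
    π-inj e = trans (sym (perm-inverseˡ π)) (trans (cong (π ⟨$⟩ˡ_) e) (perm-inverseˡ π))
    move : ∀ {z} → Member x y z → (π ⟨$⟩ʳ z) ∈ image π (triple x y)
    move m = ∈-image⁺ π _ (subst (_∈ _) (sym (perm-inverseˡ π)) (Member⇒∈ m))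
    image≡ : triple (π ⟨$⟩ʳ x) (π ⟨$⟩ʳ y) ≡ triple p q
    image≡ = triple-unique p≢q (λ e → x≢y (π-inj e)) (∈⇒Member (subst (_ ∈_) (sym eq) (move first)))
                         (∈⇒Member (subst (_ ∈_) (sym eq) (move second)))
    result : ∀ {z} → Member (π ⟨$⟩ʳ x) (π ⟨$⟩ʳ y) z → z ≡ π ⟨$⟩ʳ (x · y) → z ≡ (π ⟨$⟩ʳ x) · (π ⟨$⟩ʳ y)
    result first  e = ⊥-elim (x≢y (absorb (sym (π-inj e))))
    result second e = ⊥-elim (x≢y (fixed (sym (π-inj e))))
    result third  e = refl

  hom⇒block : ∀ π → IsHom (π ⟨$⟩ʳ_) → ∀ {b} → Block b → Block (image π b)
  hom⇒block π hom (x , y , x≢y , refl) =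
      π ⟨$⟩ʳ x , π ⟨$⟩ʳ y
    , (λ e → x≢y (trans (sym (perm-inverseˡ π)) (trans (cong (π ⟨$⟩ˡ_) e) (perm-inverseˡ π))))
    , ⊆-antisym (λ m → ∈-image⁺ π _ (Member⇒∈ (back (∈⇒Member m))))
                (λ m → subst (_∈ _) (perm-inverseʳ π) (forth (∈⇒Member (∈-image⁻ π _ m))))
    where
    back : ∀ {z} → Member (π ⟨$⟩ʳ x) (π ⟨$⟩ʳ y) z → Member x y (π ⟨$⟩ˡ z)
    back first  = subst (Member x y) (sym (perm-inverseˡ π)) first
    back second = subst (Member x y) (sym (perm-inverseˡ π)) second
    back third  = subst (Member x y) (sym (trans (cong (π ⟨$⟩ˡ_) (sym (hom x y))) (perm-inverseˡ π))) third
    forth : ∀ {z} → Member x y z → (π ⟨$⟩ʳ z) ∈ triple (π ⟨$⟩ʳ x) (π ⟨$⟩ʳ y)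
    forth first  = Member⇒∈ first
    forth second = Member⇒∈ second
    forth third  = subst (_∈ triple (π ⟨$⟩ʳ x) (π ⟨$⟩ʳ y)) (sym (hom x y)) (Member⇒∈ third)

  hom⇒aut : ∀ π → IsHom (π ⟨$⟩ʳ_) → IsAut sts π
  hom⇒aut π hom b = mk⇔ (hom⇒block π hom)
      (λ blk → subst Block (image-flip π b) (hom⇒block (flip π) hom⁻ blk))
    where
    hom⁻ : IsHom (π ⟨$⟩ˡ_)
    hom⁻ x y = trans (cong (π ⟨$⟩ˡ_) (trans (cong₂ _·_ (sym (perm-inverseʳ π)) (sym (perm-inverseʳ π)))
                                            (sym (hom _ _)))) (perm-inverseˡ π)

transport : ∀ {P Q : Set} → P ↔ Q → Steiner P → Steiner Q
transport i S = record
  { _·_   = λ x y → to (from x · from y)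
  ; idem  = λ x → trans (cong to (idem (from x))) (strictlyInverseˡ x)
  ; comm  = λ x y → cong to (comm (from x) (from y))
  ; invol = λ x y → trans (cong (λ z → to (from x · z)) (strictlyInverseʳ _))
                          (trans (cong to (invol (from x) (from y))) (strictlyInverseˡ y)) }
  where open Inverse i
        open Steiner S

record Automorphism {P : Set} (S : Steiner P) : Set where
  open Steiner S
  field
    θ θ⁻ : P → P
    θ-θ⁻ : ∀ x → θ (θ⁻ x) ≡ x
    θ⁻-θ : ∀ x → θ⁻ (θ x) ≡ x
    homo : ∀ x y → θ (x · y) ≡ θ x · θ y

  θ-inj : ∀ {x y} → θ x ≡ θ y → x ≡ y
  θ-inj {x} {y} eq = trans (sym (θ⁻-θ x)) (trans (cong θ⁻ eq) (θ⁻-θ y))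

  inverse : Automorphism S
  inverse = record { θ = θ⁻ ; θ⁻ = θ ; θ-θ⁻ = θ⁻-θ ; θ⁻-θ = θ-θ⁻
    ; homo = λ x y → θ-inj (trans (θ-θ⁻ _) (trans (cong₂ _·_ (sym (θ-θ⁻ x)) (sym (θ-θ⁻ y)))
                                                  (sym (homo _ _)))) }

-- An isomorphism onto the automorphism group, before the points are numbered; `realize` carries it
-- over to `Fin u`.
record FullAction {c ℓ} (G : Group c ℓ) {P : Set} (S : Steiner P) : Set (c Level.⊔ ℓ) where
  open Group G
  open Steiner S
  field
    act      : Carrier → P → P
    act-cong : ∀ {g h} → g ≈ h → ∀ x → act g x ≡ act h x
    act-ε    : ∀ x → act ε x ≡ x
    act-∙    : ∀ g h x → act (g ∙ h) x ≡ act g (act h x)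
    act-homo : ∀ g x y → act g (x · y) ≡ act g x · act g y
    faithful : ∀ {g h} → (∀ x → act g x ≡ act h x) → g ≈ h
    full     : (A : Automorphism S) → ∃ λ g → ∀ x → Automorphism.θ A x ≡ act g x

module _ {c ℓ} (G : Group c ℓ) {P : Set} {S : Steiner P} (F : FullAction G S) {u} (e : P ↔ Fin u) where
  open Group G using (Carrier; _≈_; _∙_; ε; _⁻¹; rawGroup)
    renaming (refl to ≈-refl; sym to ≈-sym; trans to ≈-trans)
  open FullAction F
  open Inverse e using (to; from; strictlyInverseˡ; strictlyInverseʳ)
  private
    SF : Steiner (Fin u)
    SF = transport e S
    module S = Steiner S
    open Triples SF

    move : Carrier → Fin u → Fin u
    move g x = to (act g (from x))

    move-∙ : ∀ g h x → move (g ∙ h) x ≡ move g (move h x)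
    move-∙ g h x = cong to (trans (act-∙ g h (from x)) (cong (act g) (sym (strictlyInverseʳ _))))

    move-id : ∀ {g} → g ≈ ε → ∀ x → move g x ≡ x
    move-id g≈ε x = trans (cong to (trans (act-cong g≈ε (from x)) (act-ε (from x)))) (strictlyInverseˡ x)

    perm : Carrier → Permutation′ u
    perm g = permutation (move g) (move (g ⁻¹))
      (λ x → trans (sym (move-∙ g (g ⁻¹) x)) (move-id (Group.inverseʳ G g) x))
      (λ x → trans (sym (move-∙ (g ⁻¹) g x)) (move-id (Group.inverseˡ G g) x))

    move-hom : ∀ g → IsHom (move g)
    move-hom g x y = cong to (trans (cong (act g) (strictlyInverseʳ _))
      (trans (act-homo g (from x) (from y))
             (cong₂ S._·_ (sym (strictlyInverseʳ _)) (sym (strictlyInverseʳ _)))))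

    φ : Carrier → Aut sts
    φ g = perm g , hom⇒aut (perm g) (move-hom g)

    pull : Aut sts → Automorphism S
    pull (π , aut) = record
      { θ    = λ x → from (π ⟨$⟩ʳ to x)
      ; θ⁻   = λ x → from (π ⟨$⟩ˡ to x)
      ; θ-θ⁻ = λ x → trans (cong (λ z → from (π ⟨$⟩ʳ z)) (strictlyInverseˡ _))
                           (trans (cong from (perm-inverseʳ π)) (strictlyInverseʳ x))
      ; θ⁻-θ = λ x → trans (cong (λ z → from (π ⟨$⟩ˡ z)) (strictlyInverseˡ _))
                           (trans (cong from (perm-inverseˡ π)) (strictlyInverseʳ x))
      ; homo = λ x y → trans (cong (λ z → from (π ⟨$⟩ʳ z))
                 (cong to (cong₂ S._·_ (sym (strictlyInverseʳ x)) (sym (strictlyInverseʳ y)))))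
                 (trans (cong from (aut⇒hom π aut (to x) (to y))) (strictlyInverseʳ _)) }

  realize : Σ (STS u) λ U → ∃ λ (φ : Group.Carrier G → Aut U) →
            GroupMorphisms.IsGroupIsomorphism (Group.rawGroup G) (AutGroup U) φ
  realize = sts , φ , record
    { isGroupMonomorphism = record
      { isGroupHomomorphism = record
        { isMonoidHomomorphism = record
          { isMagmaHomomorphism = record
            { isRelHomomorphism = record { cong = λ eq x → cong to (act-cong eq (from x)) }
            ; homo = move-∙ }
          ; ε-homo = move-id ≈-refl }
        ; ⁻¹-homo = λ g x → refl }
      ; injective = λ eq → faithful (λ x → trans (sym (cong (act _) (strictlyInverseʳ x)))
          (trans (sym (strictlyInverseʳ _)) (trans (cong from (eq (to x)))
            (trans (strictlyInverseʳ _) (cong (act _) (strictlyInverseʳ x)))))) }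
    ; surjective = λ { (π , aut) → let g , eq = full (pull (π , aut)) in
        g , λ {h} h≈g x → trans (cong to (trans (act-cong h≈g (from x)) (sym (eq (from x)))))
          (trans (strictlyInverseˡ _) (cong (π ⟨$⟩ʳ_) (strictlyInverseˡ x))) } }

-- Recovering the special point, the special part and the fibres

module BoseProduct
  {B K E V : Set} (G : OddGroup B) (𝔻 : DifferenceSet G K) (H : Hole E)
  (SV : Steiner V) (_≟ⱽ_ : DecidableEquality V)
  (twist : V → Fin 3 → B → B → Bool)
  (twist-comm : ∀ a ℓ x y → twist a ℓ x y ≡ twist a ℓ y x)
  (SY : Steiner (E ⊎ (K × Fin 3))) where

  open OddGroup G public
  open DifferenceSet 𝔻 public
  open Hole H public
  open Bose G 𝔻 H public

  groupT : AbGroup T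
  groupT = xorGroup ×ᴳ (Level₃ ×ᴳ group)

  module F (a : V) = Twisted (twist a) (twist-comm a)
  open Product groupT SY SV _≟ⱽ_ σ σ-σ F.fibre public

  module SY = Steiner SY
  module SV = Steiner SV
  module L = AbGroup Level₃
  module TG = AbGroup groupT

  lev : T → Fin 3
  lev i = proj₁ (proj₂ i)

  crd : T → B
  crd i = proj₂ (proj₂ i)

  σ-∞ : ∀ ε ℓ x → σ (inj₁ ∞) (ε , ℓ , x) ≡ (not ε , ℓ , x)
  σ-∞ ε ℓ x rewrite shift-∞ = cong (λ m → not ε , m , x) (lemma ε ℓ)
    where
    open Signed Level₃ using () renaming (signed to signed₃)
    lemma : ∀ ε ℓ → ℓ L.+ signed₃ ε 0F ≡ ℓ
    lemma false ℓ = L.+-identityʳ ℓ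
    lemma true  ℓ = L.+-identityʳ ℓ

  open Signed Level₃ using () renaming (signed to signed₃)

  -- Levels alone tell every `y ≢ inj₁ ∞` from a translation: the displacement varies with the bit
  -- for a point of `E`, and with the level for `(k , α)`. The second formula unites the
  -- displacements 1, 0 and 2 of the cases `same`, `rising` and `falling`.
  level-shift : Y → T → Fin 3
  level-shift (inj₁ e)       (ε , ℓ , x) = signed₃ ε (shift e)
  level-shift (inj₂ (k , α)) (ε , ℓ , x) = ℓ L.+ L.- α L.+ 1F

  private
    same-shift : ∀ ℓ → up ℓ ≡ ℓ L.+ (ℓ L.+ L.- ℓ L.+ 1F)
    same-shift 0F = refl
    same-shift 1F = refl
    same-shift 2F = refl

    rising-shift : ∀ ℓ → ℓ ≡ ℓ L.+ (ℓ L.+ L.- (up ℓ) L.+ 1F)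
    rising-shift 0F = refl
    rising-shift 1F = refl
    rising-shift 2F = refl

    falling-shift : ∀ ℓ → ℓ ≡ up ℓ L.+ (up ℓ L.+ L.- ℓ L.+ 1F)
    falling-shift 0F = refl
    falling-shift 1F = refl
    falling-shift 2F = refl

  lev-σ : ∀ y i → lev (σ y i) ≡ lev i L.+ level-shift y i
  lev-σ (inj₁ e) (ε , ℓ , x) = refl
  lev-σ (inj₂ (k , α)) (ε , ℓ , x) with levels ℓ α
  ... | same _    = same-shift ℓ
  ... | rising _  = rising-shift ℓ
  ... | falling _ = falling-shift α

  double≢0 : ∀ {s} → s ≢ 0F → s L.+ s ≢ 0F
  double≢0 {0F} s≢0 = λ _ → s≢0 refl
  double≢0 {1F} s≢0 = λ ()
  double≢0 {2F} s≢0 = λ ()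

  signed≢0 : ∀ {s} ε → s ≢ 0F → signed₃ ε s ≢ 0F
  signed≢0 {0F} ε     s≢0 = λ _ → s≢0 refl
  signed≢0 {1F} false s≢0 = λ ()
  signed≢0 {1F} true  s≢0 = λ ()
  signed≢0 {2F} false s≢0 = λ ()
  signed≢0 {2F} true  s≢0 = λ ()

  signed-not≢ : ∀ {s} ε → s ≢ 0F → signed₃ (not ε) s ≢ signed₃ ε s
  signed-not≢ {0F} ε     s≢0 = λ _ → s≢0 refl
  signed-not≢ {1F} false s≢0 = λ ()
  signed-not≢ {1F} true  s≢0 = λ ()
  signed-not≢ {2F} false s≢0 = λ ()
  signed-not≢ {2F} true  s≢0 = λ ()

  up-shift≢ : ∀ ℓ α → up ℓ L.+ L.- α L.+ 1F ≢ ℓ L.+ L.- α L.+ 1F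
  up-shift≢ 0F 0F ()
  up-shift≢ 0F 1F ()
  up-shift≢ 0F 2F ()
  up-shift≢ 1F 0F ()
  up-shift≢ 1F 1F ()
  up-shift≢ 1F 2F ()
  up-shift≢ 2F 0F ()
  up-shift≢ 2F 1F ()
  up-shift≢ 2F 2F ()

  shift≢0 : ∀ {e} → inj₁ e ≢ inj₁ {B = K × Fin 3} ∞ → shift e ≢ 0F
  shift≢0 e≢∞ eq = e≢∞ (cong inj₁ (shift-0 eq))

  -- The bit is changed against the points of `E`, the level against the points `(k , α)` and
  -- against triples across fibres. The coordinate stays free, to escape the exceptions.
  away : B → T → T
  away x (ε , ℓ , _) = not ε , up ℓ , x

  shift-away : ∀ {y} → y ≢ inj₁ ∞ → ∀ x i → level-shift y (away x i) ≢ level-shift y i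
  shift-away {inj₁ e}       y≢∞ x (ε , ℓ , _) = signed-not≢ ε (shift≢0 y≢∞)
  shift-away {inj₂ (k , α)} y≢∞ x (ε , ℓ , _) = up-shift≢ ℓ α

  -- With the bit `false`, `third j (probe y x)` has the bit of `j`, and the two displacements by a
  -- point of `E` are equal and do not cancel. With the level α, the two displacements by `(k , α)`
  -- add up to 2 - 3 α = 2.
  probe : Y → B → T
  probe (inj₁ e)       x = false , 0F , x
  probe (inj₂ (k , α)) x = false , α , x

  shift-probe : ∀ {y} → y ≢ inj₁ ∞ → ∀ x j →
                level-shift y (third j (probe y x)) L.+ level-shift y j ≢ 0F
  shift-probe {inj₁ e} y≢∞ x (false , ℓ , _) = double≢0 (signed≢0 false (shift≢0 y≢∞))
  shift-probe {inj₁ e} y≢∞ x (true  , ℓ , _) = double≢0 (signed≢0 true (shift≢0 y≢∞))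
  shift-probe {inj₂ (k , α)} y≢∞ x (ε , ℓ , _) eq = 2≢0 (trans (sym lemma) eq)
    where
    open Solver Level₃
    2≢0 : 1F L.+ 1F L.+ L.- (α L.+ α L.+ α) ≢ 0F
    2≢0 = lemma′ α
      where
      lemma′ : ∀ α → 1F L.+ 1F L.+ L.- (α L.+ α L.+ α) ≢ 0F
      lemma′ 0F ()
      lemma′ 1F ()
      lemma′ 2F ()
    lemma : (L.- (ℓ L.+ α) L.+ L.- α L.+ 1F) L.+ (ℓ L.+ L.- α L.+ 1F)
          ≡ 1F L.+ 1F L.+ L.- (α L.+ α L.+ α)
    lemma = prove (ℓ ∷ α ∷ 1F ∷ [])
      (⊖ (v₀ ⊕ v₁) ⊕ ⊖ v₁ ⊕ v₂ ⊕ (v₀ ⊕ ⊖ v₁ ⊕ v₂)) (v₂ ⊕ v₂ ⊕ ⊖ (v₁ ⊕ v₁ ⊕ v₁)) refl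

  inj₂-fib : ∀ {a b : V} {i j : T} → inj₂ {A = Y} (a , i) ≡ inj₂ (b , j) → a ≡ b
  inj₂-fib refl = refl

  inj₂-pt : ∀ {a b : V} {i j : T} → inj₂ {A = Y} (a , i) ≡ inj₂ (b , j) → i ≡ j
  inj₂-pt refl = refl

  -- Modulo 3 the sides are m + 1 and m - 1.
  away-triple : ∀ ℓ m → L.- (ℓ L.+ L.- (m L.+ up ℓ)) ≢ L.- (L.- (ℓ L.+ m) L.+ up ℓ)
  away-triple 0F 0F ()
  away-triple 0F 1F ()
  away-triple 0F 2F ()
  away-triple 1F 0F ()
  away-triple 1F 1F ()
  away-triple 1F 2F ()
  away-triple 2F 0F ()
  away-triple 2F 1F ()
  away-triple 2F 2F ()

  base : V → U → V
  base a (inj₁ _)       = a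
  base a (inj₂ (b , _)) = b

  Assoc : U → U → U → Set
  Assoc z p q = z ∙ (p ∙ q) ≡ (z ∙ p) ∙ q

  module _ {a c : V} {i : T} (x : B) where
    private
      k : T
      k = away x i

    -- If `p` or the product of `p` with the first point is some `y` in `Y`, associativity would
    -- make `level-shift y` agree at `i` and `k`. If `p` lies over another place, `away-triple`
    -- applies. Otherwise the first product stays over `a` in `T`, and the two sides lie over `c`
    -- and `a ⋆ c`.
    ¬assoc : ∀ p → p ≢ inj₁ (inj₁ ∞) → p ≢ inj₁ (inj₁ ∞) ∙ inj₂ (a , i) →
             c ≢ a → c ≢ base a p → c ≢ a ⋆ base a p → ¬ Assoc (inj₂ (a , i)) p (inj₂ (c , k))
    ¬assoc (inj₁ y) p≢∞ _ c≢a _ _ eq =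
      shift-away (λ e → p≢∞ (cong inj₁ e)) x i
        (L.+-cancelʳ (lev i L.+ lev k) (begin
          level-shift y k L.+ (lev i L.+ lev k)
            ≡⟨ prove (lev i ∷ lev k ∷ level-shift y k ∷ []) (v₂ ⊕ (v₀ ⊕ v₁)) (v₀ ⊕ (v₁ ⊕ v₂)) refl ⟩
          lev i L.+ (lev k L.+ level-shift y k)
            ≡⟨ cong (lev i L.+_) (sym (lev-σ y k)) ⟩
          lev i L.+ lev (σ y k)
            ≡⟨ neg-inj levs ⟩
          lev (σ y i) L.+ lev k
            ≡⟨ cong (L._+ lev k) (lev-σ y i) ⟩
          lev i L.+ level-shift y i L.+ lev k
            ≡⟨ prove (lev i ∷ lev k ∷ level-shift y i ∷ []) (v₀ ⊕ v₂ ⊕ v₁) (v₂ ⊕ (v₀ ⊕ v₁)) refl ⟩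
          level-shift y i L.+ (lev i L.+ lev k) ∎))
      where
      open ≡-Reasoning
      open Solver Level₃
      neg-inj : ∀ {s t} → L.- s ≡ L.- t → s ≡ t
      neg-inj {s} {t} e = trans (prove (s ∷ []) v₀ (⊖ ⊖ v₀) refl)
                                (trans (cong L.-_ e) (prove (t ∷ []) (⊖ ⊖ v₀) v₀ refl))
      levs : L.- (lev i L.+ lev (σ y k)) ≡ L.- (lev (σ y i) L.+ lev k)
      levs = cong lev (inj₂-pt (trans (sym (across i (σ y k) (λ e → c≢a (sym e))))
                                  (trans eq (across (σ y i) k (λ e → c≢a (sym e))))))
    ¬assoc (inj₂ (b , j)) _ p≢∞z c≢a c≢b c≢ab eq with a ≟ⱽ b
    ... | no a≢b = away-triple (lev i) (lev j) (cong lev (inj₂-pt (begin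
        inj₂ (a ⋆ (b ⋆ c) , third i (third j k))
          ≡⟨ sym (across i (third j k) (λ e → c≢ab (sym (trans (SV.comm a b) (SV.swap (sym e)))))) ⟩
        inj₂ (a , i) ∙ inj₂ (b ⋆ c , third j k)
          ≡⟨ cong (inj₂ (a , i) ∙_) (sym (across j k (λ e → c≢b (sym e)))) ⟩
        inj₂ (a , i) ∙ (inj₂ (b , j) ∙ inj₂ (c , k))
          ≡⟨ eq ⟩
        inj₂ (a ⋆ b , third i j) ∙ inj₂ (c , k)
          ≡⟨ across (third i j) k (λ e → c≢ab (sym e)) ⟩
        inj₂ ((a ⋆ b) ⋆ c , third (third i j) k) ∎)))
      where open ≡-Reasoning
    ... | yes refl with F.τ a i j in τ-eq
    ...   | inj₂ l = c≢a (sym (SV.fixed (inj₂-fib (trans (sym lhs) lhs′))))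
      where
      lhs : inj₂ (a , i) ∙ (inj₂ (a , j) ∙ inj₂ (c , k)) ≡ inj₂ (a ⋆ c , third l k)
      lhs = trans eq (across l k (λ e → c≢a (sym e)))
      lhs′ : inj₂ (a , i) ∙ (inj₂ (a , j) ∙ inj₂ (c , k)) ≡ inj₂ (c , third i (third j k))
      lhs′ = trans (cong (inj₂ (a , i) ∙_) (across j k (λ e → c≢a (sym e))))
               (trans (across i (third j k) (λ e → c≢a (sym (SV.absorb (sym e)))))
                      (cong (λ d → inj₂ (d , third i (third j k))) (SV.invol a c)))
    ...   | inj₁ y = shift-away y≢∞ x i (L.+-cancelʳ (lev k) (begin
          level-shift y k L.+ lev k
            ≡⟨ L.+-comm (level-shift y k) (lev k) ⟩
          lev k L.+ level-shift y k
            ≡⟨ sym (lev-σ y k) ⟩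
          lev (σ y k)
            ≡⟨ sym (cong lev (inj₂-pt (trans (sym lhs′) eq))) ⟩
          L.- (lev i L.+ L.- (lev j L.+ lev k))
            ≡⟨ cong (λ m → L.- (lev i L.+ L.- (m L.+ lev k)))
                 (trans (cong lev (sym (Fibre.σ-τ (F.fibre a) τ-eq))) (lev-σ y i)) ⟩
          L.- (lev i L.+ L.- (lev i L.+ level-shift y i L.+ lev k))
            ≡⟨ prove (lev i ∷ lev k ∷ level-shift y i ∷ []) (⊖ (v₀ ⊕ ⊖ (v₀ ⊕ v₂ ⊕ v₁))) (v₂ ⊕ v₁) refl ⟩
          level-shift y i L.+ lev k ∎))
      where
      open ≡-Reasoning
      open Solver Level₃
      lhs′ : inj₂ (a , i) ∙ (inj₂ (a , j) ∙ inj₂ (c , k)) ≡ inj₂ (c , third i (third j k))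
      lhs′ = trans (cong (inj₂ (a , i) ∙_) (across j k (λ e → c≢a (sym e))))
               (trans (across i (third j k) (λ e → c≢a (sym (SV.absorb (sym e)))))
                      (cong (λ d → inj₂ (d , third i (third j k))) (SV.invol a c)))
      y≢∞ : y ≢ inj₁ ∞
      y≢∞ refl = p≢∞z (cong (λ j → inj₂ (a , j)) (sym (Fibre.σ-τ (F.fibre a) τ-eq)))

  -- For `p` in `Y` the bit is flipped twice on one side and once on the other; for `p` over a place
  -- other than `c`, associativity would make the sum in `shift-probe` vanish.
  ¬assoc-Y : ∀ {y c x} → y ≢ inj₁ ∞ → ∀ p → c ≢ base (c ⋆ c) p ⊎ (∃ λ w → p ≡ inj₁ w) →
             ¬ Assoc (inj₁ y) p (inj₂ (c , probe y x))
  ¬assoc-Y {y} {c} {x} y≢∞ (inj₁ w) _ eq =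
    Boolₚ.not-¬ {proj₁ (probe y x)} refl (sym (begin
      not (proj₁ (probe y x))              ≡⟨ sym (σ-flips (y SY.· w) (probe y x)) ⟩
      proj₁ (σ (y SY.· w) (probe y x))     ≡⟨ cong proj₁ (inj₂-pt (sym eq)) ⟩
      proj₁ (σ y (σ w (probe y x)))        ≡⟨ σ-flips y _ ⟩
      not (proj₁ (σ w (probe y x)))        ≡⟨ cong not (σ-flips w _) ⟩
      not (not (proj₁ (probe y x)))        ≡⟨ Boolₚ.not-involutive _ ⟩
      proj₁ (probe y x) ∎))
    where open ≡-Reasoning
  ¬assoc-Y y≢∞ (inj₂ (b , j)) (inj₂ (w , ()))
  ¬assoc-Y {y} {c} {x} y≢∞ (inj₂ (b , j)) (inj₁ c≢b) eq =
    shift-probe y≢∞ x j (begin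
      level-shift y l L.+ level-shift y j
        ≡⟨ prove (lev j ∷ lev l ∷ level-shift y j ∷ level-shift y l ∷ [])
             (v₃ ⊕ v₂) ((v₁ ⊕ v₃) ⊕ (v₀ ⊕ v₂) ⊕ ⊖ (v₀ ⊕ v₁)) refl ⟩
      (lev l L.+ level-shift y l) L.+ (lev j L.+ level-shift y j) L.+ L.- (lev j L.+ lev l)
        ≡⟨ cong₂ (λ s t → s L.+ t L.+ L.- (lev j L.+ lev l)) (sym (lev-σ y l)) (sym (lev-σ y j)) ⟩
      lev (σ y l) L.+ lev (σ y j) L.+ L.- (lev j L.+ lev l)
        ≡⟨ cong (λ s → s L.+ lev (σ y j) L.+ L.- (lev j L.+ lev l)) (cong lev (inj₂-pt eq′)) ⟩
      L.- (lev (σ y j) L.+ lev k) L.+ lev (σ y j) L.+ L.- (lev j L.+ L.- (lev j L.+ lev k))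
        ≡⟨ prove (lev j ∷ lev k ∷ lev (σ y j) ∷ [])
             (⊖ (v₂ ⊕ v₁) ⊕ v₂ ⊕ ⊖ (v₀ ⊕ ⊖ (v₀ ⊕ v₁))) 𝟘 refl ⟩
      0F ∎)
    where
    open ≡-Reasoning
    open Solver Level₃
    k l : T
    k = probe y x
    l = third j k
    b≢c : b ≢ c
    b≢c e = c≢b (sym e)
    eq′ : inj₂ {A = Y} (b ⋆ c , σ y l) ≡ inj₂ (b ⋆ c , third (σ y j) k)
    eq′ = trans (cong (inj₁ y ∙_) (sym (across j k b≢c))) (trans eq (across (σ y j) k b≢c))

  assoc-∞ : ∀ {a c i k} → a ≢ c → Assoc (inj₁ (inj₁ ∞)) (inj₂ (a , i)) (inj₂ (c , k))
  assoc-∞ {a} {c} {i@(ε , ℓ , x)} {k@(δ , m , w)} a≢c = begin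
    inj₁ (inj₁ ∞) ∙ (inj₂ (a , i) ∙ inj₂ (c , k))
      ≡⟨ cong (inj₁ (inj₁ ∞) ∙_) (across i k a≢c) ⟩
    inj₂ (a ⋆ c , σ (inj₁ ∞) (third i k))
      ≡⟨ cong (λ t → inj₂ (a ⋆ c , t)) (σ-∞ _ _ _) ⟩
    inj₂ (a ⋆ c , not (ε xor δ) , L.- (ℓ L.+ m) , - (x + w))
      ≡⟨ cong (λ α → inj₂ (a ⋆ c , α , L.- (ℓ L.+ m) , - (x + w))) (not-xor ε δ) ⟩
    inj₂ (a ⋆ c , third (not ε , ℓ , x) k)
      ≡⟨ cong (λ t → inj₂ (a ⋆ c , third t k)) (sym (σ-∞ ε ℓ x)) ⟩
    inj₂ (a ⋆ c , third (σ (inj₁ ∞) i) k)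
      ≡⟨ sym (across (σ (inj₁ ∞) i) k a≢c) ⟩
    (inj₁ (inj₁ ∞) ∙ inj₂ (a , i)) ∙ inj₂ (c , k) ∎
    where
    open ≡-Reasoning
    not-xor : ∀ ε δ → not (ε xor δ) ≡ (not ε) xor δ
    not-xor false δ = refl
    not-xor true  δ = Boolₚ.not-involutive δ

  ¬assoc-∞ : ∀ y a i → ¬ Assoc (inj₁ (inj₁ ∞)) (inj₁ y) (inj₂ (a , i))
  ¬assoc-∞ y a i eq = Boolₚ.not-¬ {proj₁ i} refl (sym (begin
      not (proj₁ i)                           ≡⟨ sym (σ-flips (inj₁ ∞ SY.· y) i) ⟩
      proj₁ (σ (inj₁ ∞ SY.· y) i)             ≡⟨ cong proj₁ (inj₂-pt (sym eq)) ⟩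
      proj₁ (σ (inj₁ ∞) (σ y i))              ≡⟨ σ-flips (inj₁ ∞) (σ y i) ⟩
      not (proj₁ (σ y i))                     ≡⟨ cong not (σ-flips y i) ⟩
      not (not (proj₁ i))                     ≡⟨ Boolₚ.not-involutive _ ⟩
      proj₁ i ∎))
    where open ≡-Reasoning

module Detection
  {B K E V : Set} (G : OddGroup B) (𝔻 : DifferenceSet G K) (H : Hole E)
  (SV : Steiner V) (_≟ⱽ_ : DecidableEquality V)
  (twist : V → Fin 3 → B → B → Bool)
  (twist-comm : ∀ a ℓ x y → twist a ℓ x y ≡ twist a ℓ y x)
  (SY : Steiner (E ⊎ (K × Fin 3)))
  (_≟ᵁ_ : DecidableEquality ((E ⊎ (K × Fin 3)) ⊎ (V × (Bool × Fin 3 × B))))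
  (fresh : (f : E ⊎ (K × Fin 3) → B) → ∃ λ x → ∀ y → f y ≢ x)
  (¬embed : (f : B → E ⊎ (K × Fin 3)) → ¬ (∀ {x y} → f x ≡ f y → x ≡ y))
  (avoid : (f : Fin 5 → V) → ∃ λ c → ∀ i → f i ≢ c)
  (a₀ : V) (k₀ : K)
  (generated : (P : B → Set) → P (OddGroup.0# G) →
     (∀ x → P x → P (OddGroup._+_ G x (DifferenceSet.D 𝔻 k₀))) → ∀ x → P x)
  where

  open BoseProduct G 𝔻 H SV _≟ⱽ_ twist twist-comm SY public

  infty : U
  infty = inj₁ (inj₁ ∞)

  -- For z = ∞ two points over different places of V suffice, up to the points
  -- of Y; any other z satisfies the condition for no pair avoiding ∞ and ∞ z.
  record Central (z : U) : Set where
    field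
      exception : Y → U
      p         : Fin 3 → Bool → U
      disjoint  : ∀ {i j s t} → p i s ≡ p j t → i ≡ j
      cover     : ∀ i q → (∀ y → exception y ≢ q) → Assoc z (p i false) q ⊎ Assoc z (p i true) q

  crdU : U → B
  crdU (inj₁ _)       = 0#
  crdU (inj₂ (_ , i)) = crd i

  crd-probe : ∀ y x → crd (probe y x) ≡ x
  crd-probe (inj₁ e)       x = refl
  crd-probe (inj₂ (k , α)) x = refl

  place : Bool → V
  place false = a₀
  place true  = proj₁ (avoid (λ _ → a₀))

  central-∞ : Central infty
  central-∞ = record
    { exception = inj₁
    -- The three levels keep the pairs disjoint. The second place serves the points `q` that lie
    -- over the first, where `assoc-∞` does not apply.
    ; p         = λ i s → inj₂ (place s , false , i , 0#)
    ; disjoint  = λ eq → cong lev (inj₂-pt eq)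
    ; cover     = cover }
    where
    Covered : Fin 3 → U → Set
    Covered i q = Assoc infty (inj₂ (a₀ , false , i , 0#)) q
                ⊎ Assoc infty (inj₂ (place true , false , i , 0#)) q

    covered : ∀ i {c} k → Dec (a₀ ≡ c) → Covered i (inj₂ (c , k))
    covered i k (no a₀≢c)  = inj₁ (assoc-∞ a₀≢c)
    covered i k (yes refl) = inj₂ (assoc-∞ (λ e → proj₂ (avoid (λ _ → a₀)) 0F (sym e)))

    cover : ∀ i q → (∀ y → inj₁ y ≢ q) → Covered i q
    cover i (inj₁ y)       exc = ⊥-elim (exc y refl)
    cover i (inj₂ (c , k)) exc = covered i k (a₀ ≟ⱽ c)

  module _ {z : U} (C : Central z) where
    open Central C

    freshB : ∃ λ x → ∀ y → crdU (exception y) ≢ x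
    freshB = fresh (λ y → crdU (exception y))

    place-pair : Fin 5 → V
    place-pair 0F = base a₀ (p 0F false)
    place-pair _  = base a₀ (p 0F true)

    base-or-Y : ∀ {c} q → base a₀ q ≢ c → c ≢ base (c ⋆ c) q ⊎ (∃ λ w → q ≡ inj₁ w)
    base-or-Y (inj₁ w) _ = inj₂ (w , refl)
    base-or-Y (inj₂ _) n = inj₁ (λ e → n (sym e))

    central-Y : ∀ {y} → z ≡ inj₁ y → y ≡ inj₁ ∞
    central-Y {y} refl with inj₁ y ≟ᵁ infty
    ... | yes eq  = inj₁-injective eq
    ... | no  neq with avoid place-pair | freshB
    ...   | c , c∉ | x , x∉ with cover 0F (inj₂ (c , probe y x))
                                (λ y′ e → x∉ y′ (trans (cong crdU e) (crd-probe y x)))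
    ...     | inj₁ as = ⊥-elim (¬assoc-Y (λ e → neq (cong inj₁ e)) (p 0F false)
                                  (base-or-Y (p 0F false) (c∉ 0F)) as)
    ...     | inj₂ as = ⊥-elim (¬assoc-Y (λ e → neq (cong inj₁ e)) (p 0F true)
                                  (base-or-Y (p 0F true) (c∉ 1F)) as)

    module _ {a : V} {i : T} (z≡ : z ≡ inj₂ (a , i)) where
      key : Fin 2 → U
      key 0F = infty
      key 1F = infty ∙ z

      isKey : ∀ q → (∃ λ m → q ≡ key m) ⊎ (q ≢ infty × q ≢ infty ∙ z)
      isKey q with q ≟ᵁ infty | q ≟ᵁ (infty ∙ z)
      ... | yes e | _     = inj₁ (0F , e)
      ... | no _  | yes e = inj₁ (1F , e)
      ... | no n  | no n′ = inj₂ (n , n′)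

      places : Fin 3 → Fin 5 → V
      places j 0F = a
      places j 1F = base a (p j false)
      places j 2F = a ⋆ base a (p j false)
      places j 3F = base a (p j true)
      places j 4F = a ⋆ base a (p j true)

      -- If neither point of the pair were a key, a point with a fresh coordinate over a place off
      -- all five `places` would contradict `cover` through `¬assoc`.
      keys : ∀ j → ∃ λ m → ∃ λ s → p j s ≡ key m
      keys j with isKey (p j false) | isKey (p j true)
      ... | inj₁ (m , e) | _            = m , false , e
      ... | inj₂ _       | inj₁ (m , e) = m , true , e
      ... | inj₂ (n , n′) | inj₂ (o , o′) with avoid (places j) | freshB
      ...   | c , c∉ | x , x∉
              with cover j (inj₂ (c , away x i)) (λ y′ e → x∉ y′ (cong crdU e))
      ...     | inj₁ as = ⊥-elim (¬assoc x (p j false) n (subst (λ w → p j false ≢ infty ∙ w) z≡ n′)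
                (λ e → c∉ 0F (sym e)) (λ e → c∉ 1F (sym e)) (λ e → c∉ 2F (sym e))
                (subst (λ w → Assoc w (p j false) _) z≡ as))
      ...     | inj₂ as = ⊥-elim (¬assoc x (p j true) o (subst (λ w → p j true ≢ infty ∙ w) z≡ o′)
                (λ e → c∉ 0F (sym e)) (λ e → c∉ 3F (sym e)) (λ e → c∉ 4F (sym e))
                (subst (λ w → Assoc w (p j true) _) z≡ as))

      -- Two keys cannot meet three disjoint pairs, which is why `Central` asks for three.
      ¬central-T : ⊥
      ¬central-T with Finₚ.pigeonhole (ℕₚ.n<1+n 2) (λ j → proj₁ (keys j))
      ... | j , j′ , j<j′ , eq = ℕₚ.<-irrefl (cong toℕ (disjoint (trans (proj₂ (proj₂ (keys j)))
                       (trans (cong key eq) (sym (proj₂ (proj₂ (keys j′)))))))) j<j′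

  central-unique : ∀ {z} → Central z → z ≡ infty
  central-unique {inj₁ y} C = cong inj₁ (central-Y C refl)
  central-unique {inj₂ _} C = ⊥-elim (¬central-T C refl)

  -- ∞ toggles the bit, `(k₀ , 1F)` moves along level 0 by `D k₀`, and `(k₀ , ℓ)` climbs from ℓ to
  -- `up ℓ`. A fibre is thus a single orbit under products with `Y`, so an automorphism that keeps
  -- `Y` carries it into one fibre.
  connected : (P : T → Set) → P TG.0# → (∀ y i → P i → P (σ y i)) → ∀ i → P i
  connected P P0 Pσ = all
    where
    toggle : ∀ {ε ℓ x} → P (ε , ℓ , x) → P (not ε , ℓ , x)
    toggle {ε} {ℓ} {x} q = subst P (σ-∞ ε ℓ x) (Pσ (inj₁ ∞) _ q)

    either : ∀ {ℓ x} → P (false , ℓ , x) → ∀ ε → P (ε , ℓ , x)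
    either q false = q
    either q true  = toggle q

    climb : ∀ {ℓ} → (∀ x → P (false , ℓ , x)) → ∀ x → P (false , up ℓ , x)
    climb {ℓ} q x = subst P
      (trans (σ-same k₀ true ℓ _) (triple≡ refl
        (prove (x ∷ half (D k₀) ∷ []) (v₀ ⊕ ⊖ v₁ ⊕ v₁) v₀ refl)))
      (Pσ (inj₂ (k₀ , ℓ)) _ (either (q (x + - half (D k₀))) true))
      where open Solver group

    ground : ∀ x → P (false , 0F , x)
    ground = generated (λ x → P (false , 0F , x)) P0
      (λ x q → toggle (subst P (σ-rising k₀ false 0F x) (Pσ (inj₂ (k₀ , 1F)) _ q)))

    all : ∀ i → P i
    all (ε , 0F , x) = either (ground x) ε
    all (ε , 1F , x) = either (climb ground x) ε
    all (ε , 2F , x) = either (climb (climb ground) x) ε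

  central-θ : (A : Automorphism steiner) → ∀ {z} → Central z → Central (Automorphism.θ A z)
  central-θ A {z} C = record
    { exception = λ y → θ (exception y)
    ; p         = λ i s → θ (p i s)
    ; disjoint  = λ eq → disjoint (θ-inj eq)
    ; cover     = λ i q exc → move i q (cover i (θ⁻ q) (λ y e → exc y (trans (cong θ e) (θ-θ⁻ q)))) }
    where
    open Central C
    open Automorphism A
    along : ∀ {p} q → Assoc z p (θ⁻ q) → Assoc (θ z) (θ p) q
    along {p} q as = trans (cong (λ w → θ z ∙ (θ p ∙ w)) (sym (θ-θ⁻ q)))
      (trans (cong (θ z ∙_) (sym (homo p (θ⁻ q)))) (trans (sym (homo z (p ∙ θ⁻ q)))
        (trans (cong θ as) (trans (homo (z ∙ p) (θ⁻ q)) (cong₂ _∙_ (homo z p) (θ-θ⁻ q))))))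
    move : ∀ i q → Assoc z (p i false) (θ⁻ q) ⊎ Assoc z (p i true) (θ⁻ q) →
           Assoc (θ z) (θ (p i false)) q ⊎ Assoc (θ z) (θ (p i true)) q
    move i q (inj₁ as) = inj₁ (along q as)
    move i q (inj₂ as) = inj₂ (along q as)

  module Invariant (A : Automorphism steiner) where
    open Automorphism A

    θ-∞ : θ infty ≡ infty
    θ-∞ = central-unique (central-θ A central-∞)

    θ-assoc : ∀ {p q} → Assoc infty p q → Assoc infty (θ p) (θ q)
    θ-assoc {p} {q} as = begin
      infty ∙ (θ p ∙ θ q)    ≡⟨ cong₂ _∙_ (sym θ-∞) (sym (homo p q)) ⟩
      θ infty ∙ θ (p ∙ q)    ≡⟨ sym (homo infty (p ∙ q)) ⟩
      θ (infty ∙ (p ∙ q))    ≡⟨ cong θ as ⟩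
      θ ((infty ∙ p) ∙ q)    ≡⟨ homo (infty ∙ p) q ⟩
      θ (infty ∙ p) ∙ θ q    ≡⟨ cong (_∙ θ q) (homo infty p) ⟩
      (θ infty ∙ θ p) ∙ θ q  ≡⟨ cong (λ w → (w ∙ θ p) ∙ θ q) θ-∞ ⟩
      (infty ∙ θ p) ∙ θ q ∎
      where open ≡-Reasoning

    -- Otherwise every point over another place would have to go into Y.
    T↛Y : ∀ {a i y} → θ (inj₂ (a , i)) ≢ inj₁ y
    T↛Y {a} {i} {y} eq = ¬embed (λ x → proj₁ (intoY x)) (λ {x} {x′} e →
        cong crd (inj₂-pt (θ-inj (trans (proj₂ (intoY x)) (trans (cong inj₁ e) (sym (proj₂ (intoY x′))))))))
      where
      c : V
      c = proj₁ (avoid (λ _ → a))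
      intoY : ∀ x → ∃ λ w → θ (inj₂ (c , false , 0F , x)) ≡ inj₁ w
      intoY x with θ (inj₂ (c , false , 0F , x)) in eq′
      ... | inj₁ w       = w , refl
      ... | inj₂ (b , j) = ⊥-elim (¬assoc-∞ y b j (subst₂ (Assoc infty) eq eq′
                             (θ-assoc (assoc-∞ (proj₂ (avoid (λ _ → a)) 0F)))))

    θT : ∀ a i → ∃ λ w → θ (inj₂ (a , i)) ≡ inj₂ w
    θT a i with θ (inj₂ (a , i)) in eq
    ... | inj₁ y = ⊥-elim (T↛Y eq)
    ... | inj₂ w = w , refl

  module Decomposition (A : Automorphism steiner) where
    open Automorphism A
    open Invariant A public
    private module A⁻ = Invariant inverse

    θY : ∀ y → ∃ λ w → θ (inj₁ y) ≡ inj₁ w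
    θY y with θ (inj₁ y) in eq
    ... | inj₁ w       = w , refl
    ... | inj₂ (b , j) = ⊥-elim (A⁻.T↛Y (trans (cong θ⁻ (sym eq)) (θ⁻-θ (inj₁ y))))

    β : Y → Y
    β y = proj₁ (θY y)

    π : V → V
    π a = proj₁ (proj₁ (θT a TG.0#))

    α : V → T → T
    α a i = proj₂ (proj₁ (θT a i))

    θ-Y : ∀ y → θ (inj₁ y) ≡ inj₁ (β y)
    θ-Y y = proj₂ (θY y)

    same-place : ∀ a i → proj₁ (proj₁ (θT a i)) ≡ π a
    same-place a = connected _ refl (λ y i eq → trans (sym (inj₂-fib (begin
        inj₁ (β y) ∙ inj₂ (proj₁ (θT a i))  ≡⟨ cong₂ _∙_ (sym (θ-Y y)) (sym (proj₂ (θT a i))) ⟩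
        θ (inj₁ y) ∙ θ (inj₂ (a , i))       ≡⟨ sym (homo (inj₁ y) (inj₂ (a , i))) ⟩
        θ (inj₂ (a , σ y i))                ≡⟨ proj₂ (θT a (σ y i)) ⟩
        inj₂ (proj₁ (θT a (σ y i))) ∎))) eq)
      where open ≡-Reasoning

    θ-T : ∀ a i → θ (inj₂ (a , i)) ≡ inj₂ (π a , α a i)
    θ-T a i = trans (proj₂ (θT a i)) (cong (λ c → inj₂ (c , α a i)) (same-place a i))

  module _ (A : Automorphism steiner) where
    open Automorphism A
    open Decomposition A
    private module A⁻ = Decomposition inverse

    π⁻-π : ∀ a → A⁻.π (π a) ≡ a
    π⁻-π a = inj₂-fib (trans (sym (A⁻.θ-T (π a) (α a TG.0#)))
                             (trans (cong θ⁻ (sym (θ-T a TG.0#))) (θ⁻-θ _)))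

-- Rigidity

-- Intended for κ = the translation part of an automorphism on the fibre over each place: these
-- parts sum to zero along every line.
module ZeroSum {V A : Set} (SV : Steiner V) (avoid : (f : Fin 5 → V) → ∃ λ c → ∀ i → f i ≢ c)
  (veblen : ∀ {a b c} → a ≢ b → c ≢ a → c ≢ b → c ≢ Steiner._·_ SV a b →
            Steiner._·_ SV b (Steiner._·_ SV a c) ≡ Steiner._·_ SV a (Steiner._·_ SV b c))
  (GA : AbGroup A) (2-cancel : ∀ {x y} → AbGroup._+_ GA x x ≡ AbGroup._+_ GA y y → x ≡ y)
  (κ : V → A)
  (κ-sum : ∀ {a b} → a ≢ b → κ (Steiner._·_ SV a b) ≡ AbGroup.-_ GA (AbGroup._+_ GA (κ a) (κ b)))
  where
  open Steiner SV
  open AbGroup GA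
  open Solver GA

  -- The four lines of a quadrangle in which a and b are opposite.
  zero-sum-≢ : ∀ {a b} → a ≢ b → κ a ≡ κ b
  zero-sum-≢ {a} {b} a≢b = 2-cancel (begin
      κ a + κ a
        ≡⟨ prove (κ a ∷ κ b ∷ κ c ∷ []) (v₀ ⊕ v₀) (⊖ (v₁ ⊕ ⊖ (v₀ ⊕ v₂)) ⊕ v₁ ⊕ v₀ ⊕ ⊖ v₂) refl ⟩
      - (κ b + - (κ a + κ c)) + κ b + κ a + - κ c
        ≡⟨ cong (λ w → w + κ b + κ a + - κ c) both ⟩
      - (κ a + - (κ b + κ c)) + κ b + κ a + - κ c
        ≡⟨ prove (κ a ∷ κ b ∷ κ c ∷ []) (⊖ (v₀ ⊕ ⊖ (v₁ ⊕ v₂)) ⊕ v₁ ⊕ v₀ ⊕ ⊖ v₂) (v₁ ⊕ v₁) refl ⟩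
      κ b + κ b ∎)
    where
    open ≡-Reasoning
    spots : Fin 5 → V
    spots 0F = a
    spots 1F = b
    spots _  = a · b
    c : V
    c = proj₁ (avoid spots)
    a≢c : a ≢ c
    a≢c = proj₂ (avoid spots) 0F
    b≢c : b ≢ c
    b≢c = proj₂ (avoid spots) 1F
    ab≢c : a · b ≢ c
    ab≢c = proj₂ (avoid spots) 2F
    b≢ac : b ≢ a · c
    b≢ac e = ab≢c (swap (sym e))
    a≢bc : a ≢ b · c
    a≢bc e = ab≢c (trans (comm a b) (swap (sym e)))
    both : - (κ b + - (κ a + κ c)) ≡ - (κ a + - (κ b + κ c))
    both = begin
      - (κ b + - (κ a + κ c))  ≡⟨ cong (λ w → - (κ b + w)) (sym (κ-sum a≢c)) ⟩
      - (κ b + κ (a · c))      ≡⟨ sym (κ-sum b≢ac) ⟩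
      κ (b · (a · c))          ≡⟨ cong κ (veblen a≢b (λ e → a≢c (sym e)) (λ e → b≢c (sym e)) (λ e → ab≢c (sym e))) ⟩
      κ (a · (b · c))          ≡⟨ κ-sum a≢bc ⟩
      - (κ a + κ (b · c))      ≡⟨ cong (λ w → - (κ a + w)) (κ-sum b≢c) ⟩
      - (κ a + - (κ b + κ c)) ∎

  zero-sum-3 : ∀ a → κ a + κ a + κ a ≡ 0#
  zero-sum-3 a = begin
      κ a + κ a + κ a          ≡⟨ cong (λ w → κ a + w + κ a) (zero-sum-≢ a≢b) ⟩
      κ a + κ b + κ a          ≡⟨ cong (κ a + κ b +_) (zero-sum-≢ (λ e → a≢b (absorb (sym e)))) ⟩
      κ a + κ b + κ (a · b)    ≡⟨ cong (κ a + κ b +_) (κ-sum a≢b) ⟩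
      κ a + κ b + - (κ a + κ b) ≡⟨ +-inverseʳ _ ⟩
      0# ∎
    where
    open ≡-Reasoning
    b : V
    b = proj₁ (avoid (λ _ → a))
    a≢b : a ≢ b
    a≢b = proj₂ (avoid (λ _ → a)) 0F

-- The pair marked on level 0 pins the translations and multipliers of a fibre, the
-- pair marked on level 1 records c as the colour of the place.
module Marks {B : Set} (G : OddGroup B) (one : B) where
  open OddGroup G

  isPair : B → B → B → B → Bool
  isPair u v x y = (does (x ≟ u) ∧ does (y ≟ v)) ∨ (does (y ≟ u) ∧ does (x ≟ v))

  -- Level 2 is left blank so that no rotation of the levels can preserve the marks.
  mark : B → Fin 3 → B → B → Bool
  mark c 0F x y = isPair 0# one x y
  mark c 1F x y = isPair 0# c x y
  mark c 2F x y = false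

  mark-comm : ∀ c ℓ x y → mark c ℓ x y ≡ mark c ℓ y x
  mark-comm c 0F x y = Boolₚ.∨-comm (does (x ≟ 0#) ∧ does (y ≟ one)) _
  mark-comm c 1F x y = Boolₚ.∨-comm (does (x ≟ 0#) ∧ does (y ≟ c)) _
  mark-comm c 2F x y = refl

  isPair-self : ∀ v → isPair 0# v 0# v ≡ true
  isPair-self v = cong₂ (λ s t → (s ∧ t) ∨ (does (v ≟ 0#) ∧ does (0# ≟ v)))
                        (dec-true (0# ≟ 0#) refl) (dec-true (v ≟ v) refl)

  isPair⇒≡ : ∀ {v m} → v ≢ 0# → isPair 0# v 0# m ≡ true → m ≡ v
  isPair⇒≡ {v} {m} v≢0 eq with 0# ≟ v
  ... | yes e  = ⊥-elim (v≢0 (sym e))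
  ... | no  _  with does (0# ≟ 0#) | m ≟ v | does (m ≟ 0#)
  ...   | _     | yes e | _     = e
  isPair⇒≡ {v} {m} v≢0 () | no _ | false | no _ | false
  isPair⇒≡ {v} {m} v≢0 () | no _ | false | no _ | true
  isPair⇒≡ {v} {m} v≢0 () | no _ | true  | no _ | false
  isPair⇒≡ {v} {m} v≢0 () | no _ | true  | no _ | true

module Rigidity
  {B K E V : Set} (G : OddGroup B) (𝔻 : DifferenceSet G K) (H : Hole E)
  (SV : Steiner V) (_≟ⱽ_ : DecidableEquality V)
  (one : B) (c : V → B)
  (SY : Steiner (E ⊎ (K × Fin 3)))
  (_≟ᵁ_ : DecidableEquality ((E ⊎ (K × Fin 3)) ⊎ (V × (Bool × Fin 3 × B))))
  (fresh : (f : E ⊎ (K × Fin 3) → B) → ∃ λ x → ∀ y → f y ≢ x)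
  (¬embed : (f : B → E ⊎ (K × Fin 3)) → ¬ (∀ {x y} → f x ≡ f y → x ≡ y))
  (avoid : (f : Fin 5 → V) → ∃ λ c → ∀ i → f i ≢ c)
  (veblen : ∀ {a b c} → a ≢ b → c ≢ a → c ≢ b → c ≢ Steiner._·_ SV a b →
            Steiner._·_ SV b (Steiner._·_ SV a c) ≡ Steiner._·_ SV a (Steiner._·_ SV b c))
  (a₀ : V) (k₀ : K)
  (generated : (P : B → Set) → P (OddGroup.0# G) →
     (∀ x → P x → P (OddGroup._+_ G x one)) → ∀ x → P x)
  (D-k₀ : DifferenceSet.D 𝔻 k₀ ≡ OddGroup._+_ G one one)
  (3-free : ∀ {x} → OddGroup._+_ G (OddGroup._+_ G x x) x ≡ OddGroup.0# G → x ≡ OddGroup.0# G)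
  (third-of : ∀ x → ∃ λ z → OddGroup._+_ G (OddGroup._+_ G z z) z ≡ x)
  (one≢0 : one ≢ OddGroup.0# G) (c≢0 : ∀ a → c a ≢ OddGroup.0# G)
  (one∉D : ∀ k → DifferenceSet.D 𝔻 k ≢ one) (c∉D : ∀ a k → DifferenceSet.D 𝔻 k ≢ c a)
  where

  open Marks G one

  -- A step of `one` in z is a step of `one + one`, that is of `D k₀`, in z + z, and every element
  -- is the double of its half.
  generated′ : (P : B → Set) → P (OddGroup.0# G) →
     (∀ x → P x → P (OddGroup._+_ G x (DifferenceSet.D 𝔻 k₀))) → ∀ x → P x
  generated′ P P0 P+ x = subst P (half-double x)
    (generated (λ z → P (z + z)) (subst P (sym (+-identityˡ 0#)) P0)
      (λ z q → subst P (trans (cong (z + z +_) D-k₀)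
                 (prove (z ∷ one ∷ []) (v₀ ⊕ v₀ ⊕ (v₁ ⊕ v₁)) (v₀ ⊕ v₁ ⊕ (v₀ ⊕ v₁)) refl)) (P+ _ q))
      (half x))
    where
    open OddGroup G
    open Solver group

  open Detection G 𝔻 H SV _≟ⱽ_ (λ a → mark (c a)) (λ a → mark-comm (c a)) SY _≟ᵁ_
                 fresh ¬embed avoid a₀ k₀ generated′ public

  τ-marked : ∀ {a ℓ y} → y ≢ 0# → (∀ k → D k ≢ y) → mark (c a) ℓ 0# y ≡ true →
             F.τ a (false , ℓ , 0#) (false , ℓ , y) ≡ inj₂ (true , up ℓ , half (0# + y))
  τ-marked {a} {ℓ} {y} y≢0 y∉D eq =
    trans (F.τ-same a false ℓ false (λ e → y≢0 (sym e))) (cong (F.above a false ℓ 0# y) glue-eq)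
    where
    open Solver group
    glue-eq : F.glued a ℓ 0# y false false ≡ inj₁ true
    glue-eq with D? (y + - 0#)
    ... | yes (k , e) = ⊥-elim (y∉D k (trans e (prove (y ∷ []) (v₀ ⊕ ⊖ 𝟘) v₀ refl)))
    ... | no _        = cong inj₁ eq

  -- A converse to `τ-marked`: with ε = `false` and δ = `true` only a marked pair remains possible.
  τ-same⁻ : ∀ {a ε ℓ x y δ m z} → x ≢ y → F.τ a (ε , ℓ , x) (ε , ℓ , y) ≡ inj₂ (δ , m , z) →
            m ≡ up ℓ × (δ ≡ ε ⊎ mark (c a) ℓ x y ≡ δ)
  τ-same⁻ {a} {ε} {ℓ} {x} {y} x≢y eq =
    analyse ε (D? (y + - x)) (trans (sym (F.τ-same a ε ℓ ε x≢y)) eq)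
    where
    analyse : ∀ ε {δ m z} (d : Dec (InD (y + - x))) →
      F.above a ε ℓ x y (glue d (mark (c a) ℓ x y) ε ε) ≡ inj₂ (δ , m , z) →
      m ≡ up ℓ × (δ ≡ ε ⊎ mark (c a) ℓ x y ≡ δ)
    analyse false (no _)  refl = refl , inj₂ refl
    analyse true  (no _)  refl = refl , inj₂ refl
    analyse false (yes _) refl = refl , inj₁ refl
    analyse true  (yes _) refl = refl , inj₁ refl

  third-comm : ∀ i j → third i j ≡ third (i TG.+ j) TG.0#
  third-comm i j = prove (i ∷ j ∷ []) (⊖ (v₀ ⊕ v₁)) (⊖ (v₀ ⊕ v₁ ⊕ 𝟘)) refl
    where open Solver groupT

  third-inj : ∀ i j k l → third i j ≡ third k l → i TG.+ j ≡ k TG.+ l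
  third-inj i j k l e = trans (prove (i ∷ j ∷ []) (v₀ ⊕ v₁) (⊖ ⊖ (v₀ ⊕ v₁)) refl)
    (trans (cong TG.-_ e) (prove (k ∷ l ∷ []) (⊖ ⊖ (v₀ ⊕ v₁)) (v₀ ⊕ v₁) refl))
    where open Solver groupT

  double₃ : ∀ {s t} → s L.+ s ≡ t L.+ t → s ≡ t
  double₃ {0F} {0F} _ = refl
  double₃ {1F} {1F} _ = refl
  double₃ {2F} {2F} _ = refl
  double₃ {0F} {1F} ()
  double₃ {0F} {2F} ()
  double₃ {1F} {0F} ()
  double₃ {1F} {2F} ()
  double₃ {2F} {0F} ()
  double₃ {2F} {1F} ()

  module Affine (A : Automorphism steiner)
    (β : Y → Y) (π : V → V) (α : V → T → T)
    (θ-Y : ∀ y → Automorphism.θ A (inj₁ y) ≡ inj₁ (β y))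
    (θ-T : ∀ a i → Automorphism.θ A (inj₂ (a , i)) ≡ inj₂ (π a , α a i))
    (π-inj : ∀ {a b} → π a ≡ π b → a ≡ b)
    (θ-∞ : Automorphism.θ A infty ≡ infty)
    where
    open Automorphism A

    θ-across : ∀ {a b} i j → a ≢ b →
               inj₂ {A = Y} (π (a ⋆ b) , α (a ⋆ b) (third i j)) ≡ inj₂ (π a ⋆ π b , third (α a i) (α b j))
    θ-across {a} {b} i j a≢b = begin
      inj₂ (π (a ⋆ b) , α (a ⋆ b) (third i j))  ≡⟨ sym (θ-T (a ⋆ b) (third i j)) ⟩
      θ (inj₂ (a ⋆ b , third i j))              ≡⟨ cong θ (sym (across i j a≢b)) ⟩
      θ (inj₂ (a , i) ∙ inj₂ (b , j))           ≡⟨ homo _ _ ⟩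
      θ (inj₂ (a , i)) ∙ θ (inj₂ (b , j))       ≡⟨ cong₂ _∙_ (θ-T a i) (θ-T b j) ⟩
      inj₂ (π a , α a i) ∙ inj₂ (π b , α b j)   ≡⟨ across (α a i) (α b j) (λ e → a≢b (π-inj e)) ⟩
      inj₂ (π a ⋆ π b , third (α a i) (α b j)) ∎
      where open ≡-Reasoning

    π-homo : ∀ a b → π (a ⋆ b) ≡ π a ⋆ π b
    π-homo a b with a ≟ⱽ b
    ... | yes refl = trans (cong π (SV.idem a)) (sym (SV.idem (π a)))
    ... | no  a≢b  = inj₂-fib (θ-across TG.0# TG.0# a≢b)

    α-third : ∀ {a b} i j → a ≢ b → α (a ⋆ b) (third i j) ≡ third (α a i) (α b j)
    α-third i j a≢b = inj₂-pt (θ-across i j a≢b)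

    origin : V → T
    origin a = α a TG.0#

    -- Products over two places depend only on i + j, so the pairs (i, j) and (i + j, 0) may be
    -- compared. This is the classical argument that an autotopism of an abelian group is affine.
    α-+ : ∀ {a b} → a ≢ b → ∀ i j → α a i TG.+ α b j ≡ α a (i TG.+ j) TG.+ origin b
    α-+ {a} {b} a≢b i j = third-inj (α a i) (α b j) (α a (i TG.+ j)) (origin b) (trans (sym (α-third i j a≢b))
      (trans (cong (α (a ⋆ b)) (third-comm i j)) (α-third (i TG.+ j) TG.0# a≢b)))

    γ : T → T
    γ i = α a₀ i TG.+ TG.- origin a₀

    b₀ : V
    b₀ = place true

    a₀≢b₀ : a₀ ≢ b₀
    a₀≢b₀ = proj₂ (avoid (λ _ → a₀)) 0F

    α-γ : ∀ a i → α a i ≡ γ i TG.+ origin a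
    α-γ a i with a₀ ≟ⱽ a
    ... | yes refl = prove (α a i ∷ origin a ∷ []) v₀ (v₀ ⊕ ⊖ v₁ ⊕ v₁) refl
      where open Solver groupT
    ... | no a₀≢a = begin
      α a i
        ≡⟨ prove (origin a₀ ∷ α a i ∷ []) v₁ (v₀ ⊕ v₁ ⊕ ⊖ v₀) refl ⟩
      origin a₀ TG.+ α a i TG.+ TG.- origin a₀
        ≡⟨ cong (TG._+ TG.- origin a₀) (α-+ a₀≢a TG.0# i) ⟩
      α a₀ (TG.0# TG.+ i) TG.+ origin a TG.+ TG.- origin a₀
        ≡⟨ cong (λ j → α a₀ j TG.+ origin a TG.+ TG.- origin a₀) (TG.+-identityˡ i) ⟩
      α a₀ i TG.+ origin a TG.+ TG.- origin a₀
        ≡⟨ prove (α a₀ i ∷ origin a ∷ origin a₀ ∷ []) (v₀ ⊕ v₁ ⊕ ⊖ v₂) (v₀ ⊕ ⊖ v₂ ⊕ v₁) refl ⟩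
      γ i TG.+ origin a ∎
      where
      open ≡-Reasoning
      open Solver groupT

    γ-+ : ∀ i j → γ (i TG.+ j) ≡ γ i TG.+ γ j
    γ-+ i j = begin
      α a₀ (i TG.+ j) TG.+ TG.- origin a₀
        ≡⟨ prove (α a₀ (i TG.+ j) ∷ origin a₀ ∷ origin b₀ ∷ [])
             (v₀ ⊕ ⊖ v₁) (v₀ ⊕ v₂ ⊕ ⊖ v₁ ⊕ ⊖ v₂) refl ⟩
      α a₀ (i TG.+ j) TG.+ origin b₀ TG.+ TG.- origin a₀ TG.+ TG.- origin b₀
        ≡⟨ cong (λ w → w TG.+ TG.- origin a₀ TG.+ TG.- origin b₀) (sym (α-+ a₀≢b₀ i j)) ⟩
      α a₀ i TG.+ α b₀ j TG.+ TG.- origin a₀ TG.+ TG.- origin b₀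
        ≡⟨ cong (λ w → α a₀ i TG.+ w TG.+ TG.- origin a₀ TG.+ TG.- origin b₀) (α-γ b₀ j) ⟩
      α a₀ i TG.+ (γ j TG.+ origin b₀) TG.+ TG.- origin a₀ TG.+ TG.- origin b₀
        ≡⟨ prove (α a₀ i ∷ γ j ∷ origin b₀ ∷ origin a₀ ∷ [])
             (v₀ ⊕ (v₁ ⊕ v₂) ⊕ ⊖ v₃ ⊕ ⊖ v₂) (v₀ ⊕ ⊖ v₃ ⊕ v₁) refl ⟩
      γ i TG.+ γ j ∎
      where
      open ≡-Reasoning
      open Solver groupT

    γ-0 : γ TG.0# ≡ TG.0#
    γ-0 = TG.+-inverseʳ (origin a₀)

    α-inj : ∀ {a i j} → α a i ≡ α a j → i ≡ j
    α-inj {a} {i} {j} e = inj₂-pt (θ-inj (trans (θ-T a i) (trans (cong (λ k → inj₂ (π a , k)) e) (sym (θ-T a j)))))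

    γ-inj : ∀ {i j} → γ i ≡ γ j → i ≡ j
    γ-inj {i} {j} e = α-inj {a₀} (trans (α-γ a₀ i) (trans (cong (TG._+ origin a₀) e) (sym (α-γ a₀ j))))

    β-∞ : β (inj₁ ∞) ≡ inj₁ ∞
    β-∞ = inj₁-injective (trans (sym (θ-Y (inj₁ ∞))) θ-∞)

    α-σ : ∀ a y i → α a (σ y i) ≡ σ (β y) (α a i)
    α-σ a y i = inj₂-pt (trans (sym (θ-T a (σ y i))) (trans (homo (inj₁ y) (inj₂ (a , i)))
                               (cong₂ _∙_ (θ-Y y) (θ-T a i))))

    h : T
    h = true , 0F , 0#

    -- ∞ is fixed and translates by `h`, so `α a₀` commutes with that translation.
    γ-h : γ h ≡ h
    γ-h = begin
      α a₀ h TG.+ TG.- origin a₀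
        ≡⟨ cong (λ k → α a₀ k TG.+ TG.- origin a₀) (sym (σ-∞ false 0F 0#)) ⟩
      α a₀ (σ (inj₁ ∞) TG.0#) TG.+ TG.- origin a₀
        ≡⟨ cong (TG._+ TG.- origin a₀) (α-σ a₀ (inj₁ ∞) TG.0#) ⟩
      σ (β (inj₁ ∞)) (origin a₀) TG.+ TG.- origin a₀
        ≡⟨ cong (λ y → σ y (origin a₀) TG.+ TG.- origin a₀) β-∞ ⟩
      σ (inj₁ ∞) (origin a₀) TG.+ TG.- origin a₀
        ≡⟨ cong (TG._+ TG.- origin a₀) (σ-∞ ε ℓ x) ⟩
      (not ε , ℓ , x) TG.+ TG.- (ε , ℓ , x)
        ≡⟨ cong₂ _,_ (not-xor ε) (cong₂ _,_ (L.+-inverseʳ ℓ) (+-inverseʳ x)) ⟩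
      h ∎
      where
      open ≡-Reasoning
      ε : Bool
      ε = proj₁ (origin a₀)
      ℓ : Fin 3
      ℓ = lev (origin a₀)
      x : B
      x = crd (origin a₀)
      not-xor : ∀ ε → not ε xor ε ≡ true
      not-xor false = refl
      not-xor true  = refl

    m : B → B
    m x = crd (γ (false , 0F , x))

    -- Each element of `B` is six times another one, and six times any element of `T` has bit and
    -- level zero.
    γ-B : ∀ x → γ (false , 0F , x) ≡ (false , 0F , m x)
    γ-B x = cong₂ (λ ε ℓ → ε , ℓ , m x) (cong proj₁ ε-ℓ) (cong proj₂ ε-ℓ)
      where
      z w : B
      z = half x
      w = proj₁ (third-of z)
      six : T → T
      six i = (i TG.+ i TG.+ i) TG.+ (i TG.+ i TG.+ i)
      x≡6w : (false , 0F , x) ≡ six (false , 0F , w)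
      x≡6w = cong (λ v → false , 0F , v) (sym (trans (cong₂ _+_ (proj₂ (third-of z)) (proj₂ (third-of z)))
                                                     (half-double x)))
      γ-six : ∀ i → γ (six i) ≡ six (γ i)
      γ-six i = trans (γ-+ _ _) (cong₂ TG._+_ triple triple)
        where
        triple : γ (i TG.+ i TG.+ i) ≡ γ i TG.+ γ i TG.+ γ i
        triple = trans (γ-+ _ _) (cong (TG._+ γ i) (γ-+ i i))
      six-small : ∀ ε ℓ → (proj₁ (six (ε , ℓ , 0#)) , lev (six (ε , ℓ , 0#))) ≡ (false , 0F)
      six-small false 0F = refl
      six-small false 1F = refl
      six-small false 2F = refl
      six-small true  0F = refl
      six-small true  1F = refl
      six-small true  2F = refl
      ε-ℓ : (proj₁ (γ (false , 0F , x)) , lev (γ (false , 0F , x))) ≡ (false , 0F)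
      ε-ℓ = trans (cong (λ i → proj₁ i , lev i) (trans (cong γ x≡6w) (γ-six (false , 0F , w))))
                  (six-small (proj₁ (γ (false , 0F , w))) (lev (γ (false , 0F , w))))

    m-+ : ∀ x y → m (x + y) ≡ m x + m y
    m-+ x y = cong crd (γ-+ (false , 0F , x) (false , 0F , y))

    m≢0 : ∀ {x} → x ≢ 0# → m x ≢ 0#
    m≢0 {x} x≢0 e = x≢0 (cong crd (γ-inj {false , 0F , x} {TG.0#}
      (trans (γ-B x) (trans (cong (λ v → false , 0F , v) e) (sym γ-0)))))

    ℓ₁ : Fin 3
    ℓ₁ = lev (γ (false , 1F , 0#))

    -- The image is killed by 3, while multiplication by 3 is injective on bits and on `B`.
    γ-L : γ (false , 1F , 0#) ≡ (false , ℓ₁ , 0#)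
    γ-L = cong₂ (λ ε x → ε , ℓ₁ , x)
        (trans (sym (3ε (proj₁ w))) (cong proj₁ 3w≡0)) (3-free (cong crd 3w≡0))
      where
      w : T
      w = γ (false , 1F , 0#)
      3ε : ∀ ε → (ε xor ε) xor ε ≡ ε
      3ε false = refl
      3ε true  = refl
      3w≡0 : w TG.+ w TG.+ w ≡ TG.0#
      3w≡0 = trans (sym (trans (γ-+ _ _) (cong (TG._+ w) (γ-+ _ _))))
        (trans (cong γ (cong (λ x → false , 0F , x)
          (trans (cong (_+ 0#) (+-identityˡ 0#)) (+-identityˡ 0#)))) γ-0)

    γ-split : ∀ ε ℓ x → γ (ε , ℓ , x) ≡ γ (ε , 0F , 0#) TG.+ γ (false , ℓ , 0#) TG.+ γ (false , 0F , x)
    γ-split ε ℓ x = trans (cong γ (cong₂ _,_ (sym (trans (Boolₚ.xor-identityʳ _) (Boolₚ.xor-identityʳ ε)))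
        (cong₂ _,_ (sym (trans (L.+-identityʳ (0F L.+ ℓ)) (L.+-identityˡ ℓ)))
                      (sym (trans (cong (_+ x) (+-identityˡ 0#)) (+-identityˡ x))))))
      (trans (γ-+ _ _) (cong (TG._+ γ (false , 0F , x)) (γ-+ _ _)))

    γ-ε : ∀ ε → γ (ε , 0F , 0#) ≡ (ε , 0F , 0#)
    γ-ε false = γ-0
    γ-ε true  = γ-h

    over-inj : ∀ {a b w k} → over a w ≡ inj₂ (b , k) → w ≡ inj₂ k
    over-inj {w = inj₂ k} refl = refl

    α-shift : ∀ a ℓ y → α a (false , ℓ , y) ≡ α a (false , ℓ , 0#) TG.+ (false , 0F , m y)
    α-shift a ℓ y = begin
      α a (false , ℓ , y)
        ≡⟨ cong (λ p → α a (false , p)) (cong₂ _,_ (sym (L.+-identityʳ ℓ)) (sym (+-identityˡ y))) ⟩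
      α a ((false , ℓ , 0#) TG.+ k)
        ≡⟨ α-γ a _ ⟩
      γ ((false , ℓ , 0#) TG.+ k) TG.+ origin a
        ≡⟨ cong (TG._+ origin a) (γ-+ (false , ℓ , 0#) k) ⟩
      γ (false , ℓ , 0#) TG.+ γ k TG.+ origin a
        ≡⟨ prove (γ (false , ℓ , 0#) ∷ γ k ∷ origin a ∷ []) (v₀ ⊕ v₁ ⊕ v₂) (v₀ ⊕ v₂ ⊕ v₁) refl ⟩
      γ (false , ℓ , 0#) TG.+ origin a TG.+ γ k
        ≡⟨ cong₂ TG._+_ (sym (α-γ a (false , ℓ , 0#))) (γ-B y) ⟩
      α a (false , ℓ , 0#) TG.+ (false , 0F , m y) ∎
      where
      open ≡-Reasoning
      open Solver groupT
      k : T
      k = false , 0F , y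

    marked-image : ∀ {a ℓ y} → y ≢ 0# → (∀ k → D k ≢ y) → mark (c a) ℓ 0# y ≡ true → ∀ {i} →
      α a (false , ℓ , 0#) ≡ i →
      lev (α a (true , up ℓ , half (0# + y))) ≡ up (lev i) ×
      (proj₁ (α a (true , up ℓ , half (0# + y))) ≡ proj₁ i ⊎
       mark (c (π a)) (lev i) (crd i) (crd i + m y) ≡ proj₁ (α a (true , up ℓ , half (0# + y))))
    marked-image {a} {ℓ} {y} y≢0 y∉D marked {i@(ε , ℓ′ , x)} refl =
      τ-same⁻ {π a} {ε} {ℓ′} {x} {x + m y} x≢x+my
        (trans (cong (F.τ (π a) i) (sym shifted)) (over-inj {π a} {π a} (begin
          over (π a) (F.τ (π a) i (α a j))          ≡⟨ sym (inside (π a) i (α a j)) ⟩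
          inj₂ (π a , i) ∙ inj₂ (π a , α a j)       ≡⟨ cong₂ _∙_ (sym (θ-T a (false , ℓ , 0#))) (sym (θ-T a j)) ⟩
          θ (inj₂ (a , false , ℓ , 0#)) ∙ θ (inj₂ (a , j))
            ≡⟨ sym (homo _ _) ⟩
          θ (inj₂ (a , false , ℓ , 0#) ∙ inj₂ (a , j))
            ≡⟨ cong θ (trans (inside a (false , ℓ , 0#) j) (cong (over a) (τ-marked {a} y≢0 y∉D marked))) ⟩
          θ (inj₂ (a , true , up ℓ , half (0# + y)))
            ≡⟨ θ-T a _ ⟩
          inj₂ (π a , α a (true , up ℓ , half (0# + y))) ∎)))
      where
      open ≡-Reasoning
      j : T
      j = false , ℓ , y
      shifted : α a j ≡ (ε , ℓ′ , x + m y)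
      shifted = trans (α-shift a ℓ y)
        (cong₂ (λ δ n → δ , n , x + m y) (Boolₚ.xor-identityʳ ε) (L.+-identityʳ ℓ′))
      x≢x+my : x ≢ x + m y
      x≢x+my e = m≢0 y≢0 (+-cancelʳ x (trans (+-comm (m y) x) (trans (sym e) (sym (+-identityˡ x)))))

    -- Two points on one level have a product on the next one up. The image of such a triple must
    -- rise too, so the levels cannot be negated.
    ℓ₁≡1 : ℓ₁ ≡ 1F
    ℓ₁≡1 = cancel ℓ₁ (lev (origin a₀)) (trans (sym lev-r)
             (proj₁ (marked-image {a₀} {0F} one≢0 one∉D (isPair-self one) refl)))
      where
      cancel : ∀ s t → (0F L.+ s L.+ 0F) L.+ t ≡ up t → s ≡ 1F
      cancel 1F _ _ = refl
      cancel 0F 0F ()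
      cancel 0F 1F ()
      cancel 0F 2F ()
      cancel 2F 0F ()
      cancel 2F 1F ()
      cancel 2F 2F ()
      lev-r : lev (α a₀ (true , 1F , half (0# + one))) ≡ (0F L.+ ℓ₁ L.+ 0F) L.+ lev (origin a₀)
      lev-r = trans (cong lev (α-γ a₀ _)) (cong (L._+ lev (origin a₀))
        (trans (cong lev (γ-split true 1F (half (0# + one))))
          (cong₂ (λ s t → s L.+ ℓ₁ L.+ t) (cong lev γ-h) (cong lev (γ-B (half (0# + one)))))))

    γ-ℓ : ∀ ℓ → γ (false , ℓ , 0#) ≡ (false , ℓ , 0#)
    γ-ℓ 0F = γ-0
    γ-ℓ 1F = trans γ-L (cong (λ ℓ → false , ℓ , 0#) ℓ₁≡1)
    γ-ℓ 2F = trans (cong (λ x → γ (false , 2F , x)) (sym (+-identityˡ 0#)))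
      (trans (γ-+ (false , 1F , 0#) (false , 1F , 0#))
        (trans (cong₂ TG._+_ (γ-ℓ 1F) (γ-ℓ 1F)) (cong (λ x → false , 2F , x) (+-identityˡ 0#))))

    γ-formula : ∀ ε ℓ x → γ (ε , ℓ , x) ≡ (ε , ℓ , m x)
    γ-formula ε ℓ x = trans (γ-split ε ℓ x)
      (trans (cong₂ TG._+_ (cong₂ TG._+_ (γ-ε ε) (γ-ℓ ℓ)) (γ-B x))
        (cong₂ _,_ (trans (Boolₚ.xor-identityʳ _) (Boolₚ.xor-identityʳ ε))
          (cong₂ _,_ (trans (L.+-identityʳ (0F L.+ ℓ)) (L.+-identityˡ ℓ))
                     (trans (cong (_+ m x) (+-identityˡ 0#)) (+-identityˡ (m x))))))

    α-formula : ∀ a ε ℓ x → α a (ε , ℓ , x) ≡ (ε , ℓ , m x) TG.+ origin a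
    α-formula a ε ℓ x = trans (α-γ a _) (cong (TG._+ origin a) (γ-formula ε ℓ x))

    -- A point (k , α) shifts by ± D k inside level α − 1 and by + half (D k) from
    -- level α, which ties the sign, hence ε, to the translation.
    unflipped : ∀ y {ε ℓ x d e δ ε′ x′} → σ y (ε , ℓ , x) ≡ (δ , 0F L.+ ℓ , d + x) →
                crd (σ y (ε′ , 1F L.+ ℓ , x′)) ≡ e + x′ → d ≢ 0# → e + e ≡ d → ε ≡ false
    unflipped (inj₁ _) {ε} {ℓ} {x} eq₁ eq₂ d≢0 _ =
      ⊥-elim (d≢0 (+-cancelʳ x (trans (sym (cong crd eq₁)) (sym (+-identityˡ x)))))
    unflipped (inj₂ (k , α)) {ε} {ℓ} {x} {d} {e} {δ} {ε′} {x′} eq₁ eq₂ d≢0 e+e with levels ℓ α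
    ... | same _    = ⊥-elim (up≢ ℓ (cong lev eq₁))
      where
      up≢ : ∀ ℓ → up ℓ ≢ 0F L.+ ℓ
      up≢ 0F ()
      up≢ 1F ()
      up≢ 2F ()
    ... | falling α = ⊥-elim (up≢ α (cong lev eq₁))
      where
      up≢ : ∀ ℓ → ℓ ≢ 0F L.+ up ℓ
      up≢ 0F ()
      up≢ 1F ()
      up≢ 2F ()
    ... | rising ℓ  = sign ε (cong crd eq₁)
      where
      open ≡-Reasoning
      open Solver group
      up-+ : ∀ ℓ → 1F L.+ ℓ ≡ up ℓ
      up-+ 0F = refl
      up-+ 1F = refl
      up-+ 2F = refl
      D≡d : D k ≡ d
      D≡d = trans (sym (half-double (D k))) (trans (cong₂ _+_ half≡e half≡e) e+e)
        where
        half≡e : half (D k) ≡ e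
        half≡e = +-cancelʳ x′ (trans (+-comm (half (D k)) x′)
          (trans (sym (cong crd (σ-same k ε′ (up ℓ) x′)))
            (trans (cong (λ n → crd (σ (inj₂ (k , up ℓ)) (ε′ , n , x′))) (sym (up-+ ℓ))) eq₂)))
      open Signed group
      sign : ∀ ε → x + signed ε (D k) ≡ d + x → ε ≡ false
      sign false _ = refl
      sign true eq = ⊥-elim (D≢0 k (2-cancel (begin
        D k + D k                ≡⟨ cong (D k +_) D≡d ⟩
        D k + d                  ≡⟨ prove (x ∷ d ∷ D k ∷ []) (v₂ ⊕ v₁) (v₁ ⊕ v₀ ⊕ v₂ ⊕ ⊖ v₀) refl ⟩
        d + x + D k + - x        ≡⟨ cong (λ w → w + D k + - x) (sym eq) ⟩
        x + - D k + D k + - x    ≡⟨ prove (x ∷ D k ∷ []) (v₀ ⊕ ⊖ v₁ ⊕ v₁ ⊕ ⊖ v₀) (𝟘 ⊕ 𝟘) refl ⟩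
        0# + 0# ∎)))

    -- `ZeroSum` relies on cancelling 2 and cannot treat the bit. The image of the point `(k₀ , 1F)`
    -- decides it, through its effect on the levels that come from 0 and 1.
    origin-ε : ∀ a → proj₁ (origin a) ≡ false
    origin-ε a = unflipped (β y) {d = m (0# + D k₀)} {e = m (0# + half (D k₀))}
        (trans (sym (α-σ a y TG.0#)) (trans (cong (α a) (σ-rising k₀ false 0F 0#)) (α-formula a true 0F (0# + D k₀))))
        (trans (cong crd (trans (cong (σ (β y)) (sym (α-formula a false 1F 0#)))
          (trans (sym (α-σ a y (false , 1F , 0#))) (trans (cong (α a) (σ-same k₀ false 1F 0#))
            (α-formula a true 2F (0# + half (D k₀)))))))
          (cong (m (0# + half (D k₀)) +_) (sym (trans (cong (_+ crd (origin a)) m-0) (+-identityˡ _)))))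
        (m≢0 (λ e → D≢0 k₀ (trans (sym (+-identityˡ (D k₀))) e)))
        (trans (sym (m-+ _ _)) (cong m (trans (cong₂ _+_ (+-identityˡ _) (+-identityˡ _))
          (trans (half-double (D k₀)) (sym (+-identityˡ (D k₀)))))))
      where
      y : Y
      y = inj₂ (k₀ , 1F)
      m-0 : m 0# ≡ 0#
      m-0 = cong crd γ-0

    origin-third : ∀ {a b} → a ≢ b → origin (a ⋆ b) ≡ third (origin a) (origin b)
    origin-third {a} {b} a≢b = trans (cong (α (a ⋆ b)) (prove [] 𝟘 (⊖ (𝟘 ⊕ 𝟘)) refl)) (α-third TG.0# TG.0# a≢b)
      where open Solver groupT

    -- Modulo 3 every constant sums to zero along lines, so a common rotation `s` of the levels
    -- survives here; the marks exclude it later.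
    origin-lev : ∀ a → lev (origin a) ≡ lev (origin a₀)
    origin-lev a with a ≟ⱽ a₀
    ... | yes refl = refl
    ... | no a≢a₀  = ZeroSum.zero-sum-≢ SV avoid veblen Level₃ double₃ (λ a → lev (origin a))
                       (λ a≢b → cong lev (origin-third a≢b)) a≢a₀

    origin-crd : ∀ a → crd (origin a) ≡ 0#
    origin-crd a = 3-free (ZeroSum.zero-sum-3 SV avoid veblen group 2-cancel (λ a → crd (origin a))
                     (λ a≢b → cong crd (origin-third a≢b)) a)

    s : Fin 3
    s = lev (origin a₀)

    origin≡ : ∀ a → origin a ≡ (false , s , 0#)
    origin≡ a = cong₂ _,_ (origin-ε a) (cong₂ _,_ (origin-lev a) (origin-crd a))

    α-reduced : ∀ a ε ℓ x → α a (ε , ℓ , x) ≡ (ε , ℓ L.+ s , m x)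
    α-reduced a ε ℓ x = trans (α-formula a ε ℓ x) (trans (cong ((ε , ℓ , m x) TG.+_) (origin≡ a))
      (cong₂ (λ δ y → δ , ℓ L.+ s , y) (Boolₚ.xor-identityʳ ε) (+-identityʳ (m x))))

    -- By now bits are known to be preserved: a product with bit `true` of two points with bit
    -- `false` has an image of the same kind, and `τ-same⁻` reads a mark off it.
    marked⇒marked : ∀ {a ℓ y} → y ≢ 0# → (∀ k → D k ≢ y) → mark (c a) ℓ 0# y ≡ true →
                    mark (c (π a)) (ℓ L.+ s) 0# (m y) ≡ true
    marked⇒marked {a} {ℓ} {y} y≢0 y∉D eq = finish
        (cong proj₁ (α-reduced a true (up ℓ) (half (0# + y))))
        (proj₂ (marked-image {a} {ℓ} y≢0 y∉D eq {false , ℓ L.+ s , 0#}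
          (trans (α-reduced a false ℓ 0#) (cong (λ w → false , ℓ L.+ s , w) (cong crd γ-0)))))
      where
      finish : ∀ {δ} → δ ≡ true → δ ≡ false ⊎ mark (c (π a)) (ℓ L.+ s) 0# (0# + m y) ≡ δ →
               mark (c (π a)) (ℓ L.+ s) 0# (m y) ≡ true
      finish refl (inj₂ e) = trans (cong (mark (c (π a)) (ℓ L.+ s) 0#) (sym (+-identityˡ (m y)))) e

    -- The rotation by 1 would carry the mark of level 1 to level 2, the rotation by 2 that of level
    -- 0, and level 2 has none.
    marks-fixed : ∀ a → s ≡ 0F × m one ≡ one × m (c a) ≡ c (π a)
    marks-fixed a = decide s (marked⇒marked {a} {0F} one≢0 one∉D (isPair-self one))
                             (marked⇒marked {a} {1F} (c≢0 a) (c∉D a) (isPair-self (c a)))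
      where
      decide : ∀ s → mark (c (π a)) (0F L.+ s) 0# (m one) ≡ true →
               mark (c (π a)) (1F L.+ s) 0# (m (c a)) ≡ true →
               s ≡ 0F × m one ≡ one × m (c a) ≡ c (π a)
      decide 0F p q = refl , isPair⇒≡ one≢0 p , isPair⇒≡ (c≢0 (π a)) q
      decide 1F p ()
      decide 2F () q

    m-id : ∀ x → m x ≡ x
    m-id = generated (λ x → m x ≡ x) (cong crd γ-0)
      (λ x e → trans (m-+ x one) (cong₂ _+_ e (proj₁ (proj₂ (marks-fixed a₀)))))

    α-id : ∀ a i → α a i ≡ i
    α-id a (ε , ℓ , x) = trans (α-reduced a ε ℓ x) (cong₂ (λ n y → ε , n , y)
      (trans (cong (ℓ L.+_) (proj₁ (marks-fixed a))) (L.+-identityʳ ℓ)) (m-id x))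

    β-id : ∀ y → β y ≡ y
    β-id y = inj₁-injective (begin
        inj₁ (β y)                              ≡⟨ sym (F.τ-σ a₀ (β y) TG.0#) ⟩
        F.τ a₀ TG.0# (σ (β y) TG.0#)            ≡⟨ cong (λ i → F.τ a₀ TG.0# (σ (β y) i)) (sym (α-id a₀ TG.0#)) ⟩
        F.τ a₀ TG.0# (σ (β y) (α a₀ TG.0#))     ≡⟨ cong (F.τ a₀ TG.0#) (sym (α-σ a₀ y TG.0#)) ⟩
        F.τ a₀ TG.0# (α a₀ (σ y TG.0#))         ≡⟨ cong (F.τ a₀ TG.0#) (α-id a₀ (σ y TG.0#)) ⟩
        F.τ a₀ TG.0# (σ y TG.0#)                ≡⟨ F.τ-σ a₀ y TG.0# ⟩
        inj₁ y ∎)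
      where open ≡-Reasoning

    c-π : ∀ a → c (π a) ≡ c a
    c-π a = trans (sym (proj₂ (proj₂ (marks-fixed a)))) (m-id (c a))

  onPlaces : (V → V) → U → U
  onPlaces g (inj₁ y)       = inj₁ y
  onPlaces g (inj₂ (a , i)) = inj₂ (g a , i)

  abstract
    rigidity : (A : Automorphism steiner) → ∃ λ (π : V → V) →
               (∀ {a b} → π a ≡ π b → a ≡ b) × (∀ a b → π (a ⋆ b) ≡ π a ⋆ π b) × (∀ a → c (π a) ≡ c a) ×
               (∀ x → Automorphism.θ A x ≡ onPlaces π x)
    rigidity A = π , π-inj , Aff.π-homo , Aff.c-π , θ≡
      where
      open Automorphism A
      open Decomposition A
      π-inj : ∀ {a b} → π a ≡ π b → a ≡ b
      π-inj {a} {b} e = trans (sym (π⁻-π A a)) (trans (cong (Decomposition.π inverse) e) (π⁻-π A b))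
      module Aff = Affine A β π α θ-Y θ-T π-inj θ-∞
      θ≡ : ∀ x → θ x ≡ onPlaces π x
      θ≡ (inj₁ y)       = trans (θ-Y y) (cong inj₁ (Aff.β-id y))
      θ≡ (inj₂ (a , i)) = trans (θ-T a i) (cong (λ j → inj₂ (π a , j)) (Aff.α-id a i))

  onPlaces-homo : ∀ g → (∀ {a b} → g a ≡ g b → a ≡ b) → (∀ a b → g (a ⋆ b) ≡ g a ⋆ g b) →
                  (∀ a → c (g a) ≡ c a) → ∀ x y → onPlaces g (x ∙ y) ≡ onPlaces g x ∙ onPlaces g y
  onPlaces-homo g g-inj g-homo c-g (inj₁ y)       (inj₁ z)       = refl
  onPlaces-homo g g-inj g-homo c-g (inj₁ y)       (inj₂ (a , i)) = refl
  onPlaces-homo g g-inj g-homo c-g (inj₂ (a , i)) (inj₁ y)       = refl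
  onPlaces-homo g g-inj g-homo c-g (inj₂ (a , i)) (inj₂ (b , j)) with a ≟ⱽ b
  ... | no a≢b   = trans (cong (λ d → inj₂ (d , third i j)) (g-homo a b))
                         (sym (across i j (λ e → a≢b (g-inj e))))
  ... | yes refl = trans (onPlaces-over (F.τ a i j)) (trans (cong (over (g a)) fibre≡) (sym (inside (g a) i j)))
    where
    onPlaces-over : ∀ w → onPlaces g (over a w) ≡ over (g a) w
    onPlaces-over (inj₁ y) = refl
    onPlaces-over (inj₂ i) = refl
    fibre≡ : F.τ a i j ≡ F.τ (g a) i j
    fibre≡ = cong (λ d → Twisted.τ (mark d) (mark-comm d) i j) (sym (c-g a))

  fullAction : ∀ {g ℓ} (Γ : Group g ℓ) (act : Group.Carrier Γ → V → V) →
    (∀ {s t} → Group._≈_ Γ s t → ∀ a → act s a ≡ act t a) →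
    (∀ a → act (Group.ε Γ) a ≡ a) →
    (∀ s t a → act (Group._∙_ Γ s t) a ≡ act s (act t a)) →
    (∀ s {a b} → act s a ≡ act s b → a ≡ b) →
    (∀ s a b → act s (a ⋆ b) ≡ act s a ⋆ act s b) →
    (∀ s a → c (act s a) ≡ c a) →
    (∀ {s t} → act s a₀ ≡ act t a₀ → Group._≈_ Γ s t) →
    ((π : V → V) → (∀ {a b} → π a ≡ π b → a ≡ b) → (∀ a b → π (a ⋆ b) ≡ π a ⋆ π b) →
      (∀ a → c (π a) ≡ c a) → ∃ λ s → ∀ a → π a ≡ act s a) →
    FullAction Γ steiner
  fullAction Γ act act-cong act-ε act-∙ act-inj act-homo c-act act-faithful act-full = record
    { act      = λ s → onPlaces (act s)
    ; act-cong = λ { eq (inj₁ y) → refl ; eq (inj₂ (a , i)) → cong (λ a → inj₂ (a , i)) (act-cong eq a) }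
    ; act-ε    = λ { (inj₁ y) → refl ; (inj₂ (a , i)) → cong (λ a → inj₂ (a , i)) (act-ε a) }
    ; act-∙    = λ { s t (inj₁ y) → refl ; s t (inj₂ (a , i)) → cong (λ a → inj₂ (a , i)) (act-∙ s t a) }
    ; act-homo = λ s → onPlaces-homo (act s) (act-inj s) (act-homo s) (c-act s)
    ; faithful = λ eq → act-faithful (inj₂-fib (eq (inj₂ (a₀ , TG.0#))))
    ; full     = full }
    where
    extend : ∀ {θ : U → U} π → (∀ x → θ x ≡ onPlaces π x) → (∃ λ s → ∀ a → π a ≡ act s a) →
             ∃ λ s → ∀ x → θ x ≡ onPlaces (act s) x
    extend π θ≡ (s , π≡) = s , λ { (inj₁ y)       → θ≡ (inj₁ y)
                                 ; (inj₂ (a , i)) → trans (θ≡ (inj₂ (a , i))) (cong (λ a → inj₂ (a , i)) (π≡ a)) }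
    full : (A : Automorphism steiner) → ∃ λ s → ∀ x → Automorphism.θ A x ≡ onPlaces (act s) x
    full A = let π , π-inj , π-homo , c-π , θ≡ = rigidity A in extend π θ≡ (act-full π π-inj π-homo c-π)

-- The places: a projective space with its orbit colouring

↔-dec : ∀ {A : Set} {n} → A ↔ Fin n → DecidableEquality A
↔-dec e x y = map′ (λ eq → trans (sym (strictlyInverseʳ x)) (trans (cong from eq) (strictlyInverseʳ y)))
                   (cong to) (to x Fin.≟ to y)
  where open Inverse e

missed : ∀ {A C : Set} {m n} → A ↔ Fin m → C ↔ Fin n → m < n → (f : A → C) → ∃ λ c → ∀ a → f a ≢ c
missed {A} {C} {m} {n} eA eC m<n f = C.from i , λ a eq →
    ¬hit (A.to a , trans (cong (λ a → C.to (f a)) (A.strictlyInverseʳ a))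
                         (trans (cong C.to eq) (C.strictlyInverseˡ i)))
  where
  module A = Inverse eA
  module C = Inverse eC
  Hit : Fin n → Set
  Hit i = ∃ λ j → C.to (f (A.from j)) ≡ i
  hit? : ∀ i → Dec (Hit i)
  hit? i = Finₚ.any? (λ j → C.to (f (A.from j)) Fin.≟ i)
  ¬all : ¬ (∀ i → Hit i)
  ¬all hits with Finₚ.pigeonhole m<n (λ i → proj₁ (hits i))
  ... | i , j , i<j , eq = ℕₚ.<-irrefl (cong toℕ (trans (sym (proj₂ (hits i)))
          (trans (cong (λ k → C.to (f (A.from k))) eq) (proj₂ (hits j))))) i<j
  i : Fin n
  i = proj₁ (Finₚ.¬∀⟶∃¬ n Hit hit? ¬all)
  ¬hit : ¬ Hit i
  ¬hit = proj₂ (Finₚ.¬∀⟶∃¬ n Hit hit? ¬all)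

¬injection : ∀ {A C : Set} {m n} → A ↔ Fin m → C ↔ Fin n → m < n →
             (f : C → A) → ¬ (∀ {x y} → f x ≡ f y → x ≡ y)
¬injection eA eC m<n f inj with Finₚ.pigeonhole m<n (λ i → A.to (f (C.from i)))
  where module A = Inverse eA
        module C = Inverse eC
... | i , j , i<j , eq = ℕₚ.<-irrefl (cong toℕ (trans (sym (C.strictlyInverseˡ i))
        (trans (cong C.to (inj (trans (sym (A.strictlyInverseʳ _)) (trans (cong A.from eq) (A.strictlyInverseʳ _)))))
               (C.strictlyInverseˡ j)))) i<j
  where module A = Inverse eA
        module C = Inverse eC

subset-finite : ∀ {m} (p : Fin m → Bool) → ∃ λ k → Σ (Fin m) (λ i → IsTrue (p i)) ↔ Fin k
subset-finite {zero}  p = 0 , mk↔ₛ′ (λ { (() , _) }) (λ ()) (λ ()) (λ { (() , _) })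
subset-finite {suc m} p with subset-finite (λ i → p (suc i)) | p zero in eq
... | k , e | true  = suc k , mk↔ₛ′ to from to-from from-to
  where
  module E = Inverse e
  to : Σ (Fin (suc m)) (λ i → IsTrue (p i)) → Fin (suc k)
  to (zero  , _) = zero
  to (suc i , t) = suc (E.to (i , t))
  from : Fin (suc k) → Σ (Fin (suc m)) (λ i → IsTrue (p i))
  from zero    = zero , subst IsTrue (sym eq) tt
  from (suc j) = suc (proj₁ (E.from j)) , proj₂ (E.from j)
  to-from : ∀ j → to (from j) ≡ j
  to-from zero    = refl
  to-from (suc j) = cong suc (E.strictlyInverseˡ j)
  from-to : ∀ x → from (to x) ≡ x
  from-to (zero  , t) = cong (zero ,_) (Boolₚ.T-irrelevant _ _)
  from-to (suc i , t) = cong (λ w → suc (proj₁ w) , proj₂ w) (E.strictlyInverseʳ (i , t))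
... | k , e | false = k , mk↔ₛ′ to (λ j → suc (proj₁ (E.from j)) , proj₂ (E.from j)) E.strictlyInverseˡ from-to
  where
  module E = Inverse e
  to : Σ (Fin (suc m)) (λ i → IsTrue (p i)) → Fin k
  to (zero  , t) = ⊥-elim (subst IsTrue eq t)
  to (suc i , t) = E.to (i , t)
  from-to : ∀ x → (suc (proj₁ (E.from (to x))) , proj₂ (E.from (to x))) ≡ x
  from-to (zero  , t) = ⊥-elim (subst IsTrue eq t)
  from-to (suc i , t) = cong (λ w → suc (proj₁ w) , proj₂ w) (E.strictlyInverseʳ (i , t))

Σ-finite : ∀ {A : Set} {m} → A ↔ Fin m → (p : A → Bool) → ∃ λ k → Σ A (λ a → IsTrue (p a)) ↔ Fin k
Σ-finite {A} e p with subset-finite (λ i → p (Inverse.from e i))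
... | k , e′ = k , ↔-trans (mk↔ₛ′ to from to-from from-to) e′
  where
  module E = Inverse e
  ≡-Σ : ∀ {X : Set} {q : X → Bool} {x y : X} {s t} → x ≡ y →
        _≡_ {A = Σ X (λ x → IsTrue (q x))} (x , s) (y , t)
  ≡-Σ refl = cong (_ ,_) (Boolₚ.T-irrelevant _ _)
  to : Σ A (λ a → IsTrue (p a)) → Σ _ (λ i → IsTrue (p (E.from i)))
  to (a , t) = E.to a , subst (λ a → IsTrue (p a)) (sym (E.strictlyInverseʳ a)) t
  from : Σ _ (λ i → IsTrue (p (E.from i))) → Σ A (λ a → IsTrue (p a))
  from (i , t) = E.from i , t
  to-from : ∀ x → to (from x) ≡ x
  to-from (i , t) = ≡-Σ {q = λ i → p (E.from i)} (E.strictlyInverseˡ i)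
  from-to : ∀ x → from (to x) ≡ x
  from-to (a , t) = ≡-Σ {q = p} (E.strictlyInverseʳ a)

-- Names an orbit by its least member, so that equal orbits get equal numbers. Without a hit the
-- value is n.
firstIndex : ∀ {n} → (Fin n → Bool) → ℕ
firstIndex {zero}  p = 0
firstIndex {suc n} p = if p zero then 0 else suc (firstIndex (λ i → p (suc i)))

firstIndex-cong : ∀ {n} {p q : Fin n → Bool} → (∀ i → p i ≡ q i) → firstIndex p ≡ firstIndex q
firstIndex-cong {zero}          eq = refl
firstIndex-cong {suc n} {p} {q} eq =
  cong₂ (λ b k → if b then 0 else suc k) (eq zero) (firstIndex-cong (λ i → eq (suc i)))

firstIndex-hit : ∀ {n} (p : Fin n → Bool) i → p i ≡ true → ∃ λ j → p j ≡ true × toℕ j ≡ firstIndex p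
firstIndex-hit {suc n} p i pi with p zero in eq
... | true  = zero , eq , refl
firstIndex-hit {suc n} p zero    pi | false with () ← trans (sym eq) pi
firstIndex-hit {suc n} p (suc i) pi | false with firstIndex-hit (λ i → p (suc i)) i pi
... | j , pj , e = suc j , pj , cong suc e

-- The points and lines of a projective space over the field of two elements.
module Projective {W : Set} (GW : AbGroup W) (x+x : ∀ x → AbGroup._+_ GW x x ≡ AbGroup.0# GW)
                  (_≟_ : DecidableEquality W) where
  open AbGroup GW
  open Solver GW

  V : Set
  V = Σ W (λ w → False (w ≟ 0#))

  V-≡ : ∀ {a b : V} → proj₁ a ≡ proj₁ b → a ≡ b
  V-≡ {w , s} {.w , t} refl = cong (w ,_) (Boolₚ.T-irrelevant s t)

  _≟ⱽ_ : DecidableEquality V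
  a ≟ⱽ b = map′ V-≡ (cong proj₁) (proj₁ a ≟ proj₁ b)

  vec≢0 : ∀ (a : V) → proj₁ a ≢ 0#
  vec≢0 (w , nz) = toWitnessFalse nz

  point : ∀ w → w ≢ 0# → V
  point w w≢0 = w , fromWitnessFalse w≢0

  cancel : ∀ x y → x + (x + y) ≡ y
  cancel x y = trans (sym (+-assoc x x y)) (trans (cong (_+ y) (x+x x)) (+-identityˡ y))

  sum≢0 : ∀ {a b : V} → a ≢ b → proj₁ a + proj₁ b ≢ 0#
  sum≢0 {a} {b} a≢b eq = a≢b (V-≡ (trans (sym (+-identityʳ (proj₁ a)))
    (trans (cong (proj₁ a +_) (sym eq)) (cancel (proj₁ a) (proj₁ b)))))

  _·_ : V → V → V
  a · b with a ≟ⱽ b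
  ... | yes _   = a
  ... | no  a≢b = point (proj₁ a + proj₁ b) (sum≢0 a≢b)

  ·-≢ : ∀ {a b} → a ≢ b → proj₁ (a · b) ≡ proj₁ a + proj₁ b
  ·-≢ {a} {b} a≢b with a ≟ⱽ b
  ... | yes e = ⊥-elim (a≢b e)
  ... | no  _ = refl

  ·-idem : ∀ a → a · a ≡ a
  ·-idem a with a ≟ⱽ a
  ... | yes _   = refl
  ... | no  a≢a = ⊥-elim (a≢a refl)

  steinerV : Steiner V
  steinerV = record { _·_ = _·_ ; idem = ·-idem ; comm = ·-comm ; invol = ·-invol }
    where
    ·-comm : ∀ a b → a · b ≡ b · a
    ·-comm a b with a ≟ⱽ b
    ... | yes refl = sym (·-idem a)
    ... | no  a≢b  = V-≡ (trans (+-comm _ _) (sym (·-≢ (λ e → a≢b (sym e)))))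
    ·-invol : ∀ a b → a · (a · b) ≡ b
    ·-invol a b with a ≟ⱽ b
    ... | yes refl = ·-idem a
    ... | no  a≢b  = V-≡ (trans (·-≢ a≢ab) (cancel (proj₁ a) (proj₁ b)))
      where
      a≢ab : a ≢ point (proj₁ a + proj₁ b) (sum≢0 a≢b)
      a≢ab e = vec≢0 b (trans (sym (cancel (proj₁ a) (proj₁ b)))
        (trans (cong (proj₁ a +_) (sym (cong proj₁ e))) (x+x (proj₁ a))))

  module SV = Steiner steinerV

  veblen : ∀ {a b c} → a ≢ b → c ≢ a → c ≢ b → c ≢ a · b → b · (a · c) ≡ a · (b · c)
  veblen {a} {b} {c} a≢b c≢a c≢b c≢ab = V-≡ (begin
      proj₁ (b · (a · c))              ≡⟨ ·-≢ (λ e → c≢ab (sym (SV.swap (sym e)))) ⟩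
      proj₁ b + proj₁ (a · c)          ≡⟨ cong (proj₁ b +_) (·-≢ (λ e → c≢a (sym e))) ⟩
      proj₁ b + (proj₁ a + proj₁ c)    ≡⟨ prove (proj₁ a ∷ proj₁ b ∷ proj₁ c ∷ []) (v₁ ⊕ (v₀ ⊕ v₂)) (v₀ ⊕ (v₁ ⊕ v₂)) refl ⟩
      proj₁ a + (proj₁ b + proj₁ c)    ≡⟨ cong (proj₁ a +_) (sym (·-≢ (λ e → c≢b (sym e)))) ⟩
      proj₁ a + proj₁ (b · c)          ≡⟨ sym (·-≢ (λ e → c≢ab (sym (trans (SV.comm a b) (SV.swap (sym e)))))) ⟩
      proj₁ (a · (b · c)) ∎)
    where open ≡-Reasoning

  Additive : (W → W) → Set
  Additive f = ∀ x y → f (x + y) ≡ f x + f y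

  linear : (V → V) → W → W
  linear π w with w ≟ 0#
  ... | yes _   = 0#
  ... | no  w≢0 = proj₁ (π (point w w≢0))

  linear-V : ∀ π (a : V) → linear π (proj₁ a) ≡ proj₁ (π a)
  linear-V π a with proj₁ a ≟ 0#
  ... | yes e = ⊥-elim (vec≢0 a e)
  ... | no  _ = cong (λ b → proj₁ (π b)) (V-≡ refl)

  linear-0 : ∀ π → linear π 0# ≡ 0#
  linear-0 π with 0# ≟ 0#
  ... | yes _   = refl
  ... | no  0≢0 = ⊥-elim (0≢0 refl)

  -- Over two elements the third point of a line is the sum of the other two, so a collineation is
  -- additive on distinct points. Only sums involving 0 and sums of equal vectors need separate
  -- care.
  linear-additive : ∀ π → (∀ {a b} → π a ≡ π b → a ≡ b) → (∀ a b → π (a · b) ≡ π a · π b) → Additive (linear π)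
  linear-additive π π-inj π-homo x y = go (x ≟ 0#) (y ≟ 0#)
    where
    open ≡-Reasoning
    f : W → W
    f = linear π
    distinct : (a b : V) → Dec (a ≡ b) → f (proj₁ a + proj₁ b) ≡ f (proj₁ a) + f (proj₁ b)
    distinct a .a (yes refl) = trans (cong f (x+x (proj₁ a))) (trans (linear-0 π) (sym (x+x (f (proj₁ a)))))
    distinct a b  (no a≢b)   = begin
      f (proj₁ a + proj₁ b)        ≡⟨ cong f (sym (·-≢ a≢b)) ⟩
      f (proj₁ (a · b))            ≡⟨ linear-V π (a · b) ⟩
      proj₁ (π (a · b))            ≡⟨ cong proj₁ (π-homo a b) ⟩
      proj₁ (π a · π b)            ≡⟨ ·-≢ (λ e → a≢b (π-inj e)) ⟩
      proj₁ (π a) + proj₁ (π b)    ≡⟨ cong₂ _+_ (sym (linear-V π a)) (sym (linear-V π b)) ⟩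
      f (proj₁ a) + f (proj₁ b) ∎
    go : Dec (x ≡ 0#) → Dec (y ≡ 0#) → f (x + y) ≡ f x + f y
    go (yes refl) _ = trans (cong f (+-identityˡ y))
      (sym (trans (cong (_+ f y) (linear-0 π)) (+-identityˡ (f y))))
    go (no _) (yes refl) = trans (cong f (+-identityʳ x))
      (sym (trans (cong (f x +_) (linear-0 π)) (+-identityʳ (f x))))
    go (no x≢0) (no y≢0) = distinct (point x x≢0) (point y y≢0) (point x x≢0 ≟ⱽ point y y≢0)

-- Binary vectors and their additive maps

bits : ∀ n → AbGroup (Vec Bool n)
bits n = record
  { _+_ = zipWith _xor_ ; 0# = replicate n false ; -_ = λ v → v
  ; +-assoc     = Vecₚ.zipWith-assoc Boolₚ.xor-assoc
  ; +-comm      = Vecₚ.zipWith-comm Boolₚ.xor-comm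
  ; +-identityˡ = Vecₚ.zipWith-identityˡ Boolₚ.xor-identityˡ
  ; +-inverseˡ  = bits-2 }
  where
  bits-2 : ∀ {n} (v : Vec Bool n) → zipWith _xor_ v v ≡ replicate n false
  bits-2 []      = refl
  bits-2 (b ∷ v) = cong₂ _∷_ (Boolₚ.xor-same b) (bits-2 v)

bits-finite : ∀ n → Vec Bool n ↔ Fin (2 ^ n)
bits-finite zero    = mk↔ₛ′ (λ _ → zero) (λ _ → []) (λ { zero → refl }) (λ { [] → refl })
bits-finite (suc n) = ↔-trans (mk↔ₛ′ (λ { (b ∷ v) → b , v }) (λ { (b , v) → b ∷ v })
                                      (λ { (b , v) → refl }) (λ { (b ∷ v) → refl }))
  (↔-trans (↔-sym Finₚ.2↔Bool ×-↔ bits-finite n) (↔-sym Finₚ.*↔×))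

basis : ∀ {n} → Fin n → Vec Bool n
basis x = tabulate (λ i → does (i Fin.≟ x))

basis-inj : ∀ {n} {x y : Fin n} → basis x ≡ basis y → x ≡ y
basis-inj {x = x} {y} eq = decide (x Fin.≟ y) (begin
    does (x Fin.≟ y)      ≡⟨ sym (Vecₚ.lookup∘tabulate _ x) ⟩
    lookup (basis y) x    ≡⟨ cong (λ v → lookup v x) (sym eq) ⟩
    lookup (basis x) x    ≡⟨ Vecₚ.lookup∘tabulate _ x ⟩
    does (x Fin.≟ x)      ≡⟨ dec-true (x Fin.≟ x) refl ⟩
    true ∎)
  where
  open ≡-Reasoning
  decide : (d : Dec (x ≡ y)) → does d ≡ true → x ≡ y
  decide (yes e) _ = e

module _ {A : Set} (GA : AbGroup A) where
  open AbGroup GA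
  private
    module Bits {n} = AbGroup (bits n)

  AdditiveBits : ∀ {n} → (Vec Bool n → A) → Set
  AdditiveBits f = ∀ u v → f (u Bits.+ v) ≡ f u + f v

  additive-0 : ∀ {n} {f : Vec Bool n → A} → AdditiveBits f → f (replicate n false) ≡ 0#
  additive-0 {n} {f} f-+ = +-cancelʳ (f 0v) (trans (sym (f-+ 0v 0v))
    (trans (cong f (Bits.+-identityˡ 0v)) (sym (+-identityˡ (f 0v)))))
    where
    0v : Vec Bool n
    0v = replicate n false

  additive-≡ : ∀ {n} {f g : Vec Bool n → A} → AdditiveBits f → AdditiveBits g →
               (∀ x → f (basis x) ≡ g (basis x)) → ∀ v → f v ≡ g v
  additive-≡ {zero}  f-+ g-+ eq [] = trans (additive-0 f-+) (sym (additive-0 g-+))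
  additive-≡ {suc n} {f} {g} f-+ g-+ eq (b ∷ v) = begin
      f (b ∷ v)                              ≡⟨ cong f (split b v) ⟩
      f ((b ∷ 0v) Bits.+ (false ∷ v))        ≡⟨ f-+ _ _ ⟩
      f (b ∷ 0v) + f (false ∷ v)             ≡⟨ cong₂ _+_ (head b) tail ⟩
      g (b ∷ 0v) + g (false ∷ v)             ≡⟨ sym (g-+ _ _) ⟩
      g ((b ∷ 0v) Bits.+ (false ∷ v))        ≡⟨ cong g (sym (split b v)) ⟩
      g (b ∷ v) ∎
    where
    open ≡-Reasoning
    0v : Vec Bool n
    0v = replicate n false
    split : ∀ b v → b ∷ v ≡ (b ∷ 0v) Bits.+ (false ∷ v)
    split b v = cong₂ _∷_ (sym (Boolₚ.xor-identityʳ b)) (sym (Bits.+-identityˡ v))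
    tabulate-false : ∀ m → tabulate {n = m} (λ _ → false) ≡ replicate m false
    tabulate-false zero    = refl
    tabulate-false (suc m) = cong (false ∷_) (tabulate-false m)
    head : ∀ b → f (b ∷ 0v) ≡ g (b ∷ 0v)
    head false = trans (additive-0 f-+) (sym (additive-0 g-+))
    head true  = subst (λ w → f (true ∷ w) ≡ g (true ∷ w)) (tabulate-false n) (eq zero)
    tail : f (false ∷ v) ≡ g (false ∷ v)
    tail = additive-≡ {n} {λ v → f (false ∷ v)} {λ v → g (false ∷ v)}
             (λ u w → f-+ (false ∷ u) (false ∷ w)) (λ u w → g-+ (false ∷ u) (false ∷ w)) (λ x → eq (suc x)) v

-- G acts on three copies of the regular representation over the field of two elements:
-- sums of basis vectors from different copies tie the copies together, and the third
-- copy keeps the projective space large enough when G is trivial.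
module Regular {c ℓ} (G : Group c ℓ) {n : ℕ} (e : Inverse (Group.setoid G) (setoid (Fin n))) where
  open Group G using (Carrier; _≈_; _∙_; ε; _⁻¹; inverseˡ; inverseʳ; ∙-congˡ; ∙-congʳ; ⁻¹-cong; assoc; identityˡ)
    renaming (refl to ≈-refl; sym to ≈-sym; trans to ≈-trans)
  open Inverse e using (to; from; to-cong; from-cong; strictlyInverseˡ; strictlyInverseʳ)
  open GroupProperties G using (⁻¹-anti-homo-∙; ε⁻¹≈ε; ∙-cancelʳ)

  infixr 7 _•_
  _•_ : Carrier → Fin n → Fin n
  g • x = to (g ∙ from x)

  •-cong : ∀ {g h} → g ≈ h → ∀ x → g • x ≡ h • x
  •-cong g≈h x = to-cong (∙-congʳ g≈h)

  •-∙ : ∀ g h x → (g ∙ h) • x ≡ g • h • x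
  •-∙ g h x = to-cong (≈-trans (assoc g h (from x)) (∙-congˡ (≈-sym (strictlyInverseʳ _))))

  •-ε : ∀ {g} → g ≈ ε → ∀ x → g • x ≡ x
  •-ε g≈ε x = trans (to-cong (≈-trans (∙-congʳ g≈ε) (identityˡ _))) (strictlyInverseˡ x)

  •-free : ∀ {g h} x → g • x ≡ h • x → g ≈ h
  •-free {g} {h} x eq = ∙-cancelʳ (from x) g h (≈-trans (≈-sym (strictlyInverseʳ _))
                          (≈-trans (from-cong eq) (strictlyInverseʳ _)))

  permute : Carrier → Vec Bool n → Vec Bool n
  permute g v = tabulate (λ i → lookup v (g ⁻¹ • i))

  vec-ext : ∀ {m} {u v : Vec Bool m} → (∀ i → lookup u i ≡ lookup v i) → u ≡ v
  vec-ext {u = u} {v} eq = trans (sym (Vecₚ.tabulate∘lookup u)) (trans (Vecₚ.tabulate-cong eq) (Vecₚ.tabulate∘lookup v))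

  permute-cong : ∀ {g h} → g ≈ h → ∀ v → permute g v ≡ permute h v
  permute-cong g≈h v = Vecₚ.tabulate-cong (λ i → cong (lookup v) (•-cong (⁻¹-cong g≈h) i))

  permute-ε : ∀ v → permute ε v ≡ v
  permute-ε v = vec-ext (λ i → trans (Vecₚ.lookup∘tabulate _ i) (cong (lookup v) (•-ε ε⁻¹≈ε i)))

  permute-∙ : ∀ g h v → permute (g ∙ h) v ≡ permute g (permute h v)
  permute-∙ g h v = Vecₚ.tabulate-cong (λ i → trans
    (cong (lookup v) (trans (•-cong (⁻¹-anti-homo-∙ g h) i) (•-∙ (h ⁻¹) (g ⁻¹) i)))
    (sym (Vecₚ.lookup∘tabulate _ (g ⁻¹ • i))))

  permute-+ : ∀ g u v → permute g (zipWith _xor_ u v) ≡ zipWith _xor_ (permute g u) (permute g v)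
  permute-+ g u v = vec-ext (λ i → trans (Vecₚ.lookup∘tabulate _ i)
    (trans (Vecₚ.lookup-zipWith _xor_ (g ⁻¹ • i) u v)
      (sym (trans (Vecₚ.lookup-zipWith _xor_ i (permute g u) (permute g v))
                  (cong₂ _xor_ (Vecₚ.lookup∘tabulate _ i) (Vecₚ.lookup∘tabulate _ i))))))

  permute-basis : ∀ g x → permute g (basis x) ≡ basis (g • x)
  permute-basis g x = Vecₚ.tabulate-cong (λ i → trans (Vecₚ.lookup∘tabulate _ (g ⁻¹ • i))
    (does-⇔ (mk⇔ (λ eq → trans (sym (undo (inverseʳ g) i)) (cong (g •_) eq))
                 (λ eq → trans (cong (g ⁻¹ •_) eq) (undo (inverseˡ g) x)))
            (g ⁻¹ • i Fin.≟ x) (i Fin.≟ g • x)))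
    where
    undo : ∀ {g h} → g ∙ h ≈ ε → ∀ x → g • h • x ≡ x
    undo gh≈ε x = trans (sym (•-∙ _ _ x)) (•-ε gh≈ε x)

  W : Set
  W = Vec Bool n × Vec Bool n × Vec Bool n

  groupW : AbGroup W
  groupW = bits n ×ᴳ bits n ×ᴳ bits n
  open AbGroup groupW

  x+x : ∀ (w : W) → w + w ≡ 0#
  x+x w = +-inverseˡ w

  _≟ᵂ_ : DecidableEquality W
  _≟ᵂ_ = Productₚ.≡-dec (Vecₚ.≡-dec Boolₚ._≟_) (Productₚ.≡-dec (Vecₚ.≡-dec Boolₚ._≟_) (Vecₚ.≡-dec Boolₚ._≟_))

  finiteW : W ↔ Fin (2 ^ n *ℕ (2 ^ n *ℕ 2 ^ n))
  finiteW = ↔-trans (bits-finite n ×-↔ ↔-trans (bits-finite n ×-↔ bits-finite n) (↔-sym Finₚ.*↔×)) (↔-sym Finₚ.*↔×)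

  open Projective groupW x+x _≟ᵂ_ public

  actW : Carrier → W → W
  actW g (u , v , w) = permute g u , permute g v , permute g w

  actW-+ : ∀ g → Additive (actW g)
  actW-+ g (u , v , w) (u′ , v′ , w′) =
    cong₂ _,_ (permute-+ g u u′) (cong₂ _,_ (permute-+ g v v′) (permute-+ g w w′))

  actW-cong : ∀ {g h} → g ≈ h → ∀ w → actW g w ≡ actW h w
  actW-cong g≈h (u , v , w) = cong₂ _,_ (permute-cong g≈h u) (cong₂ _,_ (permute-cong g≈h v) (permute-cong g≈h w))

  actW-ε : ∀ w → actW ε w ≡ w
  actW-ε (u , v , w) = cong₂ _,_ (permute-ε u) (cong₂ _,_ (permute-ε v) (permute-ε w))

  actW-∙ : ∀ g h w → actW (g ∙ h) w ≡ actW g (actW h w)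
  actW-∙ g h (u , v , w) = cong₂ _,_ (permute-∙ g h u) (cong₂ _,_ (permute-∙ g h v) (permute-∙ g h w))

  actW-inj : ∀ g {u w} → actW g u ≡ actW g w → u ≡ w
  actW-inj g {u} {w} eq = trans (sym (undo u)) (trans (cong (actW (g ⁻¹)) eq) (undo w))
    where
    undo : ∀ w → actW (g ⁻¹) (actW g w) ≡ w
    undo w = trans (sym (actW-∙ (g ⁻¹) g w)) (trans (actW-cong (inverseˡ g) w) (actW-ε w))

  actW-0 : ∀ g → actW g 0# ≡ 0#
  actW-0 g = +-cancelʳ (actW g 0#) (trans (sym (actW-+ g 0# 0#))
    (trans (cong (actW g) (+-identityˡ 0#)) (sym (+-identityˡ (actW g 0#)))))

  act : Carrier → V → V
  act g a = point (actW g (proj₁ a)) (λ eq → vec≢0 a (actW-inj g (trans eq (sym (actW-0 g)))))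

  act-homo : ∀ g a b → act g (a · b) ≡ act g a · act g b
  act-homo g a b = go (a ≟ⱽ b)
    where
    go : Dec (a ≡ b) → act g (a · b) ≡ act g a · act g b
    go (yes refl) = trans (cong (act g) (·-idem a)) (sym (·-idem (act g a)))
    go (no a≢b)   = V-≡ (trans (cong (actW g) (·-≢ a≢b)) (trans (actW-+ g (proj₁ a) (proj₁ b))
      (sym (·-≢ (λ eq → a≢b (V-≡ (actW-inj g (cong proj₁ eq))))))))

  o : Fin n
  o = to ε

  first second third : Vec Bool n → W
  first  v = v , replicate n false , replicate n false
  second v = replicate n false , v , replicate n false
  third  v = replicate n false , replicate n false , v

  module Pointwise (f : W → W) (f-+ : Additive f) (orbit : ∀ w → ∃ λ g → f w ≡ actW g w) where
    private
      0ᵛ : Vec Bool n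
      0ᵛ = replicate n false
      module Bits = AbGroup (bits n)

    g : Carrier
    g = proj₁ (orbit (first (basis o)))

    permute-0 : ∀ g → permute g 0ᵛ ≡ 0ᵛ
    permute-0 g = cong proj₁ (actW-0 g)

    f-first : ∀ x → ∃ λ h → f (first (basis x)) ≡ first (basis (h • x))
    f-first x = let h , eq = orbit (first (basis x)) in h , trans eq
      (cong₂ _,_ (permute-basis h x) (cong₂ _,_ (permute-0 h) (permute-0 h)))

    f-second : ∀ x → ∃ λ h → f (second (basis x)) ≡ second (basis (h • x))
    f-second x = let h , eq = orbit (second (basis x)) in h , trans eq
      (cong₂ _,_ (permute-0 h) (cong₂ _,_ (permute-basis h x) (permute-0 h)))

    f-third : ∀ x → ∃ λ h → f (third (basis x)) ≡ third (basis (h • x))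
    f-third x = let h , eq = orbit (third (basis x)) in h , trans eq
      (cong₂ _,_ (permute-0 h) (cong₂ _,_ (permute-0 h) (permute-basis h x)))

    f-first-o : f (first (basis o)) ≡ first (basis (g • o))
    f-first-o = proj₂ (f-first o)

    -- f moves the sum of two basis vectors from different copies by a single
    -- element k of G, which is determined by its effect on either summand.
    f-second-g : ∀ x → f (second (basis x)) ≡ second (basis (g • x))
    f-second-g x with f-second x | orbit (first (basis o) + second (basis x))
    ... | h , eq | k , eq′ = trans eq (cong (λ y → second (basis y)) (trans h•x≡k•x (•-cong k≈g x)))
      where
      both : first (basis (g • o)) + second (basis (h • x)) ≡
             actW k (first (basis o)) + actW k (second (basis x))
      both = trans (cong₂ _+_ (sym f-first-o) (sym eq)) (trans (sym (f-+ (first (basis o)) (second (basis x))))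
        (trans eq′ (actW-+ k (first (basis o)) (second (basis x)))))
      k≈g : k ≈ g
      k≈g = •-free o (sym (basis-inj (trans (sym (Bits.+-identityʳ _)) (trans (cong proj₁ both)
        (trans (cong₂ Bits._+_ (permute-basis k o) (permute-0 k)) (Bits.+-identityʳ _))))))
      h•x≡k•x : h • x ≡ k • x
      h•x≡k•x = basis-inj (trans (sym (Bits.+-identityˡ _)) (trans (cong (λ w → proj₁ (proj₂ w)) both)
        (trans (cong₂ Bits._+_ (permute-0 k) (permute-basis k x)) (Bits.+-identityˡ _))))

    f-third-g : ∀ x → f (third (basis x)) ≡ third (basis (g • x))
    f-third-g x with f-third x | orbit (first (basis o) + third (basis x))
    ... | h , eq | k , eq′ = trans eq (cong (λ y → third (basis y)) (trans h•x≡k•x (•-cong k≈g x)))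
      where
      both : first (basis (g • o)) + third (basis (h • x)) ≡
             actW k (first (basis o)) + actW k (third (basis x))
      both = trans (cong₂ _+_ (sym f-first-o) (sym eq)) (trans (sym (f-+ (first (basis o)) (third (basis x))))
        (trans eq′ (actW-+ k (first (basis o)) (third (basis x)))))
      k≈g : k ≈ g
      k≈g = •-free o (sym (basis-inj (trans (sym (Bits.+-identityʳ _)) (trans (cong proj₁ both)
        (trans (cong₂ Bits._+_ (permute-basis k o) (permute-0 k)) (Bits.+-identityʳ _))))))
      h•x≡k•x : h • x ≡ k • x
      h•x≡k•x = basis-inj (trans (sym (Bits.+-identityˡ _)) (trans (cong (λ w → proj₂ (proj₂ w)) both)
        (trans (cong₂ Bits._+_ (permute-0 k) (permute-basis k x)) (Bits.+-identityˡ _))))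

    -- So far `g` is known to act on one basis vector of the first copy only. The others are
    -- compared with the second copy, since a sum of two vectors from the same copy does not tell
    -- which image belongs to which summand.
    f-first-g : ∀ x → f (first (basis x)) ≡ first (basis (g • x))
    f-first-g x with f-first x | orbit (second (basis o) + first (basis x))
    ... | h , eq | k , eq′ = trans eq (cong (λ y → first (basis y)) (trans h•x≡k•x (•-cong k≈g x)))
      where
      both : second (basis (g • o)) + first (basis (h • x)) ≡
             actW k (second (basis o)) + actW k (first (basis x))
      both = trans (cong₂ _+_ (sym (f-second-g o)) (sym eq)) (trans (sym (f-+ (second (basis o)) (first (basis x))))
        (trans eq′ (actW-+ k (second (basis o)) (first (basis x)))))
      k≈g : k ≈ g
      k≈g = •-free o (sym (basis-inj (trans (sym (Bits.+-identityʳ _)) (trans (cong (λ w → proj₁ (proj₂ w)) both)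
        (trans (cong₂ Bits._+_ (permute-basis k o) (permute-0 k)) (Bits.+-identityʳ _))))))
      h•x≡k•x : h • x ≡ k • x
      h•x≡k•x = basis-inj (trans (sym (Bits.+-identityˡ _)) (trans (cong proj₁ both)
        (trans (cong₂ Bits._+_ (permute-0 k) (permute-basis k x)) (Bits.+-identityˡ _))))

    first-+ : ∀ u v → first (u Bits.+ v) ≡ first u + first v
    first-+ u v = cong₂ _,_ refl (cong₂ _,_ (sym (Bits.+-identityˡ 0ᵛ)) (sym (Bits.+-identityˡ 0ᵛ)))

    second-+ : ∀ u v → second (u Bits.+ v) ≡ second u + second v
    second-+ u v = cong₂ _,_ (sym (Bits.+-identityˡ 0ᵛ)) (cong₂ _,_ refl (sym (Bits.+-identityˡ 0ᵛ)))

    third-+ : ∀ u v → third (u Bits.+ v) ≡ third u + third v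
    third-+ u v = cong₂ _,_ (sym (Bits.+-identityˡ 0ᵛ)) (cong₂ _,_ (sym (Bits.+-identityˡ 0ᵛ)) refl)

    along : (k : Vec Bool n → W) → (∀ u v → k (u Bits.+ v) ≡ k u + k v) →
            (∀ x → f (k (basis x)) ≡ actW g (k (basis x))) → ∀ v → f (k v) ≡ actW g (k v)
    along k k-+ eq = additive-≡ groupW {f = λ v → f (k v)} {g = λ v → actW g (k v)}
      (λ u v → trans (cong f (k-+ u v)) (f-+ (k u) (k v)))
      (λ u v → trans (cong (actW g) (k-+ u v)) (actW-+ g (k u) (k v))) eq

    f≡actW : ∀ w → f w ≡ actW g w
    f≡actW (u , v , w) = begin
      f (u , v , w)                                    ≡⟨ cong f split ⟩
      f (first u + (second v + third w))
        ≡⟨ trans (f-+ (first u) (second v + third w)) (cong (f (first u) +_) (f-+ (second v) (third w))) ⟩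
      f (first u) + (f (second v) + f (third w))
        ≡⟨ cong₂ _+_ (along first first-+ on-first u)
                     (cong₂ _+_ (along second second-+ on-second v) (along third third-+ on-third w)) ⟩
      actW g (first u) + (actW g (second v) + actW g (third w))
        ≡⟨ sym (trans (actW-+ g (first u) (second v + third w))
                      (cong (actW g (first u) +_) (actW-+ g (second v) (third w)))) ⟩
      actW g (first u + (second v + third w))          ≡⟨ cong (actW g) (sym split) ⟩
      actW g (u , v , w) ∎
      where
      open ≡-Reasoning
      on-first : ∀ x → f (first (basis x)) ≡ actW g (first (basis x))
      on-first x = trans (f-first-g x)
        (sym (cong₂ _,_ (permute-basis g x) (cong₂ _,_ (permute-0 g) (permute-0 g))))
      on-second : ∀ x → f (second (basis x)) ≡ actW g (second (basis x))
      on-second x = trans (f-second-g x)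
        (sym (cong₂ _,_ (permute-0 g) (cong₂ _,_ (permute-basis g x) (permute-0 g))))
      on-third : ∀ x → f (third (basis x)) ≡ actW g (third (basis x))
      on-third x = trans (f-third-g x)
        (sym (cong₂ _,_ (permute-0 g) (cong₂ _,_ (permute-0 g) (permute-basis g x))))
      split : (u , v , w) ≡ first u + (second v + third w)
      split = cong₂ _,_ (sym (trans (cong (u Bits.+_) (Bits.+-identityˡ 0ᵛ)) (Bits.+-identityʳ u)))
        (cong₂ _,_ (sym (trans (Bits.+-identityˡ _) (Bits.+-identityʳ v)))
                   (sym (trans (Bits.+-identityˡ _) (Bits.+-identityˡ w))))

  abstract
    single-element : (f : W → W) → Additive f → (∀ w → ∃ λ g → f w ≡ actW g w) →
                     ∃ λ g → ∀ w → f w ≡ actW g w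
    single-element f f-+ orbit = Pointwise.g f f-+ orbit , Pointwise.f≡actW f f-+ orbit

    finite : ∃ λ k → V ↔ Fin k
    finite = Σ-finite finiteW (λ w → isNo (w ≟ᵂ 0#))

  size : ℕ
  size = proj₁ finite

  finiteV : V ↔ Fin size
  finiteV = proj₂ finite

  SameOrbit : V → V → Set
  SameOrbit a b = ∃ λ i → b ≡ act (from i) a

  sameOrbit? : ∀ a b → Dec (SameOrbit a b)
  sameOrbit? a b = Finₚ.any? (λ i → b ≟ⱽ act (from i) a)

  orbit-act : ∀ g a → SameOrbit a (act g a)
  orbit-act g a = to g , V-≡ (actW-cong (≈-sym (strictlyInverseʳ g)) (proj₁ a))

  act-act : ∀ g h a → act g (act h a) ≡ act (g ∙ h) a
  act-act g h a = V-≡ (sym (actW-∙ g h (proj₁ a)))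

  act-ε : ∀ a → act ε a ≡ a
  act-ε a = V-≡ (actW-ε (proj₁ a))

  orbit-refl : ∀ a → SameOrbit a a
  orbit-refl a = subst (SameOrbit a) (act-ε a) (orbit-act ε a)

  orbit-sym : ∀ {a b} → SameOrbit a b → SameOrbit b a
  orbit-sym {a} (i , refl) = subst (SameOrbit (act (from i) a))
    (V-≡ (trans (sym (actW-∙ (from i ⁻¹) (from i) (proj₁ a)))
         (trans (actW-cong (inverseˡ (from i)) (proj₁ a)) (actW-ε (proj₁ a)))))
    (orbit-act (from i ⁻¹) (act (from i) a))

  orbit-trans : ∀ {a b c} → SameOrbit a b → SameOrbit b c → SameOrbit a c
  orbit-trans {a} (i , refl) (j , refl) = subst (SameOrbit a) (sym (act-act (from j) (from i) a))
                                                (orbit-act (from j ∙ from i) a)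

  inOrbit : V → Fin size → Bool
  inOrbit a i = does (sameOrbit? a (Inverse.from finiteV i))

  code : V → ℕ
  code a = firstIndex (inOrbit a)

  self-hit : ∀ a → inOrbit a (Inverse.to finiteV a) ≡ true
  self-hit a = dec-true (sameOrbit? a (Inverse.from finiteV (Inverse.to finiteV a)))
    (subst (SameOrbit a) (sym (Inverse.strictlyInverseʳ finiteV a)) (orbit-refl a))

  dec-witness : ∀ {P : Set} (d : Dec P) → does d ≡ true → P
  dec-witness (yes p) _ = p

  representative : ∀ a → ∃ λ i → SameOrbit a (Inverse.from finiteV i) × toℕ i ≡ code a
  representative a =
    let i , hit , eq = firstIndex-hit (inOrbit a) (Inverse.to finiteV a) (self-hit a)
    in i , dec-witness (sameOrbit? a (Inverse.from finiteV i)) hit , eq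

  code< : ∀ a → code a < size
  code< a = let i , _ , eq = representative a in subst (_< size) eq (Finₚ.toℕ<n i)

  code-act : ∀ g a → code (act g a) ≡ code a
  code-act g a = firstIndex-cong (λ i → let b = Inverse.from finiteV i in does-⇔
    (mk⇔ (orbit-trans {a} {act g a} {b} (orbit-act g a))
         (orbit-trans {act g a} {a} {b} (orbit-sym {a} {act g a} (orbit-act g a))))
    (sameOrbit? (act g a) b) (sameOrbit? a b))

  abstract
    code⇒orbit : ∀ {a b} → code b ≡ code a → SameOrbit a b
    code⇒orbit {a} {b} eq = orbit-trans {a} {r} {b} (proj₁ (proj₂ (representative a)))
      (orbit-sym {b} {r} (subst (λ i → SameOrbit b (Inverse.from finiteV i)) index≡ (proj₁ (proj₂ (representative b)))))
      where
      r : V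
      r = Inverse.from finiteV (proj₁ (representative a))
      index≡ : proj₁ (representative b) ≡ proj₁ (representative a)
      index≡ = Finₚ.toℕ-injective (trans (proj₂ (proj₂ (representative b)))
               (trans eq (sym (proj₂ (proj₂ (representative a))))))

  act-inj : ∀ g {a b} → act g a ≡ act g b → a ≡ b
  act-inj g eq = V-≡ (actW-inj g (cong proj₁ eq))

  act-cong : ∀ {g h} → g ≈ h → ∀ a → act g a ≡ act h a
  act-cong g≈h a = V-≡ (actW-cong g≈h (proj₁ a))

  a₀ : V
  a₀ = point (first (basis o)) (λ eq → basis≢0 (cong proj₁ eq))
    where
    basis≢0 : basis o ≢ replicate n false
    basis≢0 eq with () ← trans (sym (dec-true (o Fin.≟ o) refl)) (trans (sym (Vecₚ.lookup∘tabulate _ o))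
      (trans (cong (λ v → lookup v o) eq) (Vecₚ.lookup-replicate o false)))

  act-faithful : ∀ {g h} → act g a₀ ≡ act h a₀ → g ≈ h
  act-faithful {g} {h} eq = •-free o (basis-inj (trans (sym (permute-basis g o))
    (trans (cong (λ a → proj₁ (proj₁ a)) eq) (permute-basis h o))))

  act-full : (π : V → V) → (∀ {a b} → π a ≡ π b → a ≡ b) → (∀ a b → π (a · b) ≡ π a · π b) →
             (∀ a → code (π a) ≡ code a) → ∃ λ g → ∀ a → π a ≡ act g a
  act-full π π-inj π-homo π-code =
    let g , eq = single-element (linear π) (linear-additive π π-inj π-homo) (λ w → orbit w (w ≟ᵂ 0#))
    in g , λ a → V-≡ {π a} {act g a} (trans (sym (linear-V π a)) (eq (proj₁ a)))
    where
    orbit : ∀ w → Dec (w ≡ 0#) → ∃ λ g → linear π w ≡ actW g w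
    orbit w (yes w≡0) = ε , trans (cong (linear π) w≡0) (trans (linear-0 π)
                              (sym (trans (cong (actW ε) w≡0) (actW-0 ε))))
    orbit w (no w≢0)  =
      let i , eq = code⇒orbit {point w w≢0} {π (point w w≢0)} (π-code (point w w≢0))
      in from i , trans (linear-V π (point w w≢0)) (cong proj₁ eq)

  avoid : (f : Fin 5 → V) → ∃ λ c → ∀ i → f i ≢ c
  avoid f = point w (λ eq → w∉ zero (sym eq)) , λ i eq → w∉ (suc i) (cong proj₁ eq)
    where
    n≢0 : 1 ≤ n
    n≢0 = ℕₚ.≤-trans (s≤s z≤n) (Finₚ.toℕ<n o)
    2≤ : 2 ≤ 2 ^ n
    2≤ = ℕₚ.^-monoʳ-≤ 2 n≢0
    -- Even for the trivial group `W` has 8 elements, against the 6 to be avoided: 0 and the five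
    -- given points.
    big : 6 < 2 ^ n *ℕ (2 ^ n *ℕ 2 ^ n)
    big = ℕₚ.≤-trans (ℕₚ.n≤1+n 7) (ℕₚ.*-mono-≤ 2≤ (ℕₚ.*-mono-≤ 2≤ 2≤))
    values : Fin 6 → W
    values zero    = 0#
    values (suc i) = proj₁ (f i)
    w : W
    w = proj₁ (missed ↔-refl finiteW big values)
    w∉ : ∀ i → values i ≢ w
    w∉ = proj₂ (missed ↔-refl finiteW big values)

-- Cyclic differences, holes and orders

module OddCyclic (q : ℕ) where
  open Cyclic (q +ℕ q) public
  private module Z = AbGroup group

  ×ₙ-distrib : ∀ k x y → k Z.×ₙ (x Z.+ y) ≡ k Z.×ₙ x Z.+ k Z.×ₙ y
  ×ₙ-distrib zero    x y = sym (Z.+-identityˡ _)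
  ×ₙ-distrib (suc k) x y = trans (cong ((x Z.+ y) Z.+_) (×ₙ-distrib k x y)) (Z.+-interchange x y _ _)

  -- As b = 1 + 2 q, the number q + 1 is the inverse of 2 modulo b.
  halve : Fin b → Fin b
  halve x = suc q Z.×ₙ x

  halve-double : ∀ x → halve x Z.+ halve x ≡ x
  halve-double x = begin
    suc q Z.×ₙ x Z.+ suc q Z.×ₙ x    ≡⟨ sym (Z.×ₙ-homo-+ (suc q) (suc q) x) ⟩
    (suc q +ℕ suc q) Z.×ₙ x          ≡⟨ cong (λ k → suc k Z.×ₙ x) (ℕₚ.+-suc q q) ⟩
    x Z.+ b Z.×ₙ x                   ≡⟨ cong (x Z.+_) (torsion x) ⟩
    x Z.+ Z.0#                       ≡⟨ Z.+-identityʳ x ⟩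
    x ∎
    where open ≡-Reasoning

  oddGroup : OddGroup (Fin b)
  oddGroup = record { group = group ; _≟_ = Fin._≟_ ; half = halve ; half-double = halve-double
                    ; double-half = λ x → trans (×ₙ-distrib (suc q) x x) (halve-double x) }

  ι-inj : ∀ {k l} → k < b → l < b → ι k ≡ ι l → k ≡ l
  ι-inj {k} {l} k<b l<b eq = trans (sym (DivMod.m<n⇒m%n≡m k<b)) (trans (sym (toℕ-ι k))
    (trans (cong toℕ eq) (trans (toℕ-ι l) (DivMod.m<n⇒m%n≡m l<b))))

  ι-neg : ∀ {k l} → suc (k +ℕ l) < b → ι (suc k) ≢ Z.- ι l
  ι-neg {k} {l} k+l<b eq with () ← ι-inj {suc k +ℕ l} {0} k+l<b (s≤s z≤n)
    (trans (ι-+ (suc k) l) (trans (cong (Z._+ ι l) eq) (Z.+-inverseˡ (ι l))))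

noDifferences : ∀ {B} (G : OddGroup B) → DifferenceSet G (Bool × Fin 0)
noDifferences G = record { D = λ { (_ , ()) } ; neg = λ k → k ; D-inj = λ { {_ , ()} } ; D-neg = λ { (_ , ()) }
                         ; D≢0 = λ { (_ , ()) } ; D? = λ x → no λ { ((_ , ()) , _) } }

module Differences (q r : ℕ) (fits : suc r +ℕ suc r < suc (q +ℕ q)) where
  open OddCyclic q
  private module Z = AbGroup group
  open Signed group

  -- Counting starts at 2 because 1 is reserved for the mark common to all places, while 2 = 1 + 1
  -- is the difference required of `k₀`. It ends at r + 1, below all colours.
  size : Fin r → ℕ
  size j = 2 +ℕ toℕ j

  diff : Bool × Fin r → Fin b
  diff (s , j) = signed s (ι (size j))

  size≤ : ∀ j → size j ≤ suc r
  size≤ j = s≤s (Finₚ.toℕ<n j)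

  small : ∀ j → size j < b
  small j = ℕₚ.≤-<-trans (ℕₚ.≤-trans (size≤ j) (ℕₚ.m≤m+n (suc r) (suc r))) fits

  opposite : ∀ j k → ι (size j) ≢ Z.- ι (size k)
  opposite j k = ι-neg (ℕₚ.≤-<-trans (ℕₚ.+-mono-≤ (size≤ j) (size≤ k)) fits)

  -‿inj : ∀ {x y} → Z.- x ≡ Z.- y → x ≡ y
  -‿inj {x} {y} eq = trans (neg-neg x) (trans (cong Z.-_ eq) (sym (neg-neg y)))
    where
    open Solver group
    neg-neg : ∀ x → x ≡ Z.- Z.- x
    neg-neg x = prove (x ∷ []) v₀ (⊖ ⊖ v₀) refl

  size-inj : ∀ {j k} → ι (size j) ≡ ι (size k) → j ≡ k
  size-inj {j} {k} eq = Finₚ.toℕ-injective (ℕₚ.suc-injective (ℕₚ.suc-injective (ι-inj (small j) (small k) eq)))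

  diff-inj : ∀ {k l} → diff k ≡ diff l → k ≡ l
  diff-inj {false , j} {false , k} eq = cong (false ,_) (size-inj eq)
  diff-inj {true  , j} {true  , k} eq = cong (true ,_) (size-inj (-‿inj eq))
  diff-inj {false , j} {true  , k} eq = ⊥-elim (opposite j k eq)
  diff-inj {true  , j} {false , k} eq = ⊥-elim (opposite k j (sym eq))

  -- The bound on `m +ℕ suc r` keeps `m` below the negatives, the least of which is b - (r + 1).
  diff-avoids : ∀ {m} → m < 2 ⊎ suc r < m → m +ℕ suc r < b → ∀ k → diff k ≢ ι m
  diff-avoids {m} out m<b (false , j) eq = clash out (ι-inj (small j) (ℕₚ.≤-<-trans (ℕₚ.m≤m+n m (suc r)) m<b) eq)
    where
    clash : m < 2 ⊎ suc r < m → size j ≢ m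
    clash (inj₁ (s≤s m<1)) refl = ℕₚ.<⇒≱ m<1 (s≤s z≤n)
    clash (inj₂ r<m)       refl = ℕₚ.<⇒≱ r<m (size≤ j)
  diff-avoids {m} out m<b (true , j) eq =
    ι-neg {suc (toℕ j)} {m} (ℕₚ.≤-<-trans (ℕₚ.≤-trans (ℕₚ.+-monoˡ-≤ m (size≤ j)) (ℕₚ.≤-reflexive (ℕₚ.+-comm (suc r) m))) m<b)
      (-‿inj (trans eq (prove (ι m ∷ []) v₀ (⊖ ⊖ v₀) refl)))
    where open Solver group

  differences : DifferenceSet oddGroup (Bool × Fin r)
  differences = record
    { D     = diff
    ; neg   = λ { (s , j) → not s , j }
    ; D-inj = diff-inj
    ; D-neg = λ { (false , j) → refl ; (true , j) → prove (ι (size j) ∷ []) v₀ (⊖ ⊖ v₀) refl }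
    ; D≢0   = diff-avoids (inj₁ (s≤s z≤n)) (ℕₚ.≤-<-trans (ℕₚ.m≤m+n (suc r) (suc r)) fits)
    ; D?    = diff? }
    where
    open Solver group
    diff? : ∀ x → Dec (∃ λ k → diff k ≡ x)
    diff? x with Finₚ.any? (λ j → ι (size j) Fin.≟ x) | Finₚ.any? (λ j → Z.- ι (size j) Fin.≟ x)
    ... | yes (j , eq) | _            = yes ((false , j) , eq)
    ... | no _         | yes (j , eq) = yes ((true , j) , eq)
    ... | no ¬f        | no ¬t        = no λ { ((false , j) , eq) → ¬f (j , eq) ; ((true , j) , eq) → ¬t (j , eq) }

module DecideHole {k : ℕ} (line : Bool × Fin 3 → Bool × Fin 3 → Fin k ⊎ (Bool × Fin 3))
                  (act : Fin k → Bool × Fin 3 → Bool × Fin 3) where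
  S : Set
  S = Bool × Fin 3

  _≟ˢ_ : DecidableEquality S
  _≟ˢ_ = Productₚ.≡-dec Boolₚ._≟_ Fin._≟_

  _≟ʷ_ : DecidableEquality (Fin k ⊎ S)
  _≟ʷ_ = Sumₚ.≡-dec Fin._≟_ _≟ˢ_

  all : {P : S → Set} → (∀ s → Dec (P s)) → Dec (∀ s → P s)
  all P? = map′ (λ { (f , t) (false , ℓ) → f ℓ ; (f , t) (true , ℓ) → t ℓ })
                (λ p → (λ ℓ → p (false , ℓ)) , (λ ℓ → p (true , ℓ)))
                (Finₚ.all? (λ ℓ → P? (false , ℓ)) ×-dec Finₚ.all? (λ ℓ → P? (true , ℓ)))

  -- The laws `act-line` and `line-line` together, indexed by the value of `line s t`, so that
  -- deciding them takes a quantifier over s and t only.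
  Closes : S → S → Fin k ⊎ S → Set
  Closes s t (inj₁ e) = act e s ≡ t
  Closes s t (inj₂ u) = line s u ≡ inj₂ t

  closes? : ∀ s t w → Dec (Closes s t w)
  closes? s t (inj₁ e) = act e s ≟ˢ t
  closes? s t (inj₂ u) = line s u ≟ʷ inj₂ t

  idem? : Dec (∀ s → line s s ≡ inj₂ s)
  idem? = all (λ s → line s s ≟ʷ inj₂ s)

  comm? : Dec (∀ s t → line s t ≡ line t s)
  comm? = all (λ s → all (λ t → line s t ≟ʷ line t s))

  act? : Dec (∀ e s → line s (act e s) ≡ inj₁ e)
  act? = Finₚ.all? (λ e → all (λ s → line s (act e s) ≟ʷ inj₁ e))

  close? : Dec (∀ s t → Closes s t (line s t))
  close? = all (λ s → all (λ t → closes? s t (line s t)))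

module _ where
  open AbGroup Level₃
  open Signed Level₃

  -- The Fano plane: three lines through the point of `Fin 1`, and four with one point on each level
  -- and bits of sum zero.
  line₁ : Bool × Fin 3 → Bool × Fin 3 → Fin 1 ⊎ (Bool × Fin 3)
  line₁ (ε , ℓ) (δ , m) with levels ℓ m
  ... | same _    = if ε xor δ then inj₁ 0F else inj₂ (ε , ℓ)
  ... | rising _  = inj₂ (ε xor δ , up m)
  ... | falling _ = inj₂ (ε xor δ , up ℓ)

  act₁ : Fin 1 → Bool × Fin 3 → Bool × Fin 3
  act₁ _ (ε , ℓ) = not ε , ℓ + signed ε 0F

  hole₁ : Hole (Fin 1)
  hole₁ = record
    { ∞ = 0F ; shift = λ _ → 0F ; shift-∞ = refl ; shift-0 = λ { {0F} _ → refl } ; line = line₁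
    ; line-idem = toWitness {a? = idem?} tt
    ; line-comm = toWitness {a? = comm?} tt
    ; line-act  = toWitness {a? = act?} tt
    ; act-line  = λ {s} {t} eq → subst (Closes s t) eq (toWitness {a? = close?} tt s t)
    ; line-line = λ {s} {t} eq → subst (Closes s t) eq (toWitness {a? = close?} tt s t) }
    where open DecideHole line₁ act₁

  -- The affine plane of order 3, in which `Fin 3` and the two bits give the three lines of one
  -- parallel class.
  line₃ : Bool × Fin 3 → Bool × Fin 3 → Fin 3 ⊎ (Bool × Fin 3)
  line₃ (false , ℓ) (true , m) = inj₁ (m + - ℓ)
  line₃ (true , ℓ) (false , m) = inj₁ (ℓ + - m)
  line₃ (ε , ℓ) (_ , m) with levels ℓ m
  ... | same _    = inj₂ (ε , ℓ)
  ... | rising _  = inj₂ (ε , up m)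
  ... | falling _ = inj₂ (ε , up ℓ)

  act₃ : Fin 3 → Bool × Fin 3 → Bool × Fin 3
  act₃ e (ε , ℓ) = not ε , ℓ + signed ε e

  hole₃ : Hole (Fin 3)
  hole₃ = record
    { ∞ = 0F ; shift = λ e → e ; shift-∞ = refl ; shift-0 = λ eq → eq ; line = line₃
    ; line-idem = toWitness {a? = idem?} tt
    ; line-comm = toWitness {a? = comm?} tt
    ; line-act  = toWitness {a? = act?} tt
    ; act-line  = λ {s} {t} eq → subst (Closes s t) eq (toWitness {a? = close?} tt s t)
    ; line-line = λ {s} {t} eq → subst (Closes s t) eq (toWitness {a? = close?} tt s t) }
    where open DecideHole line₃ act₃

  steiner₃ : Steiner (Fin 3)
  steiner₃ = record
    { _·_   = λ x y → - (x + y)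
    ; idem  = λ { 0F → refl ; 1F → refl ; 2F → refl }
    ; comm  = λ x y → cong -_ (+-comm x y)
    ; invol = λ x y → prove (x ∷ y ∷ []) (⊖ (v₀ ⊕ ⊖ (v₀ ⊕ v₁))) v₁ refl }
    where open Solver Level₃

steiner₁ : Steiner (Fin 1)
steiner₁ = record { _·_ = λ _ _ → 0F ; idem = λ { 0F → refl } ; comm = λ _ _ → refl ; invol = λ { _ 0F → refl } }

steiner-⊤ : Steiner ⊤
steiner-⊤ = record { _·_ = λ _ _ → tt ; idem = λ _ → refl ; comm = λ _ _ → refl ; invol = λ _ _ → refl }

Special : Set → ℕ → Set
Special E r = E ⊎ ((Bool × Fin r) × Fin 3)

special-finite : ∀ {E : Set} {e} → E ↔ Fin e → ∀ r → Special E r ↔ Fin (e +ℕ 2 *ℕ r *ℕ 3)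
special-finite eE r = ↔-trans (eE ⊎-↔ ↔-trans (↔-trans (↔-sym Finₚ.2↔Bool ×-↔ ↔-refl) (↔-sym Finₚ.*↔×) ×-↔ ↔-refl)
                                              (↔-sym Finₚ.*↔×)) (↔-sym Finₚ.+↔⊎)

point-finite : ∀ {V : Set} {v} → V ↔ Fin v → ∀ b → (V × (Bool × Fin 3 × Fin b)) ↔ Fin (v *ℕ (2 *ℕ (3 *ℕ b)))
point-finite eV b = ↔-trans (eV ×-↔ ↔-trans (↔-sym Finₚ.2↔Bool ×-↔ ↔-sym Finₚ.*↔×) (↔-sym Finₚ.*↔×)) (↔-sym Finₚ.*↔×)

module Finite {E : Set} {e : ℕ} (eE : E ↔ Fin e) {V : Set} {v : ℕ} (eV : V ↔ Fin v) (r b : ℕ) where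
  finite : (Special E r ⊎ (V × (Bool × Fin 3 × Fin b))) ↔ Fin ((e +ℕ 2 *ℕ r *ℕ 3) +ℕ v *ℕ (2 *ℕ (3 *ℕ b)))
  finite = ↔-trans (special-finite eE r ⊎-↔ point-finite eV b) (↔-sym Finₚ.+↔⊎)

↔-size : ∀ {A C : Set} {m n} → A ↔ Fin m → C ↔ Fin n → m ≡ n → A ↔ C
↔-size eA eC refl = ↔-trans eA (↔-sym eC)

-- The special part is itself filled by the construction over a single place, with
-- K empty or, when r is even, with r = 1 inside it.
module Fill {E : Set} {e : ℕ} (eE : E ↔ Fin e) (H : Hole E) (SE : Steiner E) where
  open +-*-Solver

  untwisted : Fin 3 → ∀ {B : Set} → B → B → Bool
  untwisted _ _ _ = false

  over-one : ∀ {B K} (G : OddGroup B) → DifferenceSet G K → Steiner (E ⊎ (K × Fin 3)) →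
             Steiner ((E ⊎ (K × Fin 3)) ⊎ (⊤ × (Bool × Fin 3 × B)))
  over-one {B} G 𝔻 SY = BoseProduct.steiner G 𝔻 H steiner-⊤ (λ _ _ → yes refl) (λ _ ℓ → untwisted ℓ {B})
                          (λ _ _ _ _ → refl) SY

  odd : ∀ q → Steiner (Special E (suc (q +ℕ q)))
  odd q = transport (↔-size (Finite.finite eE (↔-sym Finₚ.1↔⊤) 0 (suc (q +ℕ q))) (special-finite eE (suc (q +ℕ q)))
                      (solve 2 (λ e r → (e :+ con 0) :+ con 1 :* (con 2 :* (con 3 :* r)) := e :+ con 2 :* r :* con 3)
                        refl e (suc (q +ℕ q))))
    (over-one (OddCyclic.oddGroup q) (noDifferences (OddCyclic.oddGroup q))
      (transport (↔-size eE (special-finite eE 0) (solve 1 (λ e → e := e :+ con 0) refl e)) SE))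

  -- Here b = r - 1, and the differences are 2 and -2. The condition on `q` is the inequality 4 < 1
  -- + 2 q that `Differences` demands, and it is the origin of the 6 in `fill`.
  even : ∀ q → 2 ≤ q → Steiner (Special E (suc (suc (q +ℕ q))))
  even q 2≤q = transport (↔-size (Finite.finite eE (↔-sym Finₚ.1↔⊤) 1 (suc (q +ℕ q)))
                      (special-finite eE (suc (suc (q +ℕ q))))
                      (solve 2 (λ e r → (e :+ con 6) :+ con 1 :* (con 2 :* (con 3 :* r)) := e :+ con 2 :* (con 1 :+ r) :* con 3)
                        refl e (suc (q +ℕ q))))
    (over-one (OddCyclic.oddGroup q) (Differences.differences q 1 (s≤s (ℕₚ.+-mono-≤ 2≤q 2≤q))) (odd 0))

  parity : ∀ n → ∃ λ q → n ≡ q +ℕ q ⊎ n ≡ suc (q +ℕ q)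
  parity zero = 0 , inj₁ refl
  parity (suc n) with parity n
  ... | q , inj₁ eq = q , inj₂ (cong suc eq)
  ... | q , inj₂ eq = suc q , inj₁ (cong suc (trans eq (sym (ℕₚ.+-suc q q))))

  fill : ∀ r → Steiner (Special E (6 +ℕ r))
  fill r with parity r
  ... | q , inj₁ refl = subst (λ r → Steiner (Special E r)) (even-≡ q) (even (2 +ℕ q) (s≤s (s≤s z≤n)))
    where
    even-≡ : ∀ q → 2 +ℕ ((2 +ℕ q) +ℕ (2 +ℕ q)) ≡ 6 +ℕ (q +ℕ q)
    even-≡ = solve 1 (λ q → con 2 :+ ((con 2 :+ q) :+ (con 2 :+ q)) := con 6 :+ (q :+ q)) refl
  ... | q , inj₂ refl = subst (λ r → Steiner (Special E r)) (odd-≡ q) (odd (3 +ℕ q))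
    where
    odd-≡ : ∀ q → suc ((3 +ℕ q) +ℕ (3 +ℕ q)) ≡ 6 +ℕ suc (q +ℕ q)
    odd-≡ = solve 1 (λ q → con 1 :+ ((con 3 :+ q) :+ (con 3 :+ q)) := con 6 :+ (con 1 :+ (q :+ q))) refl

-- The order e + 6 w is reached with w = r + v b, where 6 ≤ r < 6 + 6 v and
-- b = 1 + 6 p, so that b grows with w while r stays bounded.
module Sizes (v w : ℕ) .{{_ : NonZero v}} where
  open +-*-Solver

  -- The term `(6 +ℕ N) *ℕ N` forces p to be at least 6 + N, hence b to be at least 37 + 6 N,
  -- whereas |Y| is at most 33 + 6 N when |E| is at most 3.
  N bound : ℕ
  N = 6 *ℕ v
  bound = (6 +ℕ v) +ℕ (6 +ℕ N) *ℕ N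

  instance
    N≢0 : NonZero N
    N≢0 = ℕₚ.m*n≢0 6 v

  excess : ℕ
  excess = w ∸ (6 +ℕ v)

  ρ p r b : ℕ
  ρ = excess % N
  p = excess / N
  r = 6 +ℕ ρ
  b = suc (3 *ℕ p +ℕ 3 *ℕ p)

  module _ (large : bound ≤ w) where
    w≡ : w ≡ r +ℕ v *ℕ b
    w≡ = begin
      w                                      ≡⟨ sym (ℕₚ.m+[n∸m]≡n (ℕₚ.≤-trans (ℕₚ.m≤m+n (6 +ℕ v) _) large)) ⟩
      (6 +ℕ v) +ℕ excess                     ≡⟨ cong ((6 +ℕ v) +ℕ_) (DivMod.m≡m%n+[m/n]*n excess N) ⟩
      (6 +ℕ v) +ℕ (ρ +ℕ p *ℕ N)              ≡⟨ solve 3 (λ v ρ p → (con 6 :+ v) :+ (ρ :+ p :* (con 6 :* v))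
                                                 := (con 6 :+ ρ) :+ v :* (con 1 :+ (con 3 :* p :+ con 3 :* p))) refl v ρ p ⟩
      r +ℕ v *ℕ b ∎
      where open ≡-Reasoning

    6+N≤p : 6 +ℕ N ≤ p
    6+N≤p = begin
      6 +ℕ N                          ≡⟨ sym (DivMod.m*n/n≡m (6 +ℕ N) N) ⟩
      (6 +ℕ N) *ℕ N / N               ≡⟨ cong (_/ N) (sym (ℕₚ.m+n∸m≡n (6 +ℕ v) ((6 +ℕ N) *ℕ N))) ⟩
      (bound ∸ (6 +ℕ v)) / N          ≤⟨ DivMod./-monoˡ-≤ N (ℕₚ.∸-monoˡ-≤ (6 +ℕ v) large) ⟩
      p ∎
      where open ℕₚ.≤-Reasoning

    37+6N≤b : 37 +ℕ 6 *ℕ N ≤ b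
    37+6N≤b = begin
      37 +ℕ 6 *ℕ N
        ≡⟨ solve 1 (λ N → con 37 :+ con 6 :* N
             := con 1 :+ (con 3 :* (con 6 :+ N) :+ con 3 :* (con 6 :+ N))) refl N ⟩
      suc (3 *ℕ (6 +ℕ N) +ℕ 3 *ℕ (6 +ℕ N))    ≤⟨ s≤s (ℕₚ.+-mono-≤ (ℕₚ.*-monoʳ-≤ 3 6+N≤p) (ℕₚ.*-monoʳ-≤ 3 6+N≤p)) ⟩
      b ∎
      where open ℕₚ.≤-Reasoning

    ρ<N : suc ρ ≤ N
    ρ<N = DivMod.m%n<n excess N

    special<b : ∀ {e} → e ≤ 3 → e +ℕ 2 *ℕ r *ℕ 3 < b
    special<b {e} e≤3 = begin-strict
      e +ℕ 2 *ℕ r *ℕ 3              ≤⟨ ℕₚ.+-monoˡ-≤ (2 *ℕ r *ℕ 3) e≤3 ⟩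
      3 +ℕ 2 *ℕ r *ℕ 3
        ≡⟨ solve 1 (λ ρ → con 3 :+ con 2 :* (con 6 :+ ρ) :* con 3 := con 33 :+ con 6 :* (con 1 :+ ρ)) refl ρ ⟩
      33 +ℕ 6 *ℕ suc ρ              ≤⟨ ℕₚ.+-monoʳ-≤ 33 (ℕₚ.*-monoʳ-≤ 6 ρ<N) ⟩
      33 +ℕ 6 *ℕ N                  <⟨ ℕₚ.+-monoˡ-≤ (6 *ℕ N) (ℕₚ.m≤m+n 34 3) ⟩
      37 +ℕ 6 *ℕ N                  ≤⟨ 37+6N≤b ⟩
      b ∎
      where open ℕₚ.≤-Reasoning

    code-fits : ∀ {k} → k < v → (2 +ℕ r +ℕ k) +ℕ suc r < b
    code-fits {k} k<v = begin-strict
      (2 +ℕ r +ℕ k) +ℕ suc r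
        ≡⟨ solve 2 (λ ρ k → (con 2 :+ (con 6 :+ ρ) :+ k) :+ (con 7 :+ ρ)
             := con 12 :+ con 2 :* (con 1 :+ ρ) :+ (con 1 :+ k)) refl ρ k ⟩
      12 +ℕ 2 *ℕ suc ρ +ℕ suc k     ≤⟨ ℕₚ.+-mono-≤ (ℕₚ.+-monoʳ-≤ 12 (ℕₚ.*-monoʳ-≤ 2 ρ<N)) k<v ⟩
      12 +ℕ 2 *ℕ N +ℕ v             ≤⟨ ℕₚ.m≤m+n _ _ ⟩
      12 +ℕ 2 *ℕ N +ℕ v +ℕ (24 +ℕ 3 *ℕ N +ℕ 5 *ℕ v)
        ≡⟨ solve 1 (λ v → con 12 :+ con 2 :* (con 6 :* v) :+ v :+ (con 24 :+ con 3 :* (con 6 :* v) :+ con 5 :* v)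
             := con 36 :+ con 6 :* (con 6 :* v)) refl v ⟩
      36 +ℕ 6 *ℕ N                  <⟨ ℕₚ.n<1+n _ ⟩
      37 +ℕ 6 *ℕ N                  ≤⟨ 37+6N≤b ⟩
      b ∎
      where open ℕₚ.≤-Reasoning

    fits : suc r +ℕ suc r < b
    fits = begin-strict
      suc r +ℕ suc r                ≤⟨ ℕₚ.+-monoˡ-≤ (suc r) (ℕₚ.≤-trans (ℕₚ.n≤1+n _) (ℕₚ.m≤m+n (2 +ℕ r) 0)) ⟩
      (2 +ℕ r +ℕ 0) +ℕ suc r        <⟨ code-fits (>-nonZero⁻¹ v) ⟩
      b ∎
      where open ℕₚ.≤-Reasoning

-- Assembly for a given order

module Construction {c ℓ} (G : Group c ℓ) {n : ℕ} (finG : Inverse (Group.setoid G) (setoid (Fin n)))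
  {E : Set} {e : ℕ} (eE : E ↔ Fin e) (H : Hole E) (SE : Steiner E) where
  private module Places = Regular G finG

  v : ℕ
  v = Places.size

  module WithSizes (p ρ w : ℕ) (w≡ : w ≡ (6 +ℕ ρ) +ℕ v *ℕ suc (3 *ℕ p +ℕ 3 *ℕ p))
    (special<b : e +ℕ 2 *ℕ (6 +ℕ ρ) *ℕ 3 < suc (3 *ℕ p +ℕ 3 *ℕ p))
    (code-fits : ∀ {k} → k < v → (8 +ℕ ρ +ℕ k) +ℕ (7 +ℕ ρ) < suc (3 *ℕ p +ℕ 3 *ℕ p))
    (fits : (7 +ℕ ρ) +ℕ (7 +ℕ ρ) < suc (3 *ℕ p +ℕ 3 *ℕ p)) where

    r b : ℕ
    r = 6 +ℕ ρ
    b = suc (3 *ℕ p +ℕ 3 *ℕ p)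

    open OddCyclic (3 *ℕ p) using (ι; oddGroup; ι-inj; ι-+; group; torsion; generates; ×ₙ-distrib)
    open Differences (3 *ℕ p) r fits using (differences; diff-avoids)
    open DifferenceSet differences using (D)
    private module Z = AbGroup group

    -- The offset puts the colours just above r + 1, the largest size in the difference set.
    mark-index : Places.V → ℕ
    mark-index a = 2 +ℕ r +ℕ Places.code a

    mark-index< : ∀ a → mark-index a < b
    mark-index< a = ℕₚ.≤-<-trans (ℕₚ.m≤m+n _ (suc r)) (code-fits (Places.code< a))

    label : Places.V → Fin b
    label a = ι (mark-index a)

    special-size : Special E r ↔ Fin (e +ℕ 2 *ℕ r *ℕ 3)
    special-size = special-finite eE r

    finiteU : (Special E r ⊎ (Places.V × (Bool × Fin 3 × Fin b))) ↔ Fin (e +ℕ w *ℕ 6)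
    finiteU = subst (λ m → (Special E r ⊎ (Places.V × (Bool × Fin 3 × Fin b))) ↔ Fin m)
      (trans (solve 4 (λ e r v b → (e :+ con 2 :* r :* con 3) :+ v :* (con 2 :* (con 3 :* b)) := e :+ (r :+ v :* b) :* con 6)
                refl e r v b) (cong (λ w → e +ℕ w *ℕ 6) (sym w≡)))
      (Finite.finite eE Places.finiteV r b)
      where open +-*-Solver

    -- With b = 1 + 6 p one has 3 (1 + 4 p) = 1 + 2 b, so 1 + 4 p is the inverse of 3 modulo b.
    third : Fin b → Fin b
    third x = suc (4 *ℕ p) Z.×ₙ x

    3×third : ∀ x → third x Z.+ third x Z.+ third x ≡ x
    3×third x = begin
      third x Z.+ third x Z.+ third x
        ≡⟨ cong (Z._+ third x) (sym (Z.×ₙ-homo-+ k k x)) ⟩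
      (k +ℕ k) Z.×ₙ x Z.+ third x
        ≡⟨ sym (Z.×ₙ-homo-+ (k +ℕ k) k x) ⟩
      (k +ℕ k +ℕ k) Z.×ₙ x
        ≡⟨ cong (Z._×ₙ x) (solve 1 (λ p → let k = con 1 :+ con 4 :* p ; b = con 1 :+ (con 3 :* p :+ con 3 :* p) in
             k :+ k :+ k := con 1 :+ (b :+ b)) refl p) ⟩
      (1 +ℕ (b +ℕ b)) Z.×ₙ x
        ≡⟨ cong (x Z.+_) (Z.×ₙ-homo-+ b b x) ⟩
      x Z.+ (b Z.×ₙ x Z.+ b Z.×ₙ x)
        ≡⟨ cong (x Z.+_) (trans (cong₂ Z._+_ (torsion x) (torsion x)) (Z.+-identityˡ Z.0#)) ⟩
      x Z.+ Z.0#
        ≡⟨ Z.+-identityʳ x ⟩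
      x ∎
      where
      open ≡-Reasoning
      open +-*-Solver
      k : ℕ
      k = suc (4 *ℕ p)

    3-free : ∀ {x} → x Z.+ x Z.+ x ≡ Z.0# → x ≡ Z.0#
    3-free {x} eq = begin
      x                                  ≡⟨ sym (3×third x) ⟩
      third x Z.+ third x Z.+ third x    ≡⟨ cong (Z._+ third x) (sym (×ₙ-distrib (suc (4 *ℕ p)) x x)) ⟩
      third (x Z.+ x) Z.+ third x        ≡⟨ sym (×ₙ-distrib (suc (4 *ℕ p)) (x Z.+ x) x) ⟩
      third (x Z.+ x Z.+ x)              ≡⟨ cong third eq ⟩
      third Z.0#                         ≡⟨ Z.+-cancelʳ (third Z.0#) (trans (sym (×ₙ-distrib (suc (4 *ℕ p)) Z.0# Z.0#))
                                              (trans (cong third (Z.+-identityˡ Z.0#)) (sym (Z.+-identityˡ _)))) ⟩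
      Z.0# ∎
      where open ≡-Reasoning

    1<b : 1 < b
    1<b = ℕₚ.≤-<-trans (s≤s z≤n) fits

    label-inj : ∀ {a a′} → label a ≡ label a′ → Places.code a ≡ Places.code a′
    label-inj {a} {a′} eq = ℕₚ.+-cancelˡ-≡ (2 +ℕ r) _ _ (ι-inj (mark-index< a) (mark-index< a′) eq)

    abstract
      special-steiner : Steiner (Special E r)
      special-steiner = Fill.fill eE H SE ρ

      _≟ᵁ_ : DecidableEquality (Special E r ⊎ (Places.V × (Bool × Fin 3 × Fin b)))
      _≟ᵁ_ = ↔-dec finiteU

      fresh : (f : Special E r → Fin b) → ∃ λ x → ∀ y → f y ≢ x
      fresh = missed special-size ↔-refl special<b

      ¬embed : (f : Fin b → Special E r) → ¬ (∀ {x y} → f x ≡ f y → x ≡ y)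
      ¬embed = ¬injection special-size ↔-refl special<b

      third-of : ∀ x → ∃ λ z → z Z.+ z Z.+ z ≡ x
      third-of x = third x , 3×third x

      one≢0 : ι 1 ≢ Z.0#
      one≢0 eq = ℕₚ.1+n≢0 (ι-inj 1<b (ℕₚ.<-trans (s≤s z≤n) 1<b) eq)

      label≢0 : ∀ a → label a ≢ Z.0#
      label≢0 a eq = ℕₚ.1+n≢0 (ι-inj (mark-index< a) (ℕₚ.<-trans (s≤s z≤n) 1<b) eq)

      one∉D : ∀ k → D k ≢ ι 1
      one∉D = diff-avoids (inj₁ (s≤s (s≤s z≤n))) (ℕₚ.≤-<-trans (ℕₚ.+-monoˡ-≤ (suc r) (s≤s (z≤n {r}))) fits)

      label∉D : ∀ a k → D k ≢ label a
      label∉D a = diff-avoids (inj₂ (ℕₚ.m≤m+n (2 +ℕ r) (Places.code a))) (code-fits (Places.code< a))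

      D-k₀ : D (false , zero) ≡ ι 1 Z.+ ι 1
      D-k₀ = ι-+ 1 1

    action : FullAction G _
    action = Rigidity.fullAction oddGroup differences H Places.steinerV Places._≟ⱽ_ (ι 1) label special-steiner _≟ᵁ_
      fresh ¬embed Places.avoid Places.veblen Places.a₀ (false , zero) generates D-k₀ 3-free third-of
      one≢0 label≢0 one∉D label∉D
      G Places.act Places.act-cong Places.act-ε (λ g h a → sym (Places.act-act g h a)) Places.act-inj Places.act-homo
      (λ g a → cong (λ k → ι (2 +ℕ r +ℕ k)) (Places.code-act g a)) Places.act-faithful
      (λ π π-inj π-homo label-π → Places.act-full π π-inj π-homo (λ a → label-inj {π a} {a} (label-π a)))

    realized : Σ (STS (e +ℕ w *ℕ 6)) λ U → ∃ λ (φ : Group.Carrier G → Aut U) →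
               GroupMorphisms.IsGroupIsomorphism (Group.rawGroup G) (AutGroup U) φ
    realized = realize G action finiteU

theorem1p1 : ∀ {c ℓ : Level} (G : Group c ℓ) → IsFinite G →
    ∃ λ (M : ℕ) → ∀ (u : ℕ) → M ≤ u → (u % 6 ≡ 1 ⊎ u % 6 ≡ 3) →
    Σ (STS u) λ U → ∃ λ (φ : Group.Carrier G → Aut U) →
    GroupMorphisms.IsGroupIsomorphism (Group.rawGroup G) (AutGroup U) φ
theorem1p1 G (n , finG) = bound *ℕ 6 , realization
  where
  module Places = Regular G finG
  v : ℕ
  v = Places.size
  instance
    v≢0 : NonZero v
    v≢0 = >-nonZero (ℕₚ.≤-<-trans z≤n (Places.code< Places.a₀))
  bound : ℕ
  -- The bound must be named before `u`, so 0 stands in for `w`; its value is determined by `v`.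
  bound = Sizes.bound v 0
  Realized : ℕ → Set _
  Realized u = Σ (STS u) λ U → ∃ λ (φ : Group.Carrier G → Aut U) →
               GroupMorphisms.IsGroupIsomorphism (Group.rawGroup G) (AutGroup U) φ
  realization : ∀ u → bound *ℕ 6 ≤ u → (u % 6 ≡ 1 ⊎ u % 6 ≡ 3) → Realized u
  realization u large residue = pick residue
    where
    w : ℕ
    w = u / 6
    enough : bound ≤ w
    enough = subst (_≤ w) (DivMod.m*n/n≡m bound 6) (DivMod./-monoˡ-≤ 6 large)
    open Sizes v w
    with-special : ∀ {E : Set} {e} → E ↔ Fin e → e ≤ 3 → Hole E → Steiner E → u % 6 ≡ e → Realized u
    with-special eE e≤3 H SE eq = subst Realized
      (sym (trans (DivMod.m≡m%n+[m/n]*n u 6) (cong (_+ℕ w *ℕ 6) eq)))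
      (Construction.WithSizes.realized G finG eE H SE p ρ w
        (w≡ enough) (special<b enough e≤3) (code-fits enough) (fits enough))
    pick : (u % 6 ≡ 1 ⊎ u % 6 ≡ 3) → Realized u
    pick (inj₁ eq) = with-special ↔-refl (s≤s z≤n) hole₁ steiner₁ eq
    pick (inj₂ eq) = with-special ↔-refl ℕₚ.≤-refl hole₃ steiner₃ eq
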